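{- Let $s\geq 3$ be an integer, $m=2s$, $q=2^m$, and let $$\overline{\mathcal{C}_1^{\bot}}^{\bot}=\{(\mathrm{Tr}_1^m(ax^5+bx^3+cx)+h)_{x\in\mathbb{F}_q}: a,b,c\in\mathbb{F}_q,\ h\in\mathbb{F}_2\}.$$ For every $i\ge 1$ such that this code contains a codeword of weight $i$, the supports of the codewords of weight $i$ form the block set of a $2$-design on the set $\mathcal{P}$ of the $2^m$ coordinate positions. Moreover, for each of the following pairs $(i,\lambda)$, the supports of the codewords of weight $i$ form a $2$-$(2^m,i,\lambda)$ design: - $i=2^{2s-1}$, $\lambda=\dfrac{(29\cdot 2^{6s-6}-33\cdot 2^{4s-6}+17\cdot 2^{2s-4}-1)(2^{2s-1}-1)}{2^{2s}-1}$; - $i=2^{2s-1}-2^{s-1}$, $\lambda=\dfrac{2}{15}\cdot\dfrac{2^{s-1}(3\cdot 2^{4s}+5\cdot 2^{2s}-8)(2^{2s-1}-2^{s-1}-1)}{2^s+1}$; - $i=2^{2s-1}+2^{s-1}$, $\lambda=\dfrac{2}{15}\cdot\dfrac{2^{s-1}(3\cdot 2^{4s}+5\cdot 2^{2s}-8)(2^{2s-1}+2^{s-1}-1)}{2^s-1}$; - $i=2^{2s-1}-2^{s}$, $\lambda=\dfrac{7}{3}\cdot 2^{3s-4}(2^{2s-1}-2^s-1)(2^{s-1}-1)$; - $i=2^{2s-1}+2^{s}$, $\lambda=\dfrac{7}{3}\cdot 2^{3s-4}(2^{2s-1}+2^s-1)(2^{s-1}+1)$; - $i=2^{2s-1}-2^{s+1}$,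 $\lambda=\dfrac{1}{15}\cdot\dfrac{2^{s-3}(2^{4s-2}-5\cdot 2^{2s-2}+1)(2^{2s-1}-2^{s+1}-1)(2^{s-2}-1)}{2^{2s}-1}$; - $i=2^{2s-1}+2^{s+1}$, $\lambda=\dfrac{1}{15}\cdot\dfrac{2^{s-3}(2^{4s-2}-5\cdot 2^{2s-2}+1)(2^{2s-1}+2^{s+1}-1)(2^{s-2}+1)}{2^{2s}-1}$.
   Context: $\mathbb{F}_q$ is the finite field with $q=2^m$ elements, and $\mathrm{Tr}_1^m$ is the trace function from $\mathbb{F}_{2^m}$ onto $\mathbb{F}_2$. The coordinate positions of the code are indexed by $\mathbb{F}_q$, identified by a fixed bijection with $\mathcal{P}=\{0,1,\ldots,2^m-1\}$. The support of a codeword is the set of positions where it is nonzero. For $1\le t\le k\le v$, a $t$-$(v,k,\lambda)$ design is a pair $(\mathcal{P},\mathcal{B})$ where $\mathcal{P}$ is a set of $v$ points and $\mathcal{B}$ is a set of $k$-subsets (blocks) of $\mathcal{P}$ such that every $t$-subset of $\mathcal{P}$ is contained in exactly $\lambda$ elements of $\mathcal{B}$; the case $k=v$ is a trivial design. A $t$-design is a $t$-$(v,k,\lambda)$ design for some $v,k,\lambda$. -}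

module Defs where

open import Level using (Level; suc; _⊔_)
open import Algebra.Bundles using (CommutativeRing; Semiring)
import Algebra.Definitions.RawMonoid as RawMonoidDefinitions
import Algebra.Definitions.RawSemiring as RawSemiringDefinitions
open import Data.Fin.Base using (Fin; toℕ)
import Data.Fin.Properties as Fin
open import Data.Fin.Subset using (Subset; ∣_∣; _⊆_)
open import Data.Integer.Base using (ℤ; +_)
open import Data.List.Base using (List; []; _∷_; length)
open import Data.List.Membership.Propositional using (_∈_)
open import Data.List.Relation.Unary.Unique.Propositional using (Unique)
open import Data.Nat.Base as ℕ using (ℕ; NonZero; _≤_; s≤s; z≤n)
import Data.Nat.Properties as ℕ
open import Data.Product.Base using (∃; ∃-syntax; _×_; _,_)
open import Data.Rational.Base as ℚ using (ℚ; _/_)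
open import Data.Sum.Base using (_⊎_)
open import Data.Vec.Base using (tabulate)
open import Function.Base using (_∘_)
open import Function.Bundles using (Inverse; _⇔_)
open import Function.Properties.Inverse using (Inverse⇒Injection)
open import Relation.Binary.Definitions using (Decidable)
open import Relation.Binary.PropositionalEquality.Core using (_≡_)
open import Relation.Binary.PropositionalEquality.Properties using (setoid)
open import Relation.Nullary.Decidable using (does; ¬?; via-injection)
open import Relation.Nullary.Negation.Core using (¬_)
open import Relation.Unary using (Pred)

private
  variable
    a c ℓ p : Level

------------------------------------------------------------------------
-- Designs on the point set Fin v

HasCardinality : {A : Set a} → Pred A p → ℕ → Set (a ⊔ p)
HasCardinality P n =
  ∃[ xs ] Unique xs × (∀ x → x ∈ xs ⇔ P x) × length xs ≡ n

record IsDesign (t v k l : ℕ) (ℬ : Pred (Subset v) p) : Set p where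
  field
    1≤t       : 1 ≤ t
    t≤k       : t ≤ k
    k≤v       : k ≤ v
    blockSize : ∀ B → ℬ B → ∣ B ∣ ≡ k
    balanced  : ∀ T → ∣ T ∣ ≡ t → HasCardinality (λ B → ℬ B × T ⊆ B) l

IsTDesign : (t : ℕ) {v : ℕ} → Pred (Subset v) p → Set p
IsTDesign t {v} ℬ = ∃[ k ] ∃[ l ] IsDesign t v k l ℬ

-- The index is given as a rational number, which thereby has to be a
-- natural number.
IsDesignℚ : (t v k : ℕ) → ℚ → Pred (Subset v) p → Set p
IsDesignℚ t v k r ℬ = ∃[ l ] (+ l / 1 ≡ r × IsDesign t v k l ℬ)

------------------------------------------------------------------------
-- Finite fields

-- The bijection with Fin q plays two roles: it says that the field has
-- q elements, and it is the fixed labelling of coordinate positions.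
record FiniteField c ℓ (q : ℕ) : Set (suc (c ⊔ ℓ)) where
  field
    commutativeRing : CommutativeRing c ℓ

  open CommutativeRing commutativeRing public hiding (setoid)

  field
    1≉0         : ¬ (1# ≈ 0#)
    inverse     : ∀ x → ¬ (x ≈ 0#) → ∃[ y ] x * y ≈ 1#
    enumeration : Inverse (CommutativeRing.setoid commutativeRing)
                          (setoid (Fin q))

  open RawMonoidDefinitions +-rawMonoid public using (sum)
  open RawSemiringDefinitions (Semiring.rawSemiring semiring) public using (_^_)

  element : Fin q → Carrier
  element = Inverse.from enumeration

  _≟_ : Decidable _≈_
  _≟_ = via-injection (Inverse⇒Injection enumeration) Fin._≟_

  Word : Set c
  Word = Fin q → Carrier

  support : Word → Subset q
  support w = tabulate (λ i → does (¬? (w i ≟ 0#)))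

  weight : Word → ℕ
  weight w = ∣ support w ∣

  Supports : Pred Word p → ℕ → Pred (Subset q) (c ⊔ p)
  Supports C i B = ∃[ w ] (C w × weight w ≡ i × support w ≡ B)

------------------------------------------------------------------------
-- The code

-- 𝔽₂ is viewed as the prime subfield {0 , 1}, so codewords are words
-- over the large field all of whose entries lie in that subfield.
module Code (m : ℕ) (F : FiniteField c ℓ (2 ℕ.^ m)) where
  open FiniteField F

  𝔽₂ : Pred Carrier ℓ
  𝔽₂ x = x ≈ 0# ⊎ x ≈ 1#

  Tr : Carrier → Carrier
  Tr x = sum {m} (λ j → x ^ (2 ℕ.^ toℕ j))

  code : Pred Word (c ⊔ ℓ)
  code w = ∃[ a ] ∃[ b ] ∃[ c ] ∃[ h ] (𝔽₂ h ×
    (∀ i → let x = element i in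
           w i ≈ Tr (a * x ^ 5 + b * x ^ 3 + c * x) + h))

------------------------------------------------------------------------
-- The weights with their indices

-- Throughout, 3 ≤ s makes every truncated subtraction below exact; all
-- other subtractions are those of ℤ.
module Parameters (s : ℕ) (3≤s : 3 ≤ s) where
  open import Data.Nat.Base using ()
    renaming (_^_ to _^ℕ_; _+_ to _+ℕ_; _*_ to _*ℕ_; _∸_ to _∸ℕ_)
  open import Data.Integer.Base using (_+_; _-_; _*_)

  2^ : ℕ → ℤ
  2^ n = + (2 ^ℕ n)

  private
    2^n∸1≢0 : ∀ {n} → 1 ≤ n → NonZero (2 ^ℕ n ∸ℕ 1)
    2^n∸1≢0 {n} 1≤n = ℕ.>-nonZero (ℕ.m<n⇒0<n∸m (ℕ.^-monoʳ-≤ 2 1≤n))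

    2^n+1≢0 : ∀ {n} → NonZero (2 ^ℕ n +ℕ 1)
    2^n+1≢0 {n} = ℕ.>-nonZero (ℕ.m≤n+m 1 (2 ^ℕ n))

    1≤s : 1 ≤ s
    1≤s = ℕ.≤-trans (s≤s z≤n) 3≤s

    instance
      2^s+1-nonZero : NonZero (2 ^ℕ s +ℕ 1)
      2^s+1-nonZero = 2^n+1≢0 {s}

      2^s∸1-nonZero : NonZero (2 ^ℕ s ∸ℕ 1)
      2^s∸1-nonZero = 2^n∸1≢0 1≤s

      2^2s∸1-nonZero : NonZero (2 ^ℕ (2 *ℕ s) ∸ℕ 1)
      2^2s∸1-nonZero = 2^n∸1≢0 (ℕ.≤-trans 1≤s (ℕ.m≤n*m s 2))

  weightsWithIndices : List (ℕ × ℚ)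
  weightsWithIndices =
    ( 2 ^ℕ (2 *ℕ s ∸ℕ 1)
    , ((+ 29 * 2^ (6 *ℕ s ∸ℕ 6) - + 33 * 2^ (4 *ℕ s ∸ℕ 6)
          + + 17 * 2^ (2 *ℕ s ∸ℕ 4) - + 1)
        * (2^ (2 *ℕ s ∸ℕ 1) - + 1))
      / (2 ^ℕ (2 *ℕ s) ∸ℕ 1)
    ) ∷
    ( 2 ^ℕ (2 *ℕ s ∸ℕ 1) ∸ℕ 2 ^ℕ (s ∸ℕ 1)
    , (+ 2 / 15) ℚ.*
      ((2^ (s ∸ℕ 1) * (+ 3 * 2^ (4 *ℕ s) + + 5 * 2^ (2 *ℕ s) - + 8)
        * (2^ (2 *ℕ s ∸ℕ 1) - 2^ (s ∸ℕ 1) - + 1))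
       / (2 ^ℕ s +ℕ 1))
    ) ∷
    ( 2 ^ℕ (2 *ℕ s ∸ℕ 1) +ℕ 2 ^ℕ (s ∸ℕ 1)
    , (+ 2 / 15) ℚ.*
      ((2^ (s ∸ℕ 1) * (+ 3 * 2^ (4 *ℕ s) + + 5 * 2^ (2 *ℕ s) - + 8)
        * (2^ (2 *ℕ s ∸ℕ 1) + 2^ (s ∸ℕ 1) - + 1))
       / (2 ^ℕ s ∸ℕ 1))
    ) ∷
    ( 2 ^ℕ (2 *ℕ s ∸ℕ 1) ∸ℕ 2 ^ℕ s
    , (+ 7 / 3) ℚ.*
      ((2^ (3 *ℕ s ∸ℕ 4) * (2^ (2 *ℕ s ∸ℕ 1) - 2^ s - + 1)
        * (2^ (s ∸ℕ 1) - + 1))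
       / 1)
    ) ∷
    ( 2 ^ℕ (2 *ℕ s ∸ℕ 1) +ℕ 2 ^ℕ s
    , (+ 7 / 3) ℚ.*
      ((2^ (3 *ℕ s ∸ℕ 4) * (2^ (2 *ℕ s ∸ℕ 1) + 2^ s - + 1)
        * (2^ (s ∸ℕ 1) + + 1))
       / 1)
    ) ∷
    ( 2 ^ℕ (2 *ℕ s ∸ℕ 1) ∸ℕ 2 ^ℕ (s +ℕ 1)
    , (+ 1 / 15) ℚ.*
      ((2^ (s ∸ℕ 3) * (2^ (4 *ℕ s ∸ℕ 2) - + 5 * 2^ (2 *ℕ s ∸ℕ 2) + + 1)
        * (2^ (2 *ℕ s ∸ℕ 1) - 2^ (s +ℕ 1) - + 1) * (2^ (s ∸ℕ 2) - + 1))
       / (2 ^ℕ (2 *ℕ s) ∸ℕ 1))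
    ) ∷
    ( 2 ^ℕ (2 *ℕ s ∸ℕ 1) +ℕ 2 ^ℕ (s +ℕ 1)
    , (+ 1 / 15) ℚ.*
      ((2^ (s ∸ℕ 3) * (2^ (4 *ℕ s ∸ℕ 2) - + 5 * 2^ (2 *ℕ s ∸ℕ 2) + + 1)
        * (2^ (2 *ℕ s ∸ℕ 1) + 2^ (s +ℕ 1) - + 1) * (2^ (s ∸ℕ 2) + + 1))
       / (2 ^ℕ (2 *ℕ s) ∸ℕ 1))
    ) ∷ []

{-# OPTIONS --safe #-}
-- For a, b ∈ 𝔽_q let Q(x) = Tr(ax⁵ + bx³) and V(c) = Σ_x (-1)^(Q(x) + Tr(cx)). The form Q is quadratic;
-- if r is the size of the radical of its polarisation, then V(c)² ∈ {0, qr}, and Σ_c V(c)² = q². The radical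
-- is the zero set of a⁴z¹⁶ + b⁴z⁸ + b²z² + az, so r ≤ 16 unless a = b = 0; moreover r is a square (as q is one)
-- and divides q, whence r ∈ {1, 4, 16}. The number of pairs (a, b) with a given r follows from Σ r⁰, Σ r and Σ r²:
-- the last two count the (x, z), respectively (x, z, y, w), on which β = x⁴z + xz⁴ and γ = x²z + xz² vanish,
-- respectively agree, and γ ≠ 0 together with β determines the 𝔽₂-plane spanned by x and z. This gives the weight
-- distribution. The code is invariant under the doubly transitive group of the maps x ↦ ux + v, so that the supports
-- of each weight form a 2-design, whose index is found by double counting.
module Submission where

open import Defs
open import Algebra.Bundles using (CommutativeRing; RawRing)
open import Algebra.Core using (Op₁; Op₂)
import Algebra.Morphism.RingMonomorphism
open import Algebra.Morphism.Structures using (IsRingMonomorphism)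
import Algebra.Properties.CommutativeMonoid.Sum
import Algebra.Properties.CommutativeSemiring.Exp
import Algebra.Properties.Monoid.Sum
import Algebra.Properties.Ring
import Algebra.Properties.Semiring.Exp
import Algebra.Properties.Semiring.Mult
import Algebra.Properties.Semiring.Sum
import Algebra.Solver.Ring
open import Algebra.Solver.Ring.AlmostCommutativeRing using (fromCommutativeRing; _-Raw-AlmostCommutative⟶_)
open import Algebra.Structures using (IsCommutativeRing)
open import Data.Bool.Base using (Bool; true; false; if_then_else_)
import Data.Bool.Properties as Bool
open import Data.Empty using (⊥)
open import Data.Fin.Base using (Fin; zero; suc; toℕ)
open import Data.Fin.Permutation using (permutation)
import Data.Fin.Properties as Fin
open import Data.Fin.Subset using (Subset; ∣_∣; _⊆_; _∈_; inside; outside)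
open import Data.Fin.Subset.Properties using (_∈?_; ∣p∣≤n)
open import Data.Integer.Base as ℤ using (ℤ; +_; _+_; _*_; -_; _-_; 0ℤ; 1ℤ; -1ℤ)
import Data.Integer.Properties as ℤ
open import Data.Integer.Tactic.RingSolver using (solve-∀)
open import Data.List.Base as List using (List; []; _∷_; length; allFin; filter; cartesianProduct; foldr; tabulate)
import Data.List.Membership.Propositional as List
open import Data.List.Membership.Propositional.Properties using (∈-map⁺; ∈-map⁻; ∈-filter⁺; ∈-filter⁻; ∈-cartesianProduct⁺; ∈-allFin)
open import Data.List.Properties using (length-map; length-tabulate)
open import Data.List.Relation.Unary.All as All using (All; []; _∷_)
open import Data.List.Relation.Unary.All.Properties using (all-filter)
open import Data.List.Relation.Unary.AllPairs using ([]; _∷_)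
open import Data.List.Relation.Unary.Any using (here; there)
open import Data.List.Relation.Unary.Unique.Propositional using (Unique)
open import Data.List.Relation.Unary.Unique.Propositional.Properties using (allFin⁺; filter⁺; map⁺; cartesianProduct⁺)
open import Data.Maybe.Base using (Maybe; just; nothing)
open import Data.Nat.Base as ℕ using (ℕ; zero; suc; z≤n; s≤s)
open import Data.Nat.Divisibility using (divides; ∣⇒≤) renaming (_∣_ to _∣ℕ_; _∣?_ to _∣ℕ?_)
open import Data.Nat.Primality using (prime?; prime[2]; euclidsLemma)
import Data.Nat.Properties as ℕ
import Data.Nat.Tactic.RingSolver as ℕSolver
open import Data.Product.Base using (∃-syntax; _×_; _,_; proj₁; proj₂)
open import Data.Rational.Base as ℚ using (ℚ; _/_; toℚᵘ)
import Data.Rational.Properties as ℚ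
open import Data.Rational.Unnormalised.Base as ℚᵘ using (mkℚᵘ; *≡*)
import Data.Rational.Unnormalised.Properties as ℚᵘ
open import Data.Sum.Base using (_⊎_; inj₁; inj₂; [_,_]′; reduce)
open import Data.Vec.Base as Vec using ([]; _∷_; here; there)
open import Data.Vec.Properties using (tabulate-cong; lookup∘tabulate; []=⇒lookup; lookup⇒[]=)
open import Function.Base using (_∘_)
open import Function.Bundles using (_⇔_; mk⇔; Equivalence; Inverse)
open import Level using (Level; 0ℓ)
open import Relation.Binary.PropositionalEquality hiding ([_])
open import Relation.Nullary.Decidable using (Dec; does; yes; no; _×-dec_; _⊎-dec_; ¬?; dec-true; does-⇔; from-yes; from-no)
open import Relation.Nullary.Negation.Core using (¬_; contradiction)
open import Relation.Unary using (Pred; Decidable)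

open ≡-Reasoning

-- Only V(c)² is computed, never the sign of V(c). That suffices because h takes both values: adding
-- the all-one word turns V into -V, so the words of weight (q - ω)/2 correspond to the triples (a,
-- b, c) with V = ω together with those with V = -ω, and for ω ≠ 0 these are the triples with V² =
-- ω². Translations preserve the code because the polarisation is linear under the trace: x ↦ x + v
-- shifts c by a quantity depending on a and b, may change h, and leaves a and b alone. Two points
-- separate words from blocks. A word must be determined by its support; this holds because |V| = q
-- only for a = b = c = 0. And the blocks of a 2-design have at least 2 points, so weight 1 has to
-- be excluded: it would make q divide 4. The numbers of pairs (a, b) with r = 1, 4, 16 come with
-- denominators 15, 12 and 60. Equations between counts are therefore kept multiplied out over the
-- integers, and fractions appear only in the final comparison of the indices.

private module ∑ = Algebra.Properties.Semiring.Sum ℤ.+-*-semiring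

private
  variable
    a b : Level
    A : Set a
    A′ : Set b

-- Indicators and integer sums over `Fin n`

[_] : Dec A → ℤ
[ d ] = if does d then 1ℤ else 0ℤ

[]-yes : (d : Dec A) → A → [ d ] ≡ 1ℤ
[]-yes (yes _) _ = refl
[]-yes (no ¬x) x = contradiction x ¬x

[]-no : (d : Dec A) → ¬ A → [ d ] ≡ 0ℤ
[]-no (yes x) ¬x = contradiction x ¬x
[]-no (no _) _ = refl

[]-idem : (d : Dec A) → [ d ] * [ d ] ≡ [ d ]
[]-idem (yes _) = refl
[]-idem (no _) = refl

-- An equation that holds only under `A` may be used beside the indicator of `A`, since elsewhere
-- both products vanish.
[]-subst : (d : Dec A) {x y : ℤ} → (A → x ≡ y) → [ d ] * x ≡ [ d ] * y
[]-subst (yes x) e = cong (1ℤ *_) (e x)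
[]-subst (no _) {x} {y} e = trans (ℤ.*-zeroˡ x) (sym (ℤ.*-zeroˡ y))

[]-cong : (d : Dec A) (e : Dec A′) → (A → A′) → (A′ → A) → [ d ] ≡ [ e ]
[]-cong (yes x) e f g = sym ([]-yes e (f x))
[]-cong (no ¬x) e f g = sym ([]-no e (¬x ∘ g))

[]-× : (d : Dec A) (e : Dec A′) → [ d ×-dec e ] ≡ [ d ] * [ e ]
[]-× (yes _) (yes _) = refl
[]-× (yes _) (no _) = refl
[]-× (no _) (yes _) = refl
[]-× (no _) (no _) = refl

[]-¬ : (d : Dec A) → [ ¬? d ] ≡ 1ℤ - [ d ]
[]-¬ (yes _) = refl
[]-¬ (no _) = refl

opaque
  sum : ∀ {n} → (Fin n → ℤ) → ℤ
  sum = ∑.sum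

  sum-suc : ∀ {n} (f : Fin (suc n) → ℤ) → sum f ≡ f zero + sum (f ∘ suc)
  sum-suc f = refl

  sum-empty : (f : Fin 0 → ℤ) → sum f ≡ 0ℤ
  sum-empty f = refl

  sum-cong-≗ : ∀ {n} {f g : Fin n → ℤ} → (∀ x → f x ≡ g x) → sum f ≡ sum g
  sum-cong-≗ = ∑.sum-cong-≗

  ∑-distrib-+ : ∀ {n} (f g : Fin n → ℤ) → sum (λ x → f x + g x) ≡ sum f + sum g
  ∑-distrib-+ = ∑.∑-distrib-+

  ∑-comm : ∀ {m n} (f : Fin m → Fin n → ℤ) →
           sum (λ x → sum (λ y → f x y)) ≡ sum (λ y → sum (λ x → f x y))
  ∑-comm = ∑.∑-comm

  sum-*ˡ : ∀ {n} c (f : Fin n → ℤ) → sum (λ x → c * f x) ≡ c * sum f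
  sum-*ˡ c f = sym (∑.*-distribˡ-sum c f)

  sum-*ʳ : ∀ {n} c (f : Fin n → ℤ) → sum (λ x → f x * c) ≡ sum f * c
  sum-*ʳ c f = sym (∑.*-distribʳ-sum c f)

  sum-reindex : ∀ {n} (f : Fin n → ℤ) (g h : Fin n → Fin n) →
                (∀ x → g (h x) ≡ x) → (∀ x → h (g x) ≡ x) → sum (f ∘ g) ≡ sum f
  sum-reindex f g h gh hg = sym (∑.∑-permute f (permutation g h gh hg))

  sum-zero : ∀ n → sum {n} (λ _ → 0ℤ) ≡ 0ℤ
  sum-zero = ∑.sum-replicate-zero

sum-cong₂ : ∀ {m n} {f g : Fin n → Fin m → ℤ} → (∀ x y → f x y ≡ g x y) →
            sum (λ x → sum (f x)) ≡ sum (λ x → sum (g x))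
sum-cong₂ e = sum-cong-≗ λ x → sum-cong-≗ (e x)

sum-neg : ∀ {n} (f : Fin n → ℤ) → sum (λ x → - f x) ≡ - sum f
sum-neg f = begin
  sum (λ x → - f x)      ≡⟨ sum-cong-≗ (λ x → sym (ℤ.-1*i≡-i (f x))) ⟩
  sum (λ x → -1ℤ * f x)  ≡⟨ sum-*ˡ -1ℤ f ⟩
  -1ℤ * sum f            ≡⟨ ℤ.-1*i≡-i (sum f) ⟩
  - sum f                ∎

sum-- : ∀ {n} (f g : Fin n → ℤ) → sum (λ x → f x - g x) ≡ sum f - sum g
sum-- f g = trans (∑-distrib-+ f (λ x → - g x)) (cong₂ _+_ (refl {x = sum f}) (sum-neg g))

sum-× : ∀ {m n} (f : Fin n → ℤ) (g : Fin m → ℤ) →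
        sum (λ x → sum (λ y → f x * g y)) ≡ sum f * sum g
sum-× f g = trans (sum-cong-≗ λ x → sum-*ˡ (f x) g) (sum-*ʳ (sum g) f)

sum-const : ∀ n c → sum {n} (λ _ → c) ≡ + n * c
sum-const zero c = sum-empty (λ _ → c)
sum-const (suc n) c = begin
  sum {suc n} (λ _ → c)  ≡⟨ sum-suc {n} (λ _ → c) ⟩
  c + sum {n} (λ _ → c)  ≡⟨ cong₂ _+_ (refl {x = c}) (sum-const n c) ⟩
  c + + n * c            ≡⟨ expand c (+ n) ⟩
  (1ℤ + + n) * c         ∎
  where
  expand : ∀ x y → x + y * x ≡ (1ℤ + y) * x
  expand = solve-∀

sum-pick : ∀ {n} (f : Fin n → ℤ) a → sum (λ x → [ x Fin.≟ a ] * f x) ≡ f a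
sum-pick {suc n} f zero = begin
  sum (λ x → [ x Fin.≟ zero ] * f x)  ≡⟨ sum-suc (λ x → [ x Fin.≟ zero ] * f x) ⟩
  1ℤ * f zero + sum (λ x → 0ℤ * f (suc x))
    ≡⟨ cong₂ _+_ (ℤ.*-identityˡ (f zero))
         (trans (sum-cong-≗ λ x → ℤ.*-zeroˡ (f (suc x))) (sum-zero n)) ⟩
  f zero + 0ℤ  ≡⟨ ℤ.+-identityʳ (f zero) ⟩
  f zero       ∎
sum-pick {suc n} f (suc a) = begin
  sum (λ x → [ x Fin.≟ suc a ] * f x)  ≡⟨ sum-suc (λ x → [ x Fin.≟ suc a ] * f x) ⟩
  0ℤ * f zero + sum (λ x → [ suc x Fin.≟ suc a ] * f (suc x))
    ≡⟨ cong₂ _+_ (ℤ.*-zeroˡ (f zero))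
        (sum-cong-≗ λ x → cong (_* f (suc x))
          ([]-cong (suc x Fin.≟ suc a) (x Fin.≟ a) Fin.suc-injective (cong suc))) ⟩
  0ℤ + sum (λ x → [ x Fin.≟ a ] * f (suc x))  ≡⟨ ℤ.+-identityˡ _ ⟩
  sum (λ x → [ x Fin.≟ a ] * f (suc x))       ≡⟨ sum-pick (f ∘ suc) a ⟩
  f (suc a)                                   ∎

sum-pick₁ : ∀ {n} (a : Fin n) → sum (λ x → [ x Fin.≟ a ]) ≡ 1ℤ
sum-pick₁ a = trans (sum-cong-≗ λ x → sym (ℤ.*-identityʳ [ x Fin.≟ a ])) (sum-pick (λ _ → 1ℤ) a)

-- Fields with 2^m elements: Fermat, trace, polynomial functions

record FieldStructure (q : ℕ) : Set where
  infixl 6 _⊕_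
  infixl 7 _⊗_
  infix 8 ⊖_
  field
    _⊕_ _⊗_ : Op₂ (Fin q)
    ⊖_ : Op₁ (Fin q)
    𝟘 𝟙 : Fin q
    isCommutativeRing : IsCommutativeRing _≡_ _⊕_ _⊗_ ⊖_ 𝟘 𝟙
    𝟙≢𝟘 : 𝟙 ≢ 𝟘
    inverse : ∀ x → x ≢ 𝟘 → ∃[ y ] x ⊗ y ≡ 𝟙

  commutativeRing : CommutativeRing 0ℓ 0ℓ
  commutativeRing = record { isCommutativeRing = isCommutativeRing }

module Field {q : ℕ} (𝔽 : FieldStructure q) (m : ℕ) (q≡2^m : q ≡ 2 ℕ.^ m) where
  open FieldStructure 𝔽 public hiding (commutativeRing)

  K : Set
  K = Fin q

  module R = CommutativeRing (FieldStructure.commutativeRing 𝔽)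
  module ∑K = Algebra.Properties.Semiring.Sum R.semiring
  module ∏K = Algebra.Properties.CommutativeMonoid.Sum R.*-commutativeMonoid
  module RP = Algebra.Properties.Ring R.ring
  open Algebra.Properties.Semiring.Exp R.semiring public
    using (_^_; ^-assocʳ)
  open Algebra.Properties.Semiring.Mult R.semiring public
    using () renaming (_×_ to _·_; ×1-homo-* to ·𝟙-homo-*)
  open Algebra.Properties.CommutativeSemiring.Exp R.commutativeSemiring public
    using (^-distrib-*)

  infix 4 _≟_
  _≟_ : (x y : K) → Dec (x ≡ y)
  _≟_ = Fin._≟_

  ⊗-cancelˡ : ∀ x {y z} → x ≢ 𝟘 → x ⊗ y ≡ x ⊗ z → y ≡ z
  ⊗-cancelˡ x {y} {z} x≢0 xy≡xz with inverse x x≢0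
  ... | x⁻¹ , xx⁻¹≡1 = trans (sym (undo y)) (trans (cong (x⁻¹ ⊗_) xy≡xz) (undo z))
    where
    undo : ∀ t → x⁻¹ ⊗ (x ⊗ t) ≡ t
    undo t = begin
      x⁻¹ ⊗ (x ⊗ t)  ≡⟨ sym (R.*-assoc x⁻¹ x t) ⟩
      x⁻¹ ⊗ x ⊗ t    ≡⟨ cong (_⊗ t) (trans (R.*-comm x⁻¹ x) xx⁻¹≡1) ⟩
      𝟙 ⊗ t          ≡⟨ R.*-identityˡ t ⟩
      t              ∎

  ⊗-zero : ∀ x y → x ⊗ y ≡ 𝟘 → x ≡ 𝟘 ⊎ y ≡ 𝟘
  ⊗-zero x y xy≡0 with x ≟ 𝟘
  ... | yes x≡0 = inj₁ x≡0
  ... | no x≢0 = inj₂ (⊗-cancelˡ x x≢0 (trans xy≡0 (sym (R.zeroʳ x))))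

  ⊗-≢0 : ∀ {x y} → x ≢ 𝟘 → y ≢ 𝟘 → x ⊗ y ≢ 𝟘
  ⊗-≢0 {x} {y} x≢0 y≢0 xy≡0 with ⊗-zero x y xy≡0
  ... | inj₁ x≡0 = x≢0 x≡0
  ... | inj₂ y≡0 = y≢0 y≡0

  -- Translating the summation variable by 𝟙 shows q · 𝟙 ≡ 𝟘.
  q·𝟙≡𝟘 : q · 𝟙 ≡ 𝟘
  q·𝟙≡𝟘 = RP.+-cancelˡ (∑K.sum {q} (λ x → x)) _ _ (begin
    ∑K.sum {q} (λ x → x) ⊕ q · 𝟙
      ≡⟨ cong (∑K.sum {q} (λ x → x) ⊕_) (sym (∑K.sum-replicate q)) ⟩
    ∑K.sum {q} (λ x → x) ⊕ ∑K.sum {q} (λ _ → 𝟙)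
      ≡⟨ sym (∑K.∑-distrib-+ {q} (λ x → x) (λ _ → 𝟙)) ⟩
    ∑K.sum {q} (λ x → x ⊕ 𝟙)
      ≡⟨ sym (∑K.∑-permute {q} {q} (λ x → x) (permutation (_⊕ 𝟙) (_⊕ ⊖ 𝟙) right left)) ⟩
    ∑K.sum {q} (λ x → x)
      ≡⟨ sym (R.+-identityʳ _) ⟩
    ∑K.sum {q} (λ x → x) ⊕ 𝟘 ∎)
    where
    right : ∀ x → (x ⊕ ⊖ 𝟙) ⊕ 𝟙 ≡ x
    right x = trans (R.+-assoc x _ _) (trans (cong (x ⊕_) (R.-‿inverseˡ 𝟙)) (R.+-identityʳ x))
    left : ∀ x → (x ⊕ 𝟙) ⊕ ⊖ 𝟙 ≡ x
    left x = trans (R.+-assoc x _ _) (trans (cong (x ⊕_) (R.-‿inverseʳ 𝟙)) (R.+-identityʳ x))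

  -- The multiple q · 𝟙 is a product of m factors 2 · 𝟙, and without zero divisors one of them
  -- vanishes; the empty product would give 𝟙 = 𝟘.
  𝟙⊕𝟙≡𝟘 : 𝟙 ⊕ 𝟙 ≡ 𝟘
  𝟙⊕𝟙≡𝟘 = trans (cong (𝟙 ⊕_) (sym (R.+-identityʳ 𝟙))) (2·𝟙≡𝟘 m (subst (λ n → n · 𝟙 ≡ 𝟘) q≡2^m q·𝟙≡𝟘))
    where
    2·𝟙≡𝟘 : ∀ n → (2 ℕ.^ n) · 𝟙 ≡ 𝟘 → 2 · 𝟙 ≡ 𝟘
    2·𝟙≡𝟘 zero 1·𝟙≡𝟘 = contradiction (trans (sym (R.+-identityʳ 𝟙)) 1·𝟙≡𝟘) 𝟙≢𝟘
    2·𝟙≡𝟘 (suc n) e with ⊗-zero _ _ (trans (sym (·𝟙-homo-* 2 (2 ℕ.^ n))) e)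
    ... | inj₁ 2·𝟙≡0 = 2·𝟙≡0
    ... | inj₂ e′ = 2·𝟙≡𝟘 n e′

  x⊕x≡𝟘 : ∀ x → x ⊕ x ≡ 𝟘
  x⊕x≡𝟘 x = begin
    x ⊕ x            ≡⟨ sym (cong₂ _⊕_ (R.*-identityʳ x) (R.*-identityʳ x)) ⟩
    x ⊗ 𝟙 ⊕ x ⊗ 𝟙    ≡⟨ sym (R.distribˡ x 𝟙 𝟙) ⟩
    x ⊗ (𝟙 ⊕ 𝟙)      ≡⟨ cong (x ⊗_) 𝟙⊕𝟙≡𝟘 ⟩
    x ⊗ 𝟘            ≡⟨ R.zeroʳ x ⟩
    𝟘                ∎

  ⊖x≡x : ∀ x → ⊖ x ≡ x
  ⊖x≡x x = RP.+-cancelˡ x _ _ (trans (R.-‿inverseʳ x) (sym (x⊕x≡𝟘 x)))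

  ⊕-≡𝟘 : ∀ x y → x ⊕ y ≡ 𝟘 → x ≡ y
  ⊕-≡𝟘 x y e = RP.+-cancelʳ y _ _ (trans e (sym (x⊕x≡𝟘 y)))

  -- Ring identities are decided with coefficients in 𝔽₂, so that they hold modulo 2.
  private
    ⟦_⟧₂ : Bool → K
    ⟦ b ⟧₂ = if b then 𝟙 else 𝟘

    𝔽₂⟶K : CommutativeRing.rawRing Bool.xor-∧-commutativeRing
             -Raw-AlmostCommutative⟶ fromCommutativeRing (FieldStructure.commutativeRing 𝔽)
    𝔽₂⟶K = record
      { ⟦_⟧    = ⟦_⟧₂
      ; +-homo = λ { true true → sym 𝟙⊕𝟙≡𝟘 ; true false → sym (R.+-identityʳ 𝟙)
                   ; false y → sym (R.+-identityˡ ⟦ y ⟧₂) }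
      ; *-homo = λ { true y → sym (R.*-identityˡ ⟦ y ⟧₂) ; false y → sym (R.zeroˡ ⟦ y ⟧₂) }
      ; -‿homo = λ x → sym (⊖x≡x ⟦ x ⟧₂)
      ; 0-homo = refl
      ; 1-homo = refl
      }

    coeff≟ : ∀ x y → Maybe (⟦ x ⟧₂ ≡ ⟦ y ⟧₂)
    coeff≟ true true = just refl
    coeff≟ false false = just refl
    coeff≟ _ _ = nothing

  module Solver = Algebra.Solver.Ring (CommutativeRing.rawRing Bool.xor-∧-commutativeRing)
    (fromCommutativeRing (FieldStructure.commutativeRing 𝔽)) 𝔽₂⟶K coeff≟
  open Solver public using (solve; _:+_; _:*_; _:=_; con; _:^_)

  frobenius : ∀ x y → (x ⊕ y) ⊗ (x ⊕ y) ≡ x ⊗ x ⊕ y ⊗ y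
  frobenius = solve 2 (λ x y → (x :+ y) :* (x :+ y) := x :* x :+ y :* y) refl

  -- Fermat's little theorem

  private
    -- With 0 replaced by 1, the product over all q elements is the product of the nonzero ones.
    unit : K → K
    unit x with x ≟ 𝟘
    ... | yes _ = 𝟙
    ... | no _ = x

    unit≢0 : ∀ x → unit x ≢ 𝟘
    unit≢0 x with x ≟ 𝟘
    ... | yes _ = 𝟙≢𝟘
    ... | no x≢0 = x≢0

    ∏≢0 : ∀ {n} (f : Fin n → K) → (∀ i → f i ≢ 𝟘) → ∏K.sum f ≢ 𝟘
    ∏≢0 {zero} f f≢0 = 𝟙≢𝟘
    ∏≢0 {suc n} f f≢0 = ⊗-≢0 (f≢0 zero) (∏≢0 (f ∘ suc) (f≢0 ∘ suc))

    ∏-pick : ∀ {n} (a : Fin n) x → ∏K.sum (λ y → if does (y Fin.≟ a) then x else 𝟙) ≡ x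
    ∏-pick {suc n} zero x = trans (cong (x ⊗_) (∏K.sum-replicate-zero n)) (R.*-identityʳ x)
    ∏-pick {suc n} (suc a) x = trans (R.*-identityˡ _) (trans (∏K.sum-cong-≗ same) (∏-pick a x))
      where
      same : ∀ y → (if does (suc y Fin.≟ suc a) then x else 𝟙) ≡ (if does (y Fin.≟ a) then x else 𝟙)
      same y with y Fin.≟ a
      ... | yes _ = refl
      ... | no _ = refl

    -- At y = 0 both units are 1, so the left side has a surplus factor x, which the conditional
    -- supplies.
    ⊗-unit : ∀ x → x ≢ 𝟘 → ∀ y → x ⊗ unit y ≡ (if does (y ≟ 𝟘) then x else 𝟙) ⊗ unit (x ⊗ y)
    ⊗-unit x x≢0 y with y ≟ 𝟘 | x ⊗ y ≟ 𝟘
    ... | yes refl | yes _ = refl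
    ... | yes refl | no x0≢0 = contradiction (R.zeroʳ x) x0≢0
    ... | no y≢0 | yes xy≡0 = contradiction xy≡0 (⊗-≢0 x≢0 y≢0)
    ... | no _ | no _ = sym (R.*-identityˡ _)

  𝟘^n≡𝟘 : ∀ n → n ≢ 0 → 𝟘 ^ n ≡ 𝟘
  𝟘^n≡𝟘 zero n≢0 = contradiction refl n≢0
  𝟘^n≡𝟘 (suc n) _ = R.zeroˡ _

  -- For x ≠ 0 let P be the product of the nonzero elements. As y ↦ xy permutes them, multiplying
  -- each of the q factors of P by x leaves P apart from the surplus x at y = 0. So x^q P = x P, and
  -- P cancels.
  fermat : ∀ x → x ^ q ≡ x
  fermat x with x ≟ 𝟘
  ... | yes refl = 𝟘^n≡𝟘 q (λ { refl → Fin.¬Fin0 𝟘 })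
  ... | no x≢0 = ⊗-cancelˡ P (∏≢0 unit unit≢0) (begin
    P ⊗ x ^ q                    ≡⟨ R.*-comm P _ ⟩
    x ^ q ⊗ P                    ≡⟨ cong (_⊗ P) (sym (∏K.sum-replicate q)) ⟩
    ∏K.sum {q} (λ _ → x) ⊗ P     ≡⟨ sym (∏K.∑-distrib-+ {q} (λ _ → x) unit) ⟩
    ∏K.sum (λ y → x ⊗ unit y)    ≡⟨ ∏K.sum-cong-≗ (⊗-unit x x≢0) ⟩
    ∏K.sum (λ y → (if does (y ≟ 𝟘) then x else 𝟙) ⊗ unit (x ⊗ y))
      ≡⟨ ∏K.∑-distrib-+ _ (λ y → unit (x ⊗ y)) ⟩
    ∏K.sum (λ y → if does (y ≟ 𝟘) then x else 𝟙) ⊗ ∏K.sum (λ y → unit (x ⊗ y))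
      ≡⟨ cong₂ _⊗_ (∏-pick 𝟘 x) (sym (∏K.∑-permute unit (permutation (x ⊗_) (x⁻¹ ⊗_) right left))) ⟩
    x ⊗ P                        ≡⟨ R.*-comm x P ⟩
    P ⊗ x                        ∎)
    where
    P x⁻¹ : K
    P = ∏K.sum unit
    x⁻¹ = proj₁ (inverse x x≢0)
    right : ∀ y → x ⊗ (x⁻¹ ⊗ y) ≡ y
    right y = trans (sym (R.*-assoc x x⁻¹ y)) (trans (cong (_⊗ y) (proj₂ (inverse x x≢0))) (R.*-identityˡ y))
    left : ∀ y → x⁻¹ ⊗ (x ⊗ y) ≡ y
    left y = ⊗-cancelˡ x x≢0 (right (x ⊗ y))

  -- The trace

  sq-^ : ∀ x n → (x ⊗ x) ^ n ≡ x ^ (2 ℕ.* n)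
  sq-^ x n = trans (cong (λ y → (x ⊗ y) ^ n) (sym (R.*-identityʳ x))) (^-assocʳ x 2 n)

  ^-sq : ∀ x n → (x ⊗ x) ^ n ≡ x ^ n ⊗ x ^ n
  ^-sq x n = ^-distrib-* x x n

  -- The case m = 0 would be a field with one element. So the truncated subtraction is exact, and
  -- `√` below raises to the power q / 2.
  2^m≡2*2^[m∸1] : 2 ℕ.^ m ≡ 2 ℕ.* 2 ℕ.^ (m ℕ.∸ 1)
  2^m≡2*2^[m∸1] = halve m q≡2^m
    where
    single : ∀ {n} → n ≡ 1 → (x y : Fin n) → x ≡ y
    single refl zero zero = refl
    halve : ∀ m → q ≡ 2 ℕ.^ m → 2 ℕ.^ m ≡ 2 ℕ.* 2 ℕ.^ (m ℕ.∸ 1)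
    halve zero e = contradiction (single e 𝟙 𝟘) 𝟙≢𝟘
    halve (suc m) e = refl

  √_ : K → K
  √ x = x ^ (2 ℕ.^ (m ℕ.∸ 1))

  √-sq : ∀ x → √ x ⊗ √ x ≡ x
  √-sq x = begin
    √ x ⊗ √ x                             ≡⟨ sym (^-sq x (2 ℕ.^ (m ℕ.∸ 1))) ⟩
    (x ⊗ x) ^ (2 ℕ.^ (m ℕ.∸ 1))           ≡⟨ sq-^ x (2 ℕ.^ (m ℕ.∸ 1)) ⟩
    x ^ (2 ℕ.* 2 ℕ.^ (m ℕ.∸ 1))           ≡⟨ cong (x ^_) (sym (trans q≡2^m 2^m≡2*2^[m∸1])) ⟩
    x ^ q                                 ≡⟨ fermat x ⟩
    x                                     ∎

  -- The first n terms of x + x² + x⁴ + ..., with the squaring moved into the argument, so that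
  -- additivity follows by induction from the Frobenius identity.
  partialTr : ℕ → K → K
  partialTr zero x = 𝟘
  partialTr (suc n) x = x ⊕ partialTr n (x ⊗ x)

  partialTr-⊕ : ∀ n x y → partialTr n (x ⊕ y) ≡ partialTr n x ⊕ partialTr n y
  partialTr-⊕ zero x y = sym (R.+-identityˡ 𝟘)
  partialTr-⊕ (suc n) x y = begin
    x ⊕ y ⊕ partialTr n ((x ⊕ y) ⊗ (x ⊕ y))
      ≡⟨ cong (λ t → x ⊕ y ⊕ partialTr n t) (frobenius x y) ⟩
    x ⊕ y ⊕ partialTr n (x ⊗ x ⊕ y ⊗ y)
      ≡⟨ cong (x ⊕ y ⊕_) (partialTr-⊕ n (x ⊗ x) (y ⊗ y)) ⟩
    x ⊕ y ⊕ (partialTr n (x ⊗ x) ⊕ partialTr n (y ⊗ y))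
      ≡⟨ solve 4 (λ x y s t → x :+ y :+ (s :+ t) := x :+ s :+ (y :+ t)) refl x y _ _ ⟩
    x ⊕ partialTr n (x ⊗ x) ⊕ (y ⊕ partialTr n (y ⊗ y)) ∎

  partialTr-last : ∀ n x → partialTr (suc n) x ≡ x ^ (2 ℕ.^ n) ⊕ partialTr n x
  partialTr-last zero x = cong (_⊕ 𝟘) (sym (R.*-identityʳ x))
  partialTr-last (suc n) x = begin
    x ⊕ partialTr (suc n) (x ⊗ x)
      ≡⟨ cong (x ⊕_) (partialTr-last n (x ⊗ x)) ⟩
    x ⊕ ((x ⊗ x) ^ (2 ℕ.^ n) ⊕ partialTr n (x ⊗ x))
      ≡⟨ cong (λ t → x ⊕ (t ⊕ partialTr n (x ⊗ x))) (sq-^ x (2 ℕ.^ n)) ⟩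
    x ⊕ (x ^ (2 ℕ.^ suc n) ⊕ partialTr n (x ⊗ x))
      ≡⟨ solve 3 (λ x s t → x :+ (s :+ t) := s :+ (x :+ t)) refl x _ _ ⟩
    x ^ (2 ℕ.^ suc n) ⊕ (x ⊕ partialTr n (x ⊗ x)) ∎

  partialTr-sq : ∀ n x → partialTr n (x ⊗ x) ≡ partialTr n x ⊗ partialTr n x
  partialTr-sq zero x = sym (R.zeroˡ 𝟘)
  partialTr-sq (suc n) x = trans (cong (x ⊗ x ⊕_) (partialTr-sq n (x ⊗ x))) (sym (frobenius x _))

  Tr : K → K
  Tr = partialTr m

  Tr-⊕ : ∀ x y → Tr (x ⊕ y) ≡ Tr x ⊕ Tr y
  Tr-⊕ = partialTr-⊕ m

  -- The sum x + x² + x⁴ + ... with m + 1 terms is x + Tr(x²) when its first term is split off, and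
  -- x^q + Tr x when its last one is; now x^q = x.
  Tr-sq : ∀ x → Tr (x ⊗ x) ≡ Tr x
  Tr-sq x = RP.+-cancelˡ x _ _ (begin
    partialTr (suc m) x          ≡⟨ partialTr-last m x ⟩
    x ^ (2 ℕ.^ m) ⊕ Tr x         ≡⟨ cong (λ n → x ^ n ⊕ Tr x) (sym q≡2^m) ⟩
    x ^ q ⊕ Tr x                 ≡⟨ cong (_⊕ Tr x) (fermat x) ⟩
    x ⊕ Tr x                     ∎)

  -- The trace is its own square, hence a root of t(t + 1).
  Tr-𝔽₂ : ∀ x → Tr x ≡ 𝟘 ⊎ Tr x ≡ 𝟙
  Tr-𝔽₂ x with ⊗-zero (Tr x) (Tr x ⊕ 𝟙) (begin
    Tr x ⊗ (Tr x ⊕ 𝟙)     ≡⟨ solve 1 (λ t → t :* (t :+ con true) := t :* t :+ t) refl (Tr x) ⟩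
    Tr x ⊗ Tr x ⊕ Tr x    ≡⟨ cong (_⊕ Tr x) (trans (sym (partialTr-sq m x)) (Tr-sq x)) ⟩
    Tr x ⊕ Tr x           ≡⟨ x⊕x≡𝟘 (Tr x) ⟩
    𝟘                     ∎)
  ... | inj₁ t≡0 = inj₁ t≡0
  ... | inj₂ t≡1 = inj₂ (⊕-≡𝟘 _ _ t≡1)

  -- Polynomial functions

  -- Here a is the leading coefficient and n the formal degree. The coefficient is an index so that
  -- it is still known to be nonzero after a division. Functions are matched only pointwise.
  data Polynomial (a : K) : ℕ → (K → K) → Set where
    constant : ∀ {f} → (∀ x → f x ≡ a) → Polynomial a 0 f
    horner   : ∀ {n f} c g → Polynomial a n g → (∀ x → f x ≡ c ⊕ x ⊗ g x) → Polynomial a (suc n) f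

  poly-cong : ∀ {a n f g} → (∀ x → g x ≡ f x) → Polynomial a n f → Polynomial a n g
  poly-cong e (constant h) = constant (λ x → trans (e x) (h x))
  poly-cong e (horner c g p h) = horner c g p (λ x → trans (e x) (h x))

  poly-+const : ∀ {a n f} c → Polynomial a (suc n) f → Polynomial a (suc n) (λ x → f x ⊕ c)
  poly-+const c (horner d g p h) = horner (d ⊕ c) g p λ x → trans (cong (_⊕ c) (h x))
    (solve 3 (λ d t c → d :+ t :+ c := d :+ c :+ t) refl d (x ⊗ g x) c)

  poly-+lower : ∀ {a b n k f g} → Polynomial a n f → Polynomial b k g → k ℕ.< n →
                Polynomial a n (λ x → f x ⊕ g x)
  poly-+lower {f = f} p@(horner _ _ _ _) (constant {g} h) _ =
    poly-cong (λ x → cong (f x ⊕_) (h x)) (poly-+const _ p)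
  poly-+lower (horner c f p h) (horner d g r k) (s≤s k<n) =
    horner (c ⊕ d) (λ x → f x ⊕ g x) (poly-+lower p r k<n) λ x → trans (cong₂ _⊕_ (h x) (k x))
      (solve 5 (λ c x f d g → c :+ x :* f :+ (d :+ x :* g) := c :+ d :+ x :* (f :+ g)) refl c x (f x) d (g x))

  poly-^ : ∀ n → Polynomial 𝟙 n (_^ n)
  poly-^ zero = constant λ x → refl
  poly-^ (suc n) = horner 𝟘 (_^ n) (poly-^ n) λ x → sym (R.+-identityˡ _)

  -- Synthetic division by x + r. The quotient keeps the leading coefficient, so the induction
  -- bounding the number of roots can continue with it.
  divide : ∀ {a n f} → Polynomial a (suc n) f → ∀ r →
           ∃[ g ] Polynomial a n g × (∀ x → f x ≡ f r ⊕ (x ⊕ r) ⊗ g x)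
  divide {f = f} (horner c g p@(constant k) h) r = g , p , λ x → begin
    f x                        ≡⟨ h x ⟩
    c ⊕ x ⊗ g x                ≡⟨ solve 4 (λ c x r g → c :+ x :* g := c :+ r :* g :+ (x :+ r) :* g) refl c x r (g x) ⟩
    c ⊕ r ⊗ g x ⊕ (x ⊕ r) ⊗ g x
      ≡⟨ cong (λ t → c ⊕ r ⊗ t ⊕ (x ⊕ r) ⊗ g x) (trans (k x) (sym (k r))) ⟩
    c ⊕ r ⊗ g r ⊕ (x ⊕ r) ⊗ g x ≡⟨ cong (_⊕ (x ⊕ r) ⊗ g x) (sym (h r)) ⟩
    f r ⊕ (x ⊕ r) ⊗ g x        ∎
  divide {f = f} (horner c g p@(horner _ _ _ _) h) r with divide p r
  ... | g′ , p′ , h′ = (λ x → g r ⊕ x ⊗ g′ x) , horner (g r) g′ p′ (λ _ → refl) , λ x → begin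
    f x                                            ≡⟨ h x ⟩
    c ⊕ x ⊗ g x                                    ≡⟨ cong (λ t → c ⊕ x ⊗ t) (h′ x) ⟩
    c ⊕ x ⊗ (g r ⊕ (x ⊕ r) ⊗ g′ x)
      ≡⟨ solve 5 (λ c x r s t → c :+ x :* (s :+ (x :+ r) :* t) := c :+ r :* s :+ (x :+ r) :* (s :+ x :* t))
           refl c x r (g r) (g′ x) ⟩
    c ⊕ r ⊗ g r ⊕ (x ⊕ r) ⊗ (g r ⊕ x ⊗ g′ x)       ≡⟨ cong (_⊕ (x ⊕ r) ⊗ (g r ⊕ x ⊗ g′ x)) (sym (h r)) ⟩
    f r ⊕ (x ⊕ r) ⊗ (g r ⊕ x ⊗ g′ x)               ∎

  roots-≤-degree : ∀ {a n f} → a ≢ 𝟘 → Polynomial a n f →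
                   ∀ xs → Unique xs → All (λ x → f x ≡ 𝟘) xs → length xs ℕ.≤ n
  roots-≤-degree a≢0 p [] _ _ = z≤n
  roots-≤-degree a≢0 (constant h) (r ∷ xs) _ (fr≡0 ∷ _) = contradiction (trans (sym (h r)) fr≡0) a≢0
  roots-≤-degree {f = f} a≢0 p@(horner _ _ _ _) (r ∷ xs) (r∉xs ∷ xs!) (fr≡0 ∷ fxs≡0) with divide p r
  ... | g , p′ , h = s≤s (roots-≤-degree a≢0 p′ xs xs! (All.zipWith root (r∉xs , fxs≡0)))
    where
    root : ∀ {x} → r ≢ x × f x ≡ 𝟘 → g x ≡ 𝟘
    root {x} (r≢x , fx≡0) with ⊗-zero (x ⊕ r) (g x) (begin
      (x ⊕ r) ⊗ g x          ≡⟨ sym (R.+-identityˡ _) ⟩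
      𝟘 ⊕ (x ⊕ r) ⊗ g x      ≡⟨ cong (_⊕ (x ⊕ r) ⊗ g x) (sym fr≡0) ⟩
      f r ⊕ (x ⊕ r) ⊗ g x    ≡⟨ sym (h x) ⟩
      f x                    ≡⟨ fx≡0 ⟩
      𝟘                      ∎)
    ... | inj₁ x⊕r≡0 = contradiction (sym (⊕-≡𝟘 x r x⊕r≡0)) r≢x
    ... | inj₂ gx≡0 = gx≡0

  poly-partialTr : ∀ n → Polynomial 𝟙 (2 ℕ.^ n) (partialTr (suc n))
  poly-partialTr zero = poly-cong (partialTr-last 0)
    (poly-cong (λ x → R.+-identityʳ _) (poly-^ 1))
  poly-partialTr (suc n) = poly-cong (partialTr-last (suc n))
    (poly-+lower (poly-^ (2 ℕ.^ suc n)) (poly-partialTr n) (ℕ.^-monoʳ-< 2 (s≤s (s≤s z≤n)) (ℕ.n<1+n n)))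

  -- Otherwise all q elements would be roots of the trace, which has leading coefficient 1 and
  -- degree q / 2.
  Tr-nonzero : ∃[ x ] Tr x ≡ 𝟙
  Tr-nonzero with Fin.any? (λ x → Tr x ≟ 𝟙)
  ... | yes ∃x = ∃x
  ... | no ∄x = contradiction (subst (ℕ._≤ 2 ℕ.^ (m ℕ.∸ 1)) (length-allFin q)
      (roots-≤-degree 𝟙≢𝟘 (poly-cong (λ x → cong (λ n → partialTr n x) m≡) (poly-partialTr (m ℕ.∸ 1)))
        (allFin q) (allFin⁺ q) (All.universal Tr≡0 (allFin q))))
      (ℕ.<⇒≱ (subst (2 ℕ.^ (m ℕ.∸ 1) ℕ.<_) (sym q≡2^m) (ℕ.^-monoʳ-< 2 (s≤s (s≤s z≤n)) (ℕ.≤-reflexive (sym m≡)))))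
    where
    Tr≡0 : ∀ x → Tr x ≡ 𝟘
    Tr≡0 x with Tr-𝔽₂ x
    ... | inj₁ t≡0 = t≡0
    ... | inj₂ t≡1 = contradiction (x , t≡1) ∄x
    m≡ : m ≡ suc (m ℕ.∸ 1)
    m≡ = positive m 2^m≡2*2^[m∸1]
      where
      positive : ∀ n → 2 ℕ.^ n ≡ 2 ℕ.* 2 ℕ.^ (n ℕ.∸ 1) → n ≡ suc (n ℕ.∸ 1)
      positive (suc n) _ = refl
    length-allFin : ∀ n → length (allFin n) ≡ n
    length-allFin n = length-tabulate {n = n} (λ x → x)

-- The additive character and the exponential sums V

module Characters {q : ℕ} (𝔽 : FieldStructure q) (m : ℕ) (q≡2^m : q ≡ 2 ℕ.^ m) where
  open Field 𝔽 m q≡2^m public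

  sgn : K → ℤ
  sgn t = if does (t ≟ 𝟘) then 1ℤ else -1ℤ

  sgn-𝟘 : sgn 𝟘 ≡ 1ℤ
  sgn-𝟘 with 𝟘 ≟ 𝟘
  ... | yes _ = refl
  ... | no 0≢0 = contradiction refl 0≢0

  sgn-𝟙 : sgn 𝟙 ≡ -1ℤ
  sgn-𝟙 with 𝟙 ≟ 𝟘
  ... | yes 1≡0 = contradiction 1≡0 𝟙≢𝟘
  ... | no _ = refl

  sgn-⊕ : ∀ {s t} → s ≡ 𝟘 ⊎ s ≡ 𝟙 → t ≡ 𝟘 ⊎ t ≡ 𝟙 → sgn (s ⊕ t) ≡ sgn s * sgn t
  sgn-⊕ {t = t} (inj₁ refl) _ rewrite R.+-identityˡ t | sgn-𝟘 = sym (ℤ.*-identityˡ (sgn t))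
  sgn-⊕ (inj₂ refl) (inj₁ refl) rewrite R.+-identityʳ 𝟙 | sgn-𝟘 = sym (ℤ.*-identityʳ (sgn 𝟙))
  sgn-⊕ (inj₂ refl) (inj₂ refl) rewrite 𝟙⊕𝟙≡𝟘 | sgn-𝟘 | sgn-𝟙 = refl

  Tr-𝟘 : Tr 𝟘 ≡ 𝟘
  Tr-𝟘 = RP.+-cancelˡ (Tr 𝟘) _ _ (begin
    Tr 𝟘 ⊕ Tr 𝟘  ≡⟨ sym (Tr-⊕ 𝟘 𝟘) ⟩
    Tr (𝟘 ⊕ 𝟘)   ≡⟨ cong Tr (R.+-identityˡ 𝟘) ⟩
    Tr 𝟘         ≡⟨ sym (R.+-identityʳ (Tr 𝟘)) ⟩
    Tr 𝟘 ⊕ 𝟘     ∎)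

  opaque
    -- The canonical additive character, (-1) to the power Tr x.
    χ : K → ℤ
    χ x = sgn (Tr x)

    χ-def : ∀ x → χ x ≡ sgn (Tr x)
    χ-def x = refl

    χ-⊕ : ∀ x y → χ (x ⊕ y) ≡ χ x * χ y
    χ-⊕ x y = trans (cong sgn (Tr-⊕ x y)) (sgn-⊕ (Tr-𝔽₂ x) (Tr-𝔽₂ y))

    χ-sq : ∀ x → χ (x ⊗ x) ≡ χ x
    χ-sq x = cong sgn (Tr-sq x)

    χ-𝟘 : χ 𝟘 ≡ 1ℤ
    χ-𝟘 = trans (cong sgn Tr-𝟘) sgn-𝟘

    χ-±1 : ∀ x → χ x ≡ 1ℤ ⊎ χ x ≡ -1ℤ
    χ-±1 x with does (Tr x ≟ 𝟘)
    ... | true = inj₁ refl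
    ... | false = inj₂ refl

  χ-*-idem : ∀ x → χ x * χ x ≡ 1ℤ
  χ-*-idem x = trans (sym (χ-⊕ x x)) (trans (cong χ (x⊕x≡𝟘 x)) χ-𝟘)

  sum-shift : ∀ a (f : K → ℤ) → sum (λ x → f (x ⊕ a)) ≡ sum f
  sum-shift a f = sum-reindex f (_⊕ a) (_⊕ a) involutive involutive
    where
    involutive : ∀ x → x ⊕ a ⊕ a ≡ x
    involutive x = solve 2 (λ x a → x :+ a :+ a := x) refl x a

  sum-scale : ∀ {a} → a ≢ 𝟘 → (f : K → ℤ) → sum (λ x → f (a ⊗ x)) ≡ sum f
  sum-scale {a} a≢0 f = sum-reindex f (a ⊗_) (a⁻¹ ⊗_) right left
    where
    a⁻¹ = proj₁ (inverse a a≢0)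
    right : ∀ y → a ⊗ (a⁻¹ ⊗ y) ≡ y
    right y = trans (sym (R.*-assoc a a⁻¹ y)) (trans (cong (_⊗ y) (proj₂ (inverse a a≢0))) (R.*-identityˡ y))
    left : ∀ y → a⁻¹ ⊗ (a ⊗ y) ≡ y
    left y = ⊗-cancelˡ a a≢0 (right (a ⊗ y))

  sum-sq : (f : K → ℤ) → sum (λ x → f (x ⊗ x)) ≡ sum f
  sum-sq f = sum-reindex f (λ x → x ⊗ x) √_ √-sq left
    where
    left : ∀ x → √ (x ⊗ x) ≡ x
    left x with ⊗-zero (√ (x ⊗ x) ⊕ x) (√ (x ⊗ x) ⊕ x) (begin
        (√ (x ⊗ x) ⊕ x) ⊗ (√ (x ⊗ x) ⊕ x)   ≡⟨ frobenius _ x ⟩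
        √ (x ⊗ x) ⊗ √ (x ⊗ x) ⊕ x ⊗ x       ≡⟨ cong (_⊕ x ⊗ x) (√-sq (x ⊗ x)) ⟩
        x ⊗ x ⊕ x ⊗ x                       ≡⟨ x⊕x≡𝟘 (x ⊗ x) ⟩
        𝟘                                   ∎)
    ... | inj₁ e = ⊕-≡𝟘 _ x e
    ... | inj₂ e = ⊕-≡𝟘 _ x e

  self-negative : ∀ (i : ℤ) → i ≡ - i → i ≡ 0ℤ
  self-negative (+ zero) _ = refl

  -- Orthogonality. For a ≠ 0 the sum equals that of `χ` itself, and a shift by an element of trace
  -- 1 turns it into its negative.
  sum-χ : ∀ a → sum (λ x → χ (a ⊗ x)) ≡ + q * [ a ≟ 𝟘 ]
  sum-χ a with a ≟ 𝟘
  ... | yes refl = trans (sum-cong-≗ λ x → trans (cong χ (R.zeroˡ x)) χ-𝟘) (sum-const q 1ℤ)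
  ... | no a≢0 = trans (trans (sum-scale a≢0 χ) ∑χ≡0) (sym (ℤ.*-zeroʳ (+ q)))
    where
    ∑χ≡0 : sum χ ≡ 0ℤ
    ∑χ≡0 with Tr-nonzero
    ... | t , Tr-t≡1 = self-negative (sum χ) (begin
      sum χ                    ≡⟨ sym (sum-shift t χ) ⟩
      sum (λ x → χ (x ⊕ t))    ≡⟨ sum-cong-≗ (λ x → χ-⊕ x t) ⟩
      sum (λ x → χ x * χ t)    ≡⟨ sum-*ʳ (χ t) χ ⟩
      sum χ * χ t              ≡⟨ cong (sum χ *_) (trans (χ-def t) (trans (cong sgn Tr-t≡1) sgn-𝟙)) ⟩
      sum χ * -1ℤ              ≡⟨ ℤ.*-comm (sum χ) -1ℤ ⟩
      -1ℤ * sum χ              ≡⟨ ℤ.-1*i≡-i (sum χ) ⟩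
      - sum χ                  ∎)

  sq : K → K
  sq x = x ⊗ x

  form : K → K → K → K → K
  form a b c x = a ⊗ x ^ 5 ⊕ b ⊗ x ^ 3 ⊕ c ⊗ x

  -- The polarisations (x + z)⁵ + x⁵ + z⁵ and (x + z)³ + x³ + z³ in characteristic 2.
  β γ : K → K → K
  β x z = sq (sq x) ⊗ z ⊕ x ⊗ sq (sq z)
  γ x z = sq x ⊗ z ⊕ x ⊗ sq z

  form-polar : ∀ a b c x z →
    form a b c (x ⊕ z) ≡ form a b c x ⊕ form a b c z ⊕ (a ⊗ β x z ⊕ b ⊗ γ x z)
  form-polar = solve 5 (λ a b c x z →
    let sq = λ x → x :* x
        f = λ x → a :* x :^ 5 :+ b :* x :^ 3 :+ c :* x
        β = sq (sq x) :* z :+ x :* sq (sq z)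
        γ = sq x :* z :+ x :* sq z
    in f (x :+ z) := f x :+ f z :+ (a :* β :+ b :* γ)) refl

  -- Tr (a β x z + b γ x z) = Tr (x⁴ L a b z), because Tr is invariant under squaring.
  L : K → K → K → K
  L a b z = a ⊗ z ⊕ sq (b ⊗ z) ⊕ sq (sq (b ⊗ sq z)) ⊕ sq (sq (a ⊗ sq (sq z)))

  χ-bilinear : ∀ a b x z → χ (a ⊗ β x z ⊕ b ⊗ γ x z) ≡ χ (sq (sq x) ⊗ L a b z)
  χ-bilinear a b x z = begin
    χ (a ⊗ β x z ⊕ b ⊗ γ x z)
      ≡⟨ cong χ (solve 4 (λ a b x z →
           let sq = λ x → x :* x
           in a :* (sq (sq x) :* z :+ x :* sq (sq z)) :+ b :* (sq x :* z :+ x :* sq z)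
           := sq (sq x) :* (a :* z) :+ sq x :* (b :* z) :+ x :* (b :* sq z) :+ x :* (a :* sq (sq z))) refl a b x z) ⟩
    χ (t₁ ⊕ t₂ ⊕ t₃ ⊕ t₄)                               ≡⟨ χ-⊕₄ t₁ t₂ t₃ t₄ ⟩
    χ t₁ * χ t₂ * χ t₃ * χ t₄
      -- The four terms contain x⁴, x², x and x; squaring them 0, 1, 2 and 2 times makes x⁴ a factor
      -- of each.
      ≡⟨ cong₂ _*_ (cong₂ _*_ (cong (χ t₁ *_) (sym (χ-sq t₂))) (sym (χ-⁴ t₃))) (sym (χ-⁴ t₄)) ⟩
    χ t₁ * χ (sq t₂) * χ (sq (sq t₃)) * χ (sq (sq t₄))  ≡⟨ sym (χ-⊕₄ t₁ (sq t₂) (sq (sq t₃)) (sq (sq t₄))) ⟩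
    χ (t₁ ⊕ sq t₂ ⊕ sq (sq t₃) ⊕ sq (sq t₄))
      ≡⟨ cong χ (solve 5 (λ x u v w t →
           let sq = λ x → x :* x
           in sq (sq x) :* u :+ sq (sq x :* v) :+ sq (sq (x :* w)) :+ sq (sq (x :* t))
           := sq (sq x) :* (u :+ sq v :+ sq (sq w) :+ sq (sq t))) refl x (a ⊗ z) (b ⊗ z) (b ⊗ sq z) (a ⊗ sq (sq z))) ⟩
    χ (sq (sq x) ⊗ L a b z) ∎
    where
    t₁ = sq (sq x) ⊗ (a ⊗ z)
    t₂ = sq x ⊗ (b ⊗ z)
    t₃ = x ⊗ (b ⊗ sq z)
    t₄ = x ⊗ (a ⊗ sq (sq z))
    χ-⊕₄ : ∀ s t u v → χ (s ⊕ t ⊕ u ⊕ v) ≡ χ s * χ t * χ u * χ v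
    χ-⊕₄ s t u v = trans (χ-⊕ _ v) (cong (_* χ v) (trans (χ-⊕ _ u) (cong (_* χ u) (χ-⊕ s t))))
    χ-⁴ : ∀ t → χ (sq (sq t)) ≡ χ t
    χ-⁴ t = trans (χ-sq (sq t)) (χ-sq t)

  -- As x ↦ x⁴ permutes the field, this is orthogonality with x⁴ as the summation variable. The
  -- zeros of `L a b` are thus the radical of the polar form.
  sum-χ-bilinear : ∀ a b z → sum (λ x → χ (a ⊗ β x z ⊕ b ⊗ γ x z)) ≡ + q * [ L a b z ≟ 𝟘 ]
  sum-χ-bilinear a b z = begin
    sum (λ x → χ (a ⊗ β x z ⊕ b ⊗ γ x z))    ≡⟨ sum-cong-≗ (λ x → χ-bilinear a b x z) ⟩
    sum (λ x → χ (sq (sq x) ⊗ L a b z))      ≡⟨ sum-sq (λ x → χ (sq x ⊗ L a b z)) ⟩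
    sum (λ x → χ (sq x ⊗ L a b z))           ≡⟨ sum-sq (λ x → χ (x ⊗ L a b z)) ⟩
    sum (λ x → χ (x ⊗ L a b z))              ≡⟨ sum-cong-≗ (λ x → cong χ (R.*-comm x (L a b z))) ⟩
    sum (λ x → χ (L a b z ⊗ x))              ≡⟨ sum-χ (L a b z) ⟩
    + q * [ L a b z ≟ 𝟘 ]                    ∎

  L-⊕ : ∀ a b z w → L a b (z ⊕ w) ≡ L a b z ⊕ L a b w
  L-⊕ a b z w = begin
    a ⊗ (z ⊕ w) ⊕ sq (b ⊗ (z ⊕ w)) ⊕ sq (sq (b ⊗ sq (z ⊕ w))) ⊕ sq (sq (a ⊗ sq (sq (z ⊕ w))))
      ≡⟨ cong₂ _⊕_ (cong₂ _⊕_ (cong₂ _⊕_ (dist a z w) (cong sq (dist b z w)))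
           (cong (λ t → sq (sq t)) (trans (cong (b ⊗_) (frobenius z w)) (dist b (sq z) (sq w)))))
           (cong (λ t → sq (sq t)) (trans (cong (a ⊗_) (frobenius⁴ z w)) (dist a (sq (sq z)) (sq (sq w))))) ⟩
    (a ⊗ z ⊕ a ⊗ w) ⊕ sq (b ⊗ z ⊕ b ⊗ w) ⊕ sq (sq (b ⊗ sq z ⊕ b ⊗ sq w))
      ⊕ sq (sq (a ⊗ sq (sq z) ⊕ a ⊗ sq (sq w)))
      ≡⟨ cong₂ _⊕_ (cong₂ _⊕_ (cong (a ⊗ z ⊕ a ⊗ w ⊕_) (frobenius _ _)) (frobenius⁴ _ _)) (frobenius⁴ _ _) ⟩
    (a ⊗ z ⊕ a ⊗ w) ⊕ (sq (b ⊗ z) ⊕ sq (b ⊗ w)) ⊕ (sq (sq (b ⊗ sq z)) ⊕ sq (sq (b ⊗ sq w)))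
      ⊕ (sq (sq (a ⊗ sq (sq z))) ⊕ sq (sq (a ⊗ sq (sq w))))
      ≡⟨ solve 8 (λ a b c d e f g h → (a :+ b) :+ (c :+ d) :+ (e :+ f) :+ (g :+ h) := (a :+ c :+ e :+ g) :+ (b :+ d :+ f :+ h))
           refl _ _ _ _ _ _ _ _ ⟩
    L a b z ⊕ L a b w ∎
    where
    dist = R.distribˡ
    frobenius⁴ : ∀ x y → sq (sq (x ⊕ y)) ≡ sq (sq x) ⊕ sq (sq y)
    frobenius⁴ x y = trans (cong sq (frobenius x y)) (frobenius (sq x) (sq y))

  V : K → K → K → ℤ
  V a b c = sum (λ x → χ (form a b c x))

  radicalSize : K → K → ℤ
  radicalSize a b = sum (λ z → [ L a b z ≟ 𝟘 ])

  -- After y = z + x the factor χ(f x) squares to 1, and only the polar term still depends on x; its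
  -- sum over x is q on the radical and 0 elsewhere.
  V² : ∀ a b c → V a b c * V a b c ≡ + q * sum (λ z → [ L a b z ≟ 𝟘 ] * χ (form a b c z))
  V² a b c = begin
    V a b c * V a b c
      ≡⟨ sym (sum-× (χ ∘ f) (χ ∘ f)) ⟩
    sum (λ x → sum (λ y → χ (f x) * χ (f y)))
      ≡⟨ sum-cong-≗ (λ x → sym (sum-shift x (λ y → χ (f x) * χ (f y)))) ⟩
    sum (λ x → sum (λ z → χ (f x) * χ (f (z ⊕ x))))
      ≡⟨ sum-cong₂ polarise ⟩
    sum (λ x → sum (λ z → χ (f z) * χ (a ⊗ β x z ⊕ b ⊗ γ x z)))
      ≡⟨ ∑-comm (λ x z → χ (f z) * χ (a ⊗ β x z ⊕ b ⊗ γ x z)) ⟩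
    sum (λ z → sum (λ x → χ (f z) * χ (a ⊗ β x z ⊕ b ⊗ γ x z)))
      ≡⟨ sum-cong-≗ (λ z → trans (sum-*ˡ (χ (f z)) (λ x → χ (a ⊗ β x z ⊕ b ⊗ γ x z))) (cong (χ (f z) *_) (sum-χ-bilinear a b z))) ⟩
    sum (λ z → χ (f z) * (+ q * [ L a b z ≟ 𝟘 ]))
      ≡⟨ sum-cong-≗ (λ z → rearrange (χ (f z)) (+ q) [ L a b z ≟ 𝟘 ]) ⟩
    sum (λ z → + q * ([ L a b z ≟ 𝟘 ] * χ (f z)))
      ≡⟨ sum-*ˡ (+ q) (λ z → [ L a b z ≟ 𝟘 ] * χ (f z)) ⟩
    + q * sum (λ z → [ L a b z ≟ 𝟘 ] * χ (f z)) ∎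
    where
    f = form a b c
    rearrange : ∀ x y z → x * (y * z) ≡ y * (z * x)
    rearrange = solve-∀
    cancel : ∀ x z t → x * (x * z * t) ≡ x * x * (z * t)
    cancel = solve-∀
    polarise : ∀ x z → χ (f x) * χ (f (z ⊕ x)) ≡ χ (f z) * χ (a ⊗ β x z ⊕ b ⊗ γ x z)
    polarise x z = begin
      χ (f x) * χ (f (z ⊕ x))
        ≡⟨ cong (λ t → χ (f x) * χ t) (trans (cong f (R.+-comm z x)) (form-polar a b c x z)) ⟩
      χ (f x) * χ (f x ⊕ f z ⊕ B)
        ≡⟨ cong (χ (f x) *_) (trans (χ-⊕ _ B) (cong (_* χ B) (χ-⊕ (f x) (f z)))) ⟩
      χ (f x) * (χ (f x) * χ (f z) * χ B)    ≡⟨ cancel (χ (f x)) (χ (f z)) (χ B) ⟩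
      χ (f x) * χ (f x) * (χ (f z) * χ B)    ≡⟨ cong (_* (χ (f z) * χ B)) (χ-*-idem (f x)) ⟩
      1ℤ * (χ (f z) * χ B)                   ≡⟨ ℤ.*-identityˡ _ ⟩
      χ (f z) * χ B                          ∎
      where
      B = a ⊗ β x z ⊕ b ⊗ γ x z

  -- On the radical χ ∘ form is a homomorphism to {±1}, so its sum there is 0 or the size of the radical.
  V²-values : ∀ a b c → V a b c * V a b c ≡ 0ℤ ⊎ V a b c * V a b c ≡ + q * radicalSize a b
  V²-values a b c with Fin.any? (λ z → L a b z ≟ 𝟘 ×-dec χ (form a b c z) ℤ.≟ -1ℤ)
  ... | no none = inj₂ (trans (V² a b c) (cong (+ q *_) (sum-cong-≗ trivial)))
    where
    trivial : ∀ z → [ L a b z ≟ 𝟘 ] * χ (form a b c z) ≡ [ L a b z ≟ 𝟘 ]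
    trivial z = trans ([]-subst (L a b z ≟ 𝟘) is1) (ℤ.*-identityʳ _)
      where
      is1 : L a b z ≡ 𝟘 → χ (form a b c z) ≡ 1ℤ
      is1 Lz≡0 with χ-±1 (form a b c z)
      ... | inj₁ e = e
      ... | inj₂ e = contradiction (z , Lz≡0 , e) none
  ... | yes (w , Lw≡0 , χw≡-1) = inj₁ (trans (V² a b c)
      (trans (cong (+ q *_) (self-negative _ S≡-S)) (ℤ.*-zeroʳ (+ q))))
    where
    f = form a b c
    g : K → ℤ
    g z = [ L a b z ≟ 𝟘 ] * χ (f z)
    χ-f-⊕ : ∀ z → χ (f (z ⊕ w)) ≡ - χ (f z)
    χ-f-⊕ z = begin
      χ (f (z ⊕ w))                                  ≡⟨ cong χ (form-polar a b c z w) ⟩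
      χ (f z ⊕ f w ⊕ (a ⊗ β z w ⊕ b ⊗ γ z w))        ≡⟨ χ-⊕ _ _ ⟩
      χ (f z ⊕ f w) * χ (a ⊗ β z w ⊕ b ⊗ γ z w)      ≡⟨ cong₂ _*_ (χ-⊕ (f z) (f w)) (χ-bilinear a b z w) ⟩
      χ (f z) * χ (f w) * χ (sq (sq z) ⊗ L a b w)
        ≡⟨ cong₂ _*_ (cong (χ (f z) *_) χw≡-1)
             (trans (cong χ (trans (cong (sq (sq z) ⊗_) Lw≡0) (R.zeroʳ _))) χ-𝟘) ⟩
      χ (f z) * -1ℤ * 1ℤ                             ≡⟨ ℤ.*-identityʳ _ ⟩
      χ (f z) * -1ℤ                                  ≡⟨ ℤ.*-comm (χ (f z)) -1ℤ ⟩
      -1ℤ * χ (f z)                                  ≡⟨ ℤ.-1*i≡-i (χ (f z)) ⟩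
      - χ (f z)                                      ∎
    L-shift : ∀ z → L a b (z ⊕ w) ≡ L a b z
    L-shift z = trans (L-⊕ a b z w) (trans (cong (L a b z ⊕_) Lw≡0) (R.+-identityʳ _))
    g-⊕ : ∀ z → g (z ⊕ w) ≡ - g z
    g-⊕ z = trans (cong₂ _*_ (cong (λ t → [ t ≟ 𝟘 ]) (L-shift z)) (χ-f-⊕ z))
      (sym (ℤ.neg-distribʳ-* [ L a b z ≟ 𝟘 ] (χ (f z))))
    S≡-S : sum g ≡ - sum g
    S≡-S = trans (sym (sum-shift w g)) (trans (sum-cong-≗ g-⊕) (sum-neg g))

  -- Parseval: in the expanded square, c occurs only through χ((y + x) c), so summing over c leaves
  -- the diagonal y = x.
  sum-V² : ∀ a b → sum (λ c → V a b c * V a b c) ≡ + q * + q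
  sum-V² a b = begin
    sum (λ c → V a b c * V a b c)
      ≡⟨ sum-cong-≗ (λ c → sym (sum-× (χ ∘ form a b c) (χ ∘ form a b c))) ⟩
    sum (λ c → sum (λ x → sum (λ y → χ (form a b c x) * χ (form a b c y))))
      ≡⟨ ∑-comm (λ c x → sum (λ y → χ (form a b c x) * χ (form a b c y))) ⟩
    sum (λ x → sum (λ c → sum (λ y → χ (form a b c x) * χ (form a b c y))))
      ≡⟨ sum-cong-≗ (λ x → ∑-comm (λ c y → χ (form a b c x) * χ (form a b c y))) ⟩
    sum (λ x → sum (λ y → sum (λ c → χ (form a b c x) * χ (form a b c y))))
      ≡⟨ sum-cong₂ inner ⟩
    sum (λ x → sum (λ y → [ y ≟ x ] * (+ q * χ (form a b 𝟘 x ⊕ form a b 𝟘 y))))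
      ≡⟨ sum-cong-≗ (λ x → sum-pick (λ y → + q * χ (form a b 𝟘 x ⊕ form a b 𝟘 y)) x) ⟩
    sum (λ x → + q * χ (form a b 𝟘 x ⊕ form a b 𝟘 x))
      ≡⟨ sum-cong-≗ (λ x → trans (cong (λ t → + q * t) (trans (cong χ (x⊕x≡𝟘 (form a b 𝟘 x))) χ-𝟘)) (ℤ.*-identityʳ (+ q))) ⟩
    sum {q} (λ x → + q)
      ≡⟨ sum-const q (+ q) ⟩
    + q * + q ∎
    where
    inner : ∀ x y → sum (λ c → χ (form a b c x) * χ (form a b c y))
                    ≡ [ y ≟ x ] * (+ q * χ (form a b 𝟘 x ⊕ form a b 𝟘 y))
    inner x y = begin
      sum (λ c → χ (form a b c x) * χ (form a b c y))
        ≡⟨ sum-cong-≗ (λ c → trans (sym (χ-⊕ _ _)) (trans (cong χ (split c)) (χ-⊕ _ _))) ⟩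
      sum (λ c → χ (form a b 𝟘 x ⊕ form a b 𝟘 y) * χ ((y ⊕ x) ⊗ c))
        ≡⟨ trans (sum-*ˡ (χ (form a b 𝟘 x ⊕ form a b 𝟘 y)) (λ c → χ ((y ⊕ x) ⊗ c))) (cong (χ (form a b 𝟘 x ⊕ form a b 𝟘 y) *_) (sum-χ (y ⊕ x))) ⟩
      χ (form a b 𝟘 x ⊕ form a b 𝟘 y) * (+ q * [ y ⊕ x ≟ 𝟘 ])
        ≡⟨ rearrange (χ (form a b 𝟘 x ⊕ form a b 𝟘 y)) (+ q) [ y ⊕ x ≟ 𝟘 ] ⟩
      [ y ⊕ x ≟ 𝟘 ] * (+ q * χ (form a b 𝟘 x ⊕ form a b 𝟘 y))
        ≡⟨ cong (_* (+ q * χ (form a b 𝟘 x ⊕ form a b 𝟘 y)))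
             ([]-cong (y ⊕ x ≟ 𝟘) (y ≟ x) (⊕-≡𝟘 y x) (λ { refl → x⊕x≡𝟘 y })) ⟩
      [ y ≟ x ] * (+ q * χ (form a b 𝟘 x ⊕ form a b 𝟘 y)) ∎
      where
      rearrange : ∀ x y z → x * (y * z) ≡ z * (y * x)
      rearrange = solve-∀
      split : ∀ c → form a b c x ⊕ form a b c y ≡ form a b 𝟘 x ⊕ form a b 𝟘 y ⊕ (y ⊕ x) ⊗ c
      split c = solve 5 (λ a b c x y →
        let f = λ c x → a :* x :^ 5 :+ b :* x :^ 3 :+ c :* x
        in f c x :+ f c y := f (con false) x :+ f (con false) y :+ (y :+ x) :* c) refl a b c x y

-- First and second moment of the radical size

sum₂ : ∀ {m n} → (Fin m → Fin n → ℤ) → ℤ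
sum₂ f = sum (λ x → sum (f x))

sum₂-comm : ∀ {k l m n} (F : Fin k → Fin l → Fin m → Fin n → ℤ) →
  sum₂ (λ a b → sum₂ (λ x y → F a b x y)) ≡ sum₂ (λ x y → sum₂ (λ a b → F a b x y))
sum₂-comm F = begin
  sum (λ a → sum (λ b → sum (λ x → sum (λ y → F a b x y))))
    ≡⟨ sum-cong-≗ (λ a → ∑-comm (λ b x → sum (λ y → F a b x y))) ⟩
  sum (λ a → sum (λ x → sum (λ b → sum (λ y → F a b x y))))
    ≡⟨ ∑-comm (λ a x → sum (λ b → sum (λ y → F a b x y))) ⟩
  sum (λ x → sum (λ a → sum (λ b → sum (λ y → F a b x y))))
    ≡⟨ sum-cong₂ (λ x a → ∑-comm (λ b y → F a b x y)) ⟩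
  sum (λ x → sum (λ a → sum (λ y → sum (λ b → F a b x y))))
    ≡⟨ sum-cong-≗ (λ x → ∑-comm (λ a y → sum (λ b → F a b x y))) ⟩
  sum (λ x → sum (λ y → sum (λ a → sum (λ b → F a b x y)))) ∎

sum₂-*ˡ : ∀ {m n} c (f : Fin m → Fin n → ℤ) → sum₂ (λ x y → c * f x y) ≡ c * sum₂ f
sum₂-*ˡ c f = trans (sum-cong-≗ λ x → sum-*ˡ c (f x)) (sum-*ˡ c (λ x → sum (f x)))

sum₂-*ʳ : ∀ {m n} c (f : Fin m → Fin n → ℤ) → sum₂ (λ x y → f x y * c) ≡ sum₂ f * c
sum₂-*ʳ c f = trans (sum-cong-≗ λ x → sum-*ʳ c (f x)) (sum-*ʳ c (λ x → sum (f x)))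

sum₂-+ : ∀ {m n} (f g : Fin m → Fin n → ℤ) → sum₂ (λ x y → f x y + g x y) ≡ sum₂ f + sum₂ g
sum₂-+ f g = trans (sum-cong-≗ λ x → ∑-distrib-+ (f x) (g x)) (∑-distrib-+ (λ x → sum (f x)) (λ x → sum (g x)))

sum₂-× : ∀ {k l m n} (f : Fin k → Fin l → ℤ) (g : Fin m → Fin n → ℤ) →
  sum₂ (λ x y → sum₂ (λ u v → f x y * g u v)) ≡ sum₂ f * sum₂ g
sum₂-× f g = trans (sum-cong₂ λ x y → sum₂-*ˡ (f x y) g) (sum₂-*ʳ (sum₂ g) f)

module Moments {q : ℕ} (𝔽 : FieldStructure q) (m : ℕ) (q≡2^m : q ≡ 2 ℕ.^ m) where
  open Characters 𝔽 m q≡2^m public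

  q≢0 : q ≢ 0
  q≢0 refl = Fin.¬Fin0 𝟘

  instance
    +q-nonZero : ℤ.NonZero (+ q)
    +q-nonZero = ℕ.≢-nonZero q≢0

  [⊕] : ∀ (x y : K) → [ x ⊕ y ≟ 𝟘 ] ≡ [ x ≟ y ]
  [⊕] x y = []-cong (x ⊕ y ≟ 𝟘) (x ≟ y) (⊕-≡𝟘 x y) (λ { refl → x⊕x≡𝟘 x })

  sum-χ₂ : ∀ s t → sum₂ (λ a b → χ (a ⊗ s ⊕ b ⊗ t)) ≡ (+ q * + q) * ([ s ≟ 𝟘 ] * [ t ≟ 𝟘 ])
  sum-χ₂ s t = begin
    sum₂ (λ a b → χ (a ⊗ s ⊕ b ⊗ t))
      ≡⟨ sum-cong₂ (λ a b → trans (χ-⊕ (a ⊗ s) (b ⊗ t)) (cong₂ (λ x y → χ x * χ y) (R.*-comm a s) (R.*-comm b t))) ⟩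
    sum₂ (λ a b → χ (s ⊗ a) * χ (t ⊗ b))
      ≡⟨ sum-× (λ a → χ (s ⊗ a)) (λ b → χ (t ⊗ b)) ⟩
    sum (λ a → χ (s ⊗ a)) * sum (λ b → χ (t ⊗ b))
      ≡⟨ cong₂ _*_ (sum-χ s) (sum-χ t) ⟩
    + q * [ s ≟ 𝟘 ] * (+ q * [ t ≟ 𝟘 ])
      ≡⟨ rearrange (+ q) [ s ≟ 𝟘 ] [ t ≟ 𝟘 ] ⟩
    (+ q * + q) * ([ s ≟ 𝟘 ] * [ t ≟ 𝟘 ]) ∎
    where
    rearrange : ∀ q x y → q * x * (q * y) ≡ (q * q) * (x * y)
    rearrange = solve-∀

  -- Replaces indicators by characters that are linear in a and b, so that sums over (a, b) fall
  -- under orthogonality. Two copies of this give the second moment.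
  q*radicalSize : ∀ a b → + q * radicalSize a b ≡ sum₂ (λ z x → χ (a ⊗ β x z ⊕ b ⊗ γ x z))
  q*radicalSize a b = begin
    + q * radicalSize a b                  ≡⟨ sym (sum-*ˡ (+ q) (λ z → [ L a b z ≟ 𝟘 ])) ⟩
    sum (λ z → + q * [ L a b z ≟ 𝟘 ])      ≡⟨ sum-cong-≗ (λ z → sym (sum-χ-bilinear a b z)) ⟩
    sum₂ (λ z x → χ (a ⊗ β x z ⊕ b ⊗ γ x z)) ∎

  first-moment-count : sum₂ radicalSize ≡ + q * sum₂ (λ z x → [ β x z ≟ 𝟘 ] * [ γ x z ≟ 𝟘 ])
  first-moment-count = ℤ.*-cancelˡ-≡ (+ q) _ _ (begin
    + q * sum₂ radicalSize
      ≡⟨ sym (sum₂-*ˡ (+ q) radicalSize) ⟩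
    sum₂ (λ a b → + q * radicalSize a b)
      ≡⟨ sum-cong₂ q*radicalSize ⟩
    sum₂ (λ a b → sum₂ (λ z x → χ (a ⊗ β x z ⊕ b ⊗ γ x z)))
      ≡⟨ sum₂-comm (λ a b z x → χ (a ⊗ β x z ⊕ b ⊗ γ x z)) ⟩
    sum₂ (λ z x → sum₂ (λ a b → χ (a ⊗ β x z ⊕ b ⊗ γ x z)))
      ≡⟨ sum-cong₂ (λ z x → sum-χ₂ (β x z) (γ x z)) ⟩
    sum₂ (λ z x → (+ q * + q) * ([ β x z ≟ 𝟘 ] * [ γ x z ≟ 𝟘 ]))
      ≡⟨ sum₂-*ˡ (+ q * + q) (λ z x → [ β x z ≟ 𝟘 ] * [ γ x z ≟ 𝟘 ]) ⟩
    (+ q * + q) * sum₂ (λ z x → [ β x z ≟ 𝟘 ] * [ γ x z ≟ 𝟘 ])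
      ≡⟨ ℤ.*-assoc (+ q) (+ q) _ ⟩
    + q * (+ q * sum₂ (λ z x → [ β x z ≟ 𝟘 ] * [ γ x z ≟ 𝟘 ])) ∎)

  second-moment-count : sum₂ (λ a b → radicalSize a b * radicalSize a b) ≡
    sum₂ (λ z x → sum₂ (λ w y → [ β x z ≟ β y w ] * [ γ x z ≟ γ y w ]))
  second-moment-count = ℤ.*-cancelˡ-≡ (+ q) _ _ (ℤ.*-cancelˡ-≡ (+ q) _ _ (begin
    + q * (+ q * sum₂ (λ a b → radicalSize a b * radicalSize a b))
      ≡⟨ sym (ℤ.*-assoc (+ q) (+ q) _) ⟩
    + q * + q * sum₂ (λ a b → radicalSize a b * radicalSize a b)
      ≡⟨ sym (sum₂-*ˡ (+ q * + q) (λ a b → radicalSize a b * radicalSize a b)) ⟩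
    sum₂ (λ a b → + q * + q * (radicalSize a b * radicalSize a b))
      ≡⟨ sum-cong₂ (λ a b → square (+ q) (radicalSize a b)) ⟩
    sum₂ (λ a b → (+ q * radicalSize a b) * (+ q * radicalSize a b))
      ≡⟨ sum-cong₂ (λ a b → cong (λ t → t * t) (q*radicalSize a b)) ⟩
    sum₂ (λ a b → sum₂ (λ z x → χ (a ⊗ β x z ⊕ b ⊗ γ x z)) * sum₂ (λ w y → χ (a ⊗ β y w ⊕ b ⊗ γ y w)))
      ≡⟨ sum-cong₂ (λ a b → sym (sum₂-× (λ z x → χ (a ⊗ β x z ⊕ b ⊗ γ x z)) (λ w y → χ (a ⊗ β y w ⊕ b ⊗ γ y w)))) ⟩
    sum₂ (λ a b → sum₂ (λ z x → sum₂ (λ w y → χ (a ⊗ β x z ⊕ b ⊗ γ x z) * χ (a ⊗ β y w ⊕ b ⊗ γ y w))))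
      ≡⟨ sum₂-comm (λ a b z x → sum₂ (λ w y → χ (a ⊗ β x z ⊕ b ⊗ γ x z) * χ (a ⊗ β y w ⊕ b ⊗ γ y w))) ⟩
    sum₂ (λ z x → sum₂ (λ a b → sum₂ (λ w y → χ (a ⊗ β x z ⊕ b ⊗ γ x z) * χ (a ⊗ β y w ⊕ b ⊗ γ y w))))
      ≡⟨ sum-cong₂ (λ z x → sum₂-comm (λ a b w y → χ (a ⊗ β x z ⊕ b ⊗ γ x z) * χ (a ⊗ β y w ⊕ b ⊗ γ y w))) ⟩
    sum₂ (λ z x → sum₂ (λ w y → sum₂ (λ a b → χ (a ⊗ β x z ⊕ b ⊗ γ x z) * χ (a ⊗ β y w ⊕ b ⊗ γ y w))))
      ≡⟨ sum-cong₂ (λ z x → sum-cong₂ (λ w y → inner x z y w)) ⟩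
    sum₂ (λ z x → sum₂ (λ w y → (+ q * + q) * ([ β x z ≟ β y w ] * [ γ x z ≟ γ y w ])))
      ≡⟨ sum-cong₂ (λ z x → sum₂-*ˡ (+ q * + q) (λ w y → [ β x z ≟ β y w ] * [ γ x z ≟ γ y w ])) ⟩
    sum₂ (λ z x → (+ q * + q) * sum₂ (λ w y → [ β x z ≟ β y w ] * [ γ x z ≟ γ y w ]))
      ≡⟨ sum₂-*ˡ (+ q * + q) (λ z x → sum₂ (λ w y → [ β x z ≟ β y w ] * [ γ x z ≟ γ y w ])) ⟩
    (+ q * + q) * sum₂ (λ z x → sum₂ (λ w y → [ β x z ≟ β y w ] * [ γ x z ≟ γ y w ]))
      ≡⟨ ℤ.*-assoc (+ q) (+ q) _ ⟩
    + q * (+ q * sum₂ (λ z x → sum₂ (λ w y → [ β x z ≟ β y w ] * [ γ x z ≟ γ y w ]))) ∎))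
    where
    square : ∀ q r → q * q * (r * r) ≡ (q * r) * (q * r)
    square = solve-∀
    inner : ∀ x z y w → sum₂ (λ a b → χ (a ⊗ β x z ⊕ b ⊗ γ x z) * χ (a ⊗ β y w ⊕ b ⊗ γ y w))
            ≡ (+ q * + q) * ([ β x z ≟ β y w ] * [ γ x z ≟ γ y w ])
    inner x z y w = begin
      sum₂ (λ a b → χ (a ⊗ β x z ⊕ b ⊗ γ x z) * χ (a ⊗ β y w ⊕ b ⊗ γ y w))
        ≡⟨ sum-cong₂ (λ a b → trans (sym (χ-⊕ _ _)) (cong χ
             (solve 6 (λ a b s t u v → a :* s :+ b :* t :+ (a :* u :+ b :* v) := a :* (s :+ u) :+ b :* (t :+ v))
               refl a b (β x z) (γ x z) (β y w) (γ y w)))) ⟩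
      sum₂ (λ a b → χ (a ⊗ (β x z ⊕ β y w) ⊕ b ⊗ (γ x z ⊕ γ y w)))
        ≡⟨ sum-χ₂ (β x z ⊕ β y w) (γ x z ⊕ γ y w) ⟩
      (+ q * + q) * ([ β x z ⊕ β y w ≟ 𝟘 ] * [ γ x z ⊕ γ y w ≟ 𝟘 ])
        ≡⟨ cong₂ (λ s t → (+ q * + q) * (s * t)) ([⊕] (β x z) (β y w)) ([⊕] (γ x z) (γ y w)) ⟩
      (+ q * + q) * ([ β x z ≟ β y w ] * [ γ x z ≟ γ y w ]) ∎

  δ : K → K → K
  δ x z = sq x ⊕ x ⊗ z ⊕ sq z

  β≡γδ : ∀ x z → β x z ≡ γ x z ⊗ δ x z
  β≡γδ = solve 2 (λ x z →
    let sq = λ x → x :* x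
    in sq (sq x) :* z :+ x :* sq (sq z) := (sq x :* z :+ x :* sq z) :* (sq x :+ x :* z :+ sq z)) refl

  γ-factor : ∀ x z → γ x z ≡ x ⊗ (z ⊗ (z ⊕ x))
  γ-factor = solve 2 (λ x z → x :* x :* z :+ x :* (z :* z) := x :* (z :* (z :+ x))) refl

  γ-𝟘ˡ : ∀ z → γ 𝟘 z ≡ 𝟘
  γ-𝟘ˡ = solve 1 (λ z → con false :* con false :* z :+ con false :* (z :* z) := con false) refl

  γ-𝟘ʳ : ∀ x → γ x 𝟘 ≡ 𝟘
  γ-𝟘ʳ = solve 1 (λ x → x :* x :* con false :+ x :* (con false :* con false) := con false) refl

  γ-diagonal : ∀ x → γ x x ≡ 𝟘
  γ-diagonal = solve 1 (λ x → x :* x :* x :+ x :* (x :* x) := con false) refl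

  γ-zeros : ∀ {x z} → x ≢ 𝟘 → γ x z ≡ 𝟘 → z ≡ 𝟘 ⊎ z ≡ x
  γ-zeros {x} {z} x≢0 γ≡0 with ⊗-zero x _ (trans (sym (γ-factor x z)) γ≡0)
  ... | inj₁ x≡0 = contradiction x≡0 x≢0
  ... | inj₂ e with ⊗-zero z _ e
  ...   | inj₁ z≡0 = inj₁ z≡0
  ...   | inj₂ z⊕x≡0 = inj₂ (⊕-≡𝟘 z x z⊕x≡0)

  -- Since γ = xz(x + z), the zeros are the q pairs with x = 0 and, for every other x, the two pairs
  -- with z = 0 and z = x.
  γ-zero-count : sum₂ (λ z x → [ γ x z ≟ 𝟘 ]) ≡ + 3 * + q - + 2
  γ-zero-count = begin
    sum₂ (λ z x → [ γ x z ≟ 𝟘 ])                          ≡⟨ ∑-comm (λ z x → [ γ x z ≟ 𝟘 ]) ⟩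
    sum₂ (λ x z → [ γ x z ≟ 𝟘 ])                          ≡⟨ sum-cong-≗ row ⟩
    sum (λ x → [ x ≟ 𝟘 ] * (+ q - + 2) + + 2)             ≡⟨ ∑-distrib-+ (λ x → [ x ≟ 𝟘 ] * (+ q - + 2)) (λ _ → + 2) ⟩
    sum (λ x → [ x ≟ 𝟘 ] * (+ q - + 2)) + sum {q} (λ _ → + 2)
      ≡⟨ cong₂ _+_ (sum-pick (λ _ → + q - + 2) 𝟘) (sum-const q (+ 2)) ⟩
    + q - + 2 + + q * + 2                                 ≡⟨ total (+ q) ⟩
    + 3 * + q - + 2                                       ∎
    where
    total : ∀ q → q - + 2 + q * + 2 ≡ + 3 * q - + 2
    total = solve-∀
    zero-row : ∀ q → 1ℤ * (q - + 2) + + 2 ≡ q * 1ℤ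
    zero-row = solve-∀
    row : ∀ x → sum (λ z → [ γ x z ≟ 𝟘 ]) ≡ [ x ≟ 𝟘 ] * (+ q - + 2) + + 2
    row x with x ≟ 𝟘
    ... | yes refl = begin
      sum (λ z → [ γ 𝟘 z ≟ 𝟘 ])   ≡⟨ sum-cong-≗ (λ z → []-yes (γ 𝟘 z ≟ 𝟘) (γ-𝟘ˡ z)) ⟩
      sum {q} (λ z → 1ℤ)          ≡⟨ sum-const q 1ℤ ⟩
      + q * 1ℤ                    ≡⟨ sym (zero-row (+ q)) ⟩
      1ℤ * (+ q - + 2) + + 2      ∎
    ... | no x≢0 = begin
      sum (λ z → [ γ x z ≟ 𝟘 ])                      ≡⟨ sum-cong-≗ split ⟩
      sum (λ z → [ z ≟ 𝟘 ] + [ z ≟ x ])              ≡⟨ ∑-distrib-+ (λ z → [ z ≟ 𝟘 ]) (λ z → [ z ≟ x ]) ⟩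
      sum (λ z → [ z ≟ 𝟘 ]) + sum (λ z → [ z ≟ x ])  ≡⟨ cong₂ _+_ (sum-pick₁ 𝟘) (sum-pick₁ x) ⟩
      + 2                                            ≡⟨ sym (cong (_+ + 2) (ℤ.*-zeroˡ (+ q - + 2))) ⟩
      0ℤ * (+ q - + 2) + + 2                         ∎
      where
      split : ∀ z → [ γ x z ≟ 𝟘 ] ≡ [ z ≟ 𝟘 ] + [ z ≟ x ]
      split z with z ≟ 𝟘 | z ≟ x
      ... | yes refl | yes refl = contradiction refl x≢0
      ... | yes refl | no _ = []-yes (γ x 𝟘 ≟ 𝟘) (γ-𝟘ʳ x)
      ... | no _ | yes refl = []-yes (γ x x ≟ 𝟘) (γ-diagonal x)
      ... | no z≢0 | no z≢x = []-no (γ x z ≟ 𝟘) λ e → case-⊥ (γ-zeros x≢0 e)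
        where
        case-⊥ : ¬ (z ≡ 𝟘 ⊎ z ≡ x)
        case-⊥ (inj₁ e) = z≢0 e
        case-⊥ (inj₂ e) = z≢x e

  γ≡𝟘⇒β≡𝟘 : ∀ x z → γ x z ≡ 𝟘 → β x z ≡ 𝟘
  γ≡𝟘⇒β≡𝟘 x z γ≡0 = trans (β≡γδ x z) (trans (cong (_⊗ δ x z) γ≡0) (R.zeroˡ _))

  [β][γ] : ∀ x z → [ β x z ≟ 𝟘 ] * [ γ x z ≟ 𝟘 ] ≡ [ γ x z ≟ 𝟘 ]
  [β][γ] x z = trans (ℤ.*-comm [ β x z ≟ 𝟘 ] [ γ x z ≟ 𝟘 ])
    (trans ([]-subst (γ x z ≟ 𝟘) (λ e → []-yes (β x z ≟ 𝟘) (γ≡𝟘⇒β≡𝟘 x z e))) (ℤ.*-identityʳ _))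

  first-moment : sum₂ radicalSize ≡ + q * (+ 3 * + q - + 2)
  first-moment = trans first-moment-count (cong (+ q *_) (trans (sum-cong₂ λ z x → [β][γ] x z) γ-zero-count))

  -- For γ x z ≢ 𝟘, the pairs with the same β and γ are the ordered bases of the plane spanned by x
  -- and z: its nonzero vectors are the nonzero roots of X⁴ + δ X² + γ X, and δ = β / γ.
  module _ {x z : K} (γ≢0 : γ x z ≢ 𝟘) where
    InPlane : K → Set
    InPlane v = v ≡ x ⊎ v ≡ z ⊎ v ≡ x ⊕ z

    inPlane? : ∀ v → Dec (InPlane v)
    inPlane? v = (v ≟ x) ⊎-dec ((v ≟ z) ⊎-dec (v ≟ x ⊕ z))

    inPlane-count : sum (λ v → [ inPlane? v ]) ≡ + 3
    inPlane-count = begin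
      sum (λ v → [ inPlane? v ])
        ≡⟨ sum-cong-≗ split ⟩
      sum (λ v → [ v ≟ x ] + ([ v ≟ z ] + [ v ≟ x ⊕ z ]))
        ≡⟨ ∑-distrib-+ (λ v → [ v ≟ x ]) (λ v → [ v ≟ z ] + [ v ≟ x ⊕ z ]) ⟩
      sum (λ v → [ v ≟ x ]) + sum (λ v → [ v ≟ z ] + [ v ≟ x ⊕ z ])
        ≡⟨ cong₂ _+_ (sum-pick₁ x) (trans (∑-distrib-+ (λ v → [ v ≟ z ]) (λ v → [ v ≟ x ⊕ z ]))
                                           (cong₂ _+_ (sum-pick₁ z) (sum-pick₁ (x ⊕ z)))) ⟩
      + 3 ∎
      where
      split : ∀ v → [ inPlane? v ] ≡ [ v ≟ x ] + ([ v ≟ z ] + [ v ≟ x ⊕ z ])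
      split v with v ≟ x | v ≟ z | v ≟ x ⊕ z
      ... | yes refl | yes refl | _ = contradiction (γ-diagonal x) γ≢0
      ... | yes refl | no _ | yes x≡x⊕z = contradiction
        (trans (cong (γ x) (sym (RP.+-cancelˡ x _ _ (trans (R.+-identityʳ x) x≡x⊕z)))) (γ-𝟘ʳ x)) γ≢0
      ... | yes refl | no _ | no _ = refl
      ... | no _ | yes refl | yes z≡x⊕z = contradiction
        (trans (cong (λ t → γ t z) (sym (RP.+-cancelʳ z _ _ (trans (R.+-identityˡ z) z≡x⊕z)))) (γ-𝟘ˡ z)) γ≢0
      ... | no _ | yes refl | no _ = refl
      ... | no _ | no _ | yes _ = refl
      ... | no _ | no _ | no _ = refl

    root⇒inPlane : ∀ v → v ≢ 𝟘 → sq (sq v) ⊕ δ x z ⊗ sq v ⊕ γ x z ⊗ v ≡ 𝟘 → InPlane v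
    root⇒inPlane v v≢0 e with ⊗-zero v _ (trans (sym (factor x z v)) e)
      where
      factor : ∀ x z v → sq (sq v) ⊕ δ x z ⊗ sq v ⊕ γ x z ⊗ v ≡ v ⊗ ((v ⊕ x) ⊗ ((v ⊕ z) ⊗ (v ⊕ (x ⊕ z))))
      factor = solve 3 (λ x z v →
        let sq = λ x → x :* x
        in sq (sq v) :+ (sq x :+ x :* z :+ sq z) :* sq v :+ (sq x :* z :+ x :* sq z) :* v
        := v :* ((v :+ x) :* ((v :+ z) :* (v :+ (x :+ z))))) refl
    ... | inj₁ v≡0 = contradiction v≡0 v≢0
    ... | inj₂ e₁ with ⊗-zero _ _ e₁
    ...   | inj₁ v⊕x≡0 = inj₁ (⊕-≡𝟘 v x v⊕x≡0)
    ...   | inj₂ e₂ with ⊗-zero _ _ e₂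
    ...     | inj₁ v⊕z≡0 = inj₂ (inj₁ (⊕-≡𝟘 v z v⊕z≡0))
    ...     | inj₂ v⊕x⊕z≡0 = inj₂ (inj₂ (⊕-≡𝟘 v (x ⊕ z) v⊕x⊕z≡0))

    -- Cancelling γ shows that δ agrees as well, so both pairs define the same quartic; y and w are
    -- roots of the quartic that they define.
    same⇒basis : ∀ y w → β x z ≡ β y w → γ x z ≡ γ y w → InPlane y × InPlane w × y ≢ w
    same⇒basis y w β≡ γ≡ =
      root⇒inPlane y (λ { refl → γ≢0 (trans γ≡ (γ-𝟘ˡ w)) }) (transport rootˡ) ,
      root⇒inPlane w (λ { refl → γ≢0 (trans γ≡ (γ-𝟘ʳ y)) }) (transport rootʳ) ,
      (λ { refl → γ≢0 (trans γ≡ (γ-diagonal y)) })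
      where
      δ≡ : δ x z ≡ δ y w
      δ≡ = ⊗-cancelˡ (γ x z) γ≢0 (begin
        γ x z ⊗ δ x z  ≡⟨ sym (β≡γδ x z) ⟩
        β x z          ≡⟨ β≡ ⟩
        β y w          ≡⟨ β≡γδ y w ⟩
        γ y w ⊗ δ y w  ≡⟨ cong (_⊗ δ y w) (sym γ≡) ⟩
        γ x z ⊗ δ y w  ∎)
      transport : ∀ {v} → sq (sq v) ⊕ δ y w ⊗ sq v ⊕ γ y w ⊗ v ≡ 𝟘 → sq (sq v) ⊕ δ x z ⊗ sq v ⊕ γ x z ⊗ v ≡ 𝟘
      transport {v} = trans (cong₂ (λ d g → sq (sq v) ⊕ d ⊗ sq v ⊕ g ⊗ v) δ≡ γ≡)
      rootˡ : sq (sq y) ⊕ δ y w ⊗ sq y ⊕ γ y w ⊗ y ≡ 𝟘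
      rootˡ = solve 2 (λ y w →
        let sq = λ x → x :* x
        in sq (sq y) :+ (sq y :+ y :* w :+ sq w) :* sq y :+ (sq y :* w :+ y :* sq w) :* y := con false) refl y w
      rootʳ : sq (sq w) ⊕ δ y w ⊗ sq w ⊕ γ y w ⊗ w ≡ 𝟘
      rootʳ = solve 2 (λ y w →
        let sq = λ x → x :* x
        in sq (sq w) :+ (sq y :+ y :* w :+ sq w) :* sq w :+ (sq y :* w :+ y :* sq w) :* w := con false) refl y w

    γ≡⇒ : ∀ {y w} → γ x z ≡ γ y w → δ x z ≡ δ y w → β x z ≡ β y w × γ x z ≡ γ y w
    γ≡⇒ {y} {w} γ≡ δ≡ = trans (β≡γδ x z) (trans (cong₂ _⊗_ γ≡ δ≡) (sym (β≡γδ y w))) , γ≡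

    private
      γ′ δ′ : ∀ {n} → Solver.Polynomial n → Solver.Polynomial n → Solver.Polynomial n
      γ′ x z = x :* x :* z :+ x :* (z :* z)
      δ′ x z = x :* x :+ x :* z :+ z :* z

    basis⇒same : ∀ y w → InPlane y × InPlane w × y ≢ w → β x z ≡ β y w × γ x z ≡ γ y w
    basis⇒same y w (inj₁ refl , inj₁ refl , y≢w) = contradiction refl y≢w
    basis⇒same y w (inj₁ refl , inj₂ (inj₁ refl) , y≢w) = refl , refl
    basis⇒same y w (inj₁ refl , inj₂ (inj₂ refl) , y≢w) = γ≡⇒
      (solve 2 (λ x z → γ′ x z := γ′ x (x :+ z)) refl x z) (solve 2 (λ x z → δ′ x z := δ′ x (x :+ z)) refl x z)
    basis⇒same y w (inj₂ (inj₁ refl) , inj₁ refl , y≢w) = γ≡⇒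
      (solve 2 (λ x z → γ′ x z := γ′ z x) refl x z) (solve 2 (λ x z → δ′ x z := δ′ z x) refl x z)
    basis⇒same y w (inj₂ (inj₁ refl) , inj₂ (inj₁ refl) , y≢w) = contradiction refl y≢w
    basis⇒same y w (inj₂ (inj₁ refl) , inj₂ (inj₂ refl) , y≢w) = γ≡⇒
      (solve 2 (λ x z → γ′ x z := γ′ z (x :+ z)) refl x z) (solve 2 (λ x z → δ′ x z := δ′ z (x :+ z)) refl x z)
    basis⇒same y w (inj₂ (inj₂ refl) , inj₁ refl , y≢w) = γ≡⇒
      (solve 2 (λ x z → γ′ x z := γ′ (x :+ z) x) refl x z) (solve 2 (λ x z → δ′ x z := δ′ (x :+ z) x) refl x z)
    basis⇒same y w (inj₂ (inj₂ refl) , inj₂ (inj₁ refl) , y≢w) = γ≡⇒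
      (solve 2 (λ x z → γ′ x z := γ′ (x :+ z) z) refl x z) (solve 2 (λ x z → δ′ x z := δ′ (x :+ z) z) refl x z)
    basis⇒same y w (inj₂ (inj₂ refl) , inj₂ (inj₂ refl) , y≢w) = contradiction refl y≢w

    -- Ordered bases of the plane: three nonzero vectors for w, and for y the two others.
    basis-count : sum₂ (λ w y → [ β x z ≟ β y w ] * [ γ x z ≟ γ y w ]) ≡ + 6
    basis-count = begin
      sum₂ (λ w y → [ β x z ≟ β y w ] * [ γ x z ≟ γ y w ])
        ≡⟨ sum-cong₂ pointwise ⟩
      sum₂ (λ w y → [ inPlane? w ] * ([ inPlane? y ] - [ y ≟ w ] * [ inPlane? y ]))
        ≡⟨ sum-cong-≗ row ⟩
      sum (λ w → [ inPlane? w ] * + 2)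
        ≡⟨ trans (sum-*ʳ (+ 2) (λ w → [ inPlane? w ])) (cong (_* + 2) inPlane-count) ⟩
      + 6 ∎
      where
      pointwise : ∀ w y → [ β x z ≟ β y w ] * [ γ x z ≟ γ y w ] ≡
                  [ inPlane? w ] * ([ inPlane? y ] - [ y ≟ w ] * [ inPlane? y ])
      pointwise w y = begin
        [ β x z ≟ β y w ] * [ γ x z ≟ γ y w ]
          ≡⟨ sym ([]-× (β x z ≟ β y w) (γ x z ≟ γ y w)) ⟩
        [ (β x z ≟ β y w) ×-dec (γ x z ≟ γ y w) ]
          ≡⟨ []-cong ((β x z ≟ β y w) ×-dec (γ x z ≟ γ y w)) (inPlane? y ×-dec (inPlane? w ×-dec ¬? (y ≟ w)))
               (λ { (β≡ , γ≡) → same⇒basis y w β≡ γ≡ }) (basis⇒same y w) ⟩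
        [ inPlane? y ×-dec (inPlane? w ×-dec ¬? (y ≟ w)) ]
          ≡⟨ trans ([]-× (inPlane? y) (inPlane? w ×-dec ¬? (y ≟ w))) (cong ([ inPlane? y ] *_)
               (trans ([]-× (inPlane? w) (¬? (y ≟ w))) (cong ([ inPlane? w ] *_) ([]-¬ (y ≟ w))))) ⟩
        [ inPlane? y ] * ([ inPlane? w ] * (1ℤ - [ y ≟ w ]))
          ≡⟨ rearrange [ inPlane? y ] [ inPlane? w ] [ y ≟ w ] ⟩
        [ inPlane? w ] * ([ inPlane? y ] - [ y ≟ w ] * [ inPlane? y ]) ∎
        where
        rearrange : ∀ i j e → i * (j * (1ℤ - e)) ≡ j * (i - e * i)
        rearrange = solve-∀
      row : ∀ w → sum (λ y → [ inPlane? w ] * ([ inPlane? y ] - [ y ≟ w ] * [ inPlane? y ])) ≡ [ inPlane? w ] * + 2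
      row w = begin
        sum (λ y → [ inPlane? w ] * ([ inPlane? y ] - [ y ≟ w ] * [ inPlane? y ]))
          ≡⟨ sum-*ˡ [ inPlane? w ] (λ y → [ inPlane? y ] - [ y ≟ w ] * [ inPlane? y ]) ⟩
        [ inPlane? w ] * sum (λ y → [ inPlane? y ] - [ y ≟ w ] * [ inPlane? y ])
          ≡⟨ cong ([ inPlane? w ] *_) (trans (sum-- (λ y → [ inPlane? y ]) (λ y → [ y ≟ w ] * [ inPlane? y ]))
               (cong₂ _-_ inPlane-count (sum-pick (λ y → [ inPlane? y ]) w))) ⟩
        [ inPlane? w ] * (+ 3 - [ inPlane? w ])
          ≡⟨ []-subst (inPlane? w) (λ w∈ → cong (λ t → + 3 - t) ([]-yes (inPlane? w) w∈)) ⟩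
        [ inPlane? w ] * + 2 ∎

  -- The right side is 3q - 2 where γ vanishes and 6 elsewhere. In the first case β vanishes too,
  -- and the pairs counted are the zeros of γ.
  same-count : ∀ x z → sum₂ (λ w y → [ β x z ≟ β y w ] * [ γ x z ≟ γ y w ]) ≡
               [ γ x z ≟ 𝟘 ] * (+ 3 * + q - + 2 - + 6) + + 6
  same-count x z with γ x z ≟ 𝟘
  ... | no γ≢0 = trans (basis-count γ≢0) (sym (cong (_+ + 6) (ℤ.*-zeroˡ (+ 3 * + q - + 2 - + 6))))
  ... | yes γ≡0 = begin
    sum₂ (λ w y → [ β x z ≟ β y w ] * [ γ x z ≟ γ y w ])
      ≡⟨ sum-cong₂ (λ w y → trans (cong₂ _*_ (flip (γ≡𝟘⇒β≡𝟘 x z γ≡0) (β y w)) (flip γ≡0 (γ y w))) ([β][γ] y w)) ⟩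
    sum₂ (λ w y → [ γ y w ≟ 𝟘 ])        ≡⟨ γ-zero-count ⟩
    + 3 * + q - + 2                     ≡⟨ arith (+ 3 * + q - + 2) ⟩
    1ℤ * (+ 3 * + q - + 2 - + 6) + + 6  ∎
    where
    arith : ∀ t → t ≡ 1ℤ * (t - + 6) + + 6
    arith = solve-∀
    flip : ∀ {s} → s ≡ 𝟘 → ∀ t → [ s ≟ t ] ≡ [ t ≟ 𝟘 ]
    flip {s} s≡0 t = []-cong (s ≟ t) (t ≟ 𝟘) (λ e → trans (sym e) s≡0) (λ e → trans s≡0 (sym e))

  second-moment : sum₂ (λ a b → radicalSize a b * radicalSize a b) ≡ + 15 * (+ q * + q) - + 30 * + q + + 16
  second-moment = begin
    sum₂ (λ a b → radicalSize a b * radicalSize a b)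
      ≡⟨ second-moment-count ⟩
    sum₂ (λ z x → sum₂ (λ w y → [ β x z ≟ β y w ] * [ γ x z ≟ γ y w ]))
      ≡⟨ sum-cong₂ (λ z x → same-count x z) ⟩
    sum₂ (λ z x → [ γ x z ≟ 𝟘 ] * (+ 3 * + q - + 2 - + 6) + + 6)
      ≡⟨ sum₂-+ (λ z x → [ γ x z ≟ 𝟘 ] * (+ 3 * + q - + 2 - + 6)) (λ _ _ → + 6) ⟩
    sum₂ (λ z x → [ γ x z ≟ 𝟘 ] * (+ 3 * + q - + 2 - + 6)) + sum₂ {q} {q} (λ _ _ → + 6)
      ≡⟨ cong₂ _+_ (trans (sum₂-*ʳ (+ 3 * + q - + 2 - + 6) (λ z x → [ γ x z ≟ 𝟘 ]))
                          (cong (_* (+ 3 * + q - + 2 - + 6)) γ-zero-count))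
                   (trans (sum-cong-≗ λ _ → sum-const q (+ 6)) (sum-const q (+ q * + 6))) ⟩
    (+ 3 * + q - + 2) * (+ 3 * + q - + 2 - + 6) + + q * (+ q * + 6)
      ≡⟨ total (+ q) ⟩
    + 15 * (+ q * + q) - + 30 * + q + + 16 ∎
    where
    total : ∀ q → (+ 3 * q - + 2) * (+ 3 * q - + 2 - + 6) + q * (q * + 6) ≡ + 15 * (q * q) - + 30 * q + + 16
    total = solve-∀

-- Lengths of filtered lists as sums of indicators

sumList : ∀ {a} {A : Set a} → (A → ℤ) → List A → ℤ
sumList f = foldr (λ x t → f x + t) 0ℤ

sumList-filter : ∀ {a p} {A : Set a} {P : Pred A p} (P? : Decidable P) xs →
  + length (filter P? xs) ≡ sumList (λ x → [ P? x ]) xs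
sumList-filter P? [] = refl
sumList-filter P? (x ∷ xs) with P? x
... | yes _ = cong (λ t → 1ℤ + t) (sumList-filter P? xs)
... | no _ = trans (sumList-filter P? xs) (sym (ℤ.+-identityˡ _))

sumList-++ : ∀ {a} {A : Set a} (f : A → ℤ) xs ys → sumList f (xs List.++ ys) ≡ sumList f xs + sumList f ys
sumList-++ f [] ys = sym (ℤ.+-identityˡ _)
sumList-++ f (x ∷ xs) ys = trans (cong (λ t → f x + t) (sumList-++ f xs ys)) (sym (ℤ.+-assoc (f x) _ _))

sumList-map : ∀ {a b} {A : Set a} {B : Set b} (f : B → ℤ) (g : A → B) xs →
  sumList f (List.map g xs) ≡ sumList (λ x → f (g x)) xs
sumList-map f g [] = refl
sumList-map f g (x ∷ xs) = cong (λ t → f (g x) + t) (sumList-map f g xs)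

sumList-cartesianProduct : ∀ {a b} {A : Set a} {B : Set b} (f : A × B → ℤ) xs ys →
  sumList f (cartesianProduct xs ys) ≡ sumList (λ x → sumList (λ y → f (x , y)) ys) xs
sumList-cartesianProduct f [] ys = refl
sumList-cartesianProduct f (x ∷ xs) ys = trans (sumList-++ f (List.map (x ,_) ys) (cartesianProduct xs ys))
  (cong₂ _+_ (sumList-map f (x ,_) ys) (sumList-cartesianProduct f xs ys))

sumList-tabulate : ∀ {a} {A : Set a} (f : A → ℤ) {n} (g : Fin n → A) → sumList f (List.tabulate g) ≡ sum (λ i → f (g i))
sumList-tabulate f {zero} g = sym (sum-empty (λ i → f (g i)))
sumList-tabulate f {suc n} g = trans (cong (λ t → f (g zero) + t) (sumList-tabulate f (g ∘ suc))) (sym (sum-suc (λ i → f (g i))))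

length-filter-tabulate : ∀ {a p} {A : Set a} {P : Pred A p} (P? : Decidable P) {n} (g : Fin n → A) →
  + length (filter P? (tabulate g)) ≡ sum (λ i → [ P? (g i) ])
length-filter-tabulate P? g = trans (sumList-filter P? (tabulate g)) (sumList-tabulate (λ x → [ P? x ]) g)

-- Possible sizes of the radical

square-quotient : ∀ s v k → v ℕ.* v ≡ 2 ℕ.^ s ℕ.* 2 ℕ.^ s ℕ.* k → ∃[ u ] u ℕ.* u ≡ k
square-quotient zero v k e = v , trans e (ℕ.*-identityˡ k)
square-quotient (suc s) v k e = descend (reduce (euclidsLemma v v prime[2] 2∣v²))
  where
  4x : ∀ x k → 2 ℕ.* x ℕ.* (2 ℕ.* x) ℕ.* k ≡ (2 ℕ.* (x ℕ.* x ℕ.* k)) ℕ.* 2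
  4x = ℕSolver.solve-∀
  2∣v² : 2 ∣ℕ v ℕ.* v
  2∣v² = divides (2 ℕ.* (2 ℕ.^ s ℕ.* 2 ℕ.^ s ℕ.* k)) (trans e (4x (2 ℕ.^ s) k))
  regroup : ∀ w → 2 ℕ.* (2 ℕ.* (w ℕ.* w)) ≡ w ℕ.* 2 ℕ.* (w ℕ.* 2)
  regroup = ℕSolver.solve-∀
  4x′ : ∀ x k → 2 ℕ.* x ℕ.* (2 ℕ.* x) ℕ.* k ≡ 2 ℕ.* (2 ℕ.* (x ℕ.* x ℕ.* k))
  4x′ = ℕSolver.solve-∀
  descend : 2 ∣ℕ v → ∃[ u ] u ℕ.* u ≡ k
  -- With v = 2w both sides carry a factor 4, which cancels.
  descend (divides w refl) = square-quotient s w k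
    (ℕ.*-cancelˡ-≡ _ _ 2 (ℕ.*-cancelˡ-≡ _ _ 2 (trans (regroup w) (trans e (4x′ (2 ℕ.^ s) k)))))

3∤2^ : ∀ n → ¬ (3 ∣ℕ 2 ℕ.^ n)
3∤2^ zero d = from-no (3 ∣ℕ? 1) d
3∤2^ (suc n) d = [ from-no (3 ∣ℕ? 2) , 3∤2^ n ]′ (euclidsLemma 2 (2 ℕ.^ n) (from-yes (prime? 3)) d)

square≤16 : ∀ u → u ℕ.* u ℕ.≤ 16 → u ≡ 0 ⊎ u ≡ 1 ⊎ u ≡ 2 ⊎ u ≡ 3 ⊎ u ≡ 4
square≤16 0 _ = inj₁ refl
square≤16 1 _ = inj₂ (inj₁ refl)
square≤16 2 _ = inj₂ (inj₂ (inj₁ refl))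
square≤16 3 _ = inj₂ (inj₂ (inj₂ (inj₁ refl)))
square≤16 4 _ = inj₂ (inj₂ (inj₂ (inj₂ refl)))
square≤16 (suc (suc (suc (suc (suc u))))) u²≤16 =
  contradiction (ℕ.≤-trans (ℕ.*-mono-≤ 5≤ 5≤) u²≤16) (from-no (25 ℕ.≤? 16))
  where
  5≤ : 5 ℕ.≤ 5 ℕ.+ u
  5≤ = ℕ.m≤m+n 5 u

module Radicals {q : ℕ} (𝔽 : FieldStructure q) (s : ℕ) (q≡ : q ≡ 2 ℕ.^ (2 ℕ.* s)) where
  open Moments 𝔽 (2 ℕ.* s) q≡ public

  q≡2^s*2^s : q ≡ 2 ℕ.^ s ℕ.* 2 ℕ.^ s
  q≡2^s*2^s = trans q≡ (trans (cong (λ t → 2 ℕ.^ (s ℕ.+ t)) (ℕ.+-identityʳ s)) (ℕ.^-distribˡ-+-* 2 s s))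

  poly-monomial : ∀ c n → Polynomial c n (λ x → c ⊗ x ^ n)
  poly-monomial c zero = constant λ x → R.*-identityʳ c
  poly-monomial c (suc n) = horner 𝟘 _ (poly-monomial c n) λ x →
    solve 3 (λ c x t → c :* (x :* t) := con false :+ x :* (c :* t)) refl c x (x ^ n)

  poly-L : ∀ a b → Polynomial (sq (sq a)) 16 (L a b)
  poly-L a b = poly-cong expand (poly-+lower (poly-+lower (poly-+lower
      (poly-monomial (sq (sq a)) 16) (poly-monomial (sq (sq b)) 8) (ℕ.m≤m+n 9 7))
      (poly-monomial (sq b) 2) (ℕ.m≤m+n 3 13)) (poly-monomial a 1) (ℕ.m≤m+n 2 14))
    where
    expand : ∀ z → L a b z ≡ sq (sq a) ⊗ z ^ 16 ⊕ sq (sq b) ⊗ z ^ 8 ⊕ sq b ⊗ z ^ 2 ⊕ a ⊗ z ^ 1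
    expand z = solve 3 (λ a b z →
      let sq = λ x → x :* x
      in a :* z :+ sq (b :* z) :+ sq (sq (b :* sq z)) :+ sq (sq (a :* sq (sq z)))
      := sq (sq a) :* z :^ 16 :+ sq (sq b) :* z :^ 8 :+ sq b :* z :^ 2 :+ a :* z :^ 1) refl a b z

  -- For a = 0 the coefficient of z¹⁶ is lost; the root bound then rests on b ≠ 0 and degree 8.
  poly-L-𝟘 : ∀ b → Polynomial (sq (sq b)) 8 (L 𝟘 b)
  poly-L-𝟘 b = poly-cong expand (poly-+lower (poly-monomial (sq (sq b)) 8) (poly-monomial (sq b) 2) (ℕ.m≤m+n 3 5))
    where
    expand : ∀ z → L 𝟘 b z ≡ sq (sq b) ⊗ z ^ 8 ⊕ sq b ⊗ z ^ 2
    expand z = solve 2 (λ b z →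
      let sq = λ x → x :* x
      in con false :* z :+ sq (b :* z) :+ sq (sq (b :* sq z)) :+ sq (sq (con false :* sq (sq z)))
      := sq (sq b) :* z :^ 8 :+ sq b :* z :^ 2) refl b z

  radical : K → K → List K
  radical a b = filter (λ z → L a b z ≟ 𝟘) (allFin q)

  radicalSize≡length : ∀ a b → radicalSize a b ≡ + length (radical a b)
  radicalSize≡length a b = sym (length-filter-tabulate (λ z → L a b z ≟ 𝟘) (λ z → z))

  radical-bound : ∀ a b → ¬ (a ≡ 𝟘 × b ≡ 𝟘) → length (radical a b) ℕ.≤ 16
  radical-bound a b ≢0 with a ≟ 𝟘
  ... | no a≢0 = roots-≤-degree (⊗-≢0 (⊗-≢0 a≢0 a≢0) (⊗-≢0 a≢0 a≢0)) (poly-L a b) (radical a b)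
          (filter⁺ (λ z → L a b z ≟ 𝟘) (allFin⁺ q)) (all-filter (λ z → L a b z ≟ 𝟘) (allFin q))
  ... | yes refl = ℕ.≤-trans
          (roots-≤-degree (⊗-≢0 (⊗-≢0 b≢0 b≢0) (⊗-≢0 b≢0 b≢0)) (poly-L-𝟘 b) (radical 𝟘 b)
            (filter⁺ (λ z → L 𝟘 b z ≟ 𝟘) (allFin⁺ q)) (all-filter (λ z → L 𝟘 b z ≟ 𝟘) (allFin q)))
          (ℕ.m≤m+n 8 8)
    where
    b≢0 : b ≢ 𝟘
    b≢0 b≡0 = ≢0 (refl , b≡0)

  nonzeroCount : K → K → ℤ
  nonzeroCount a b = sum (λ c → [ ¬? (V a b c ℤ.≟ 0ℤ) ])

  V²≡ : ∀ a b c → V a b c * V a b c ≡ + q * radicalSize a b * [ ¬? (V a b c ℤ.≟ 0ℤ) ]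
  V²≡ a b c with V a b c ℤ.≟ 0ℤ
  ... | yes V≡0 = trans (cong (λ t → t * t) V≡0) (sym (ℤ.*-zeroʳ (+ q * radicalSize a b)))
  ... | no V≢0 with V²-values a b c
  ...   | inj₁ V²≡0 = contradiction (reduce (ℤ.i*j≡0⇒i≡0∨j≡0 (V a b c) V²≡0)) V≢0
  ...   | inj₂ V²≡qr = trans V²≡qr (sym (ℤ.*-identityʳ _))

  -- Every nonzero V² equals qr, so with n nonzero values Parseval reads q r n = q². In particular r
  -- divides q.
  radicalSize*nonzeroCount : ∀ a b → radicalSize a b * nonzeroCount a b ≡ + q
  radicalSize*nonzeroCount a b = ℤ.*-cancelˡ-≡ (+ q) _ _ (begin
    + q * (radicalSize a b * nonzeroCount a b)
      ≡⟨ sym (ℤ.*-assoc (+ q) (radicalSize a b) (nonzeroCount a b)) ⟩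
    + q * radicalSize a b * nonzeroCount a b
      ≡⟨ sym (sum-*ˡ (+ q * radicalSize a b) (λ c → [ ¬? (V a b c ℤ.≟ 0ℤ) ])) ⟩
    sum (λ c → + q * radicalSize a b * [ ¬? (V a b c ℤ.≟ 0ℤ) ])
      ≡⟨ sum-cong-≗ (λ c → sym (V²≡ a b c)) ⟩
    sum (λ c → V a b c * V a b c)
      ≡⟨ sum-V² a b ⟩
    + q * + q ∎)

  radicalSize-𝟘 : radicalSize 𝟘 𝟘 ≡ + q
  radicalSize-𝟘 = trans (sum-cong-≗ λ z → []-yes (L 𝟘 𝟘 z ≟ 𝟘) (L-𝟘 z))
    (trans (sum-const q 1ℤ) (ℤ.*-identityʳ (+ q)))
    where
    L-𝟘 : ∀ z → L 𝟘 𝟘 z ≡ 𝟘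
    L-𝟘 z = solve 1 (λ z →
      let sq = λ x → x :* x
          𝟘 = con false
      in 𝟘 :* z :+ sq (𝟘 :* z) :+ sq (sq (𝟘 :* sq z)) :+ sq (sq (𝟘 :* sq (sq z))) := 𝟘) refl z

  -- Some V a b c is nonzero, and its square is 4ˢ times the size of the radical, which is thus a square;
  -- it also divides q.
  radicalSize-square : ∀ a b → ∃[ u ] + (u ℕ.* u) ≡ radicalSize a b
  radicalSize-square a b with Fin.any? (λ c → ¬? (V a b c ℤ.≟ 0ℤ))
  ... | no none = contradiction (begin
      + q                                    ≡⟨ sym (radicalSize*nonzeroCount a b) ⟩
      radicalSize a b * nonzeroCount a b     ≡⟨ cong (radicalSize a b *_)
        (trans (sum-cong-≗ λ c → []-no (¬? (V a b c ℤ.≟ 0ℤ)) (λ V≢0 → none (c , V≢0))) (sum-zero q)) ⟩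
      radicalSize a b * 0ℤ                   ≡⟨ ℤ.*-zeroʳ (radicalSize a b) ⟩
      0ℤ                                     ∎) (λ e → q≢0 (ℤ.+-injective e))
  ... | yes (c , V≢0) with square-quotient s ℤ.∣ V a b c ∣ (length (radical a b)) (begin
      ℤ.∣ V a b c ∣ ℕ.* ℤ.∣ V a b c ∣              ≡⟨ sym (ℤ.abs-* (V a b c) (V a b c)) ⟩
      ℤ.∣ V a b c * V a b c ∣                      ≡⟨ cong ℤ.∣_∣ (trans (V²≡ a b c)
        (trans (cong (+ q * radicalSize a b *_) ([]-yes (¬? (V a b c ℤ.≟ 0ℤ)) V≢0)) (ℤ.*-identityʳ (+ q * radicalSize a b)))) ⟩
      ℤ.∣ + q * radicalSize a b ∣                  ≡⟨ ℤ.abs-* (+ q) (radicalSize a b) ⟩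
      q ℕ.* ℤ.∣ radicalSize a b ∣                  ≡⟨ cong₂ ℕ._*_ q≡2^s*2^s (cong ℤ.∣_∣ (radicalSize≡length a b)) ⟩
      2 ℕ.^ s ℕ.* 2 ℕ.^ s ℕ.* length (radical a b) ∎)
  ...   | u , u²≡ = u , trans (cong +_ u²≡) (sym (radicalSize≡length a b))

  -- A square of at most 16 is 0, 1, 4, 9 or 16. Neither 0 nor 9 can divide q, a power of 2.
  radicalSize-values : ∀ a b →
    (a ≡ 𝟘 × b ≡ 𝟘) ⊎ radicalSize a b ≡ + 1 ⊎ radicalSize a b ≡ + 4 ⊎ radicalSize a b ≡ + 16
  radicalSize-values a b with (a ≟ 𝟘) ×-dec (b ≟ 𝟘)
  ... | yes ab≡0 = inj₁ ab≡0
  ... | no ab≢0 with radicalSize-square a b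
  ...   | u , u²≡r with square≤16 u (subst (ℕ._≤ 16)
            (sym (ℤ.+-injective (trans u²≡r (radicalSize≡length a b)))) (radical-bound a b ab≢0))
  ...     | inj₁ refl = contradiction
              (trans (sym (radicalSize*nonzeroCount a b)) (trans (cong (_* nonzeroCount a b) (sym u²≡r)) (ℤ.*-zeroˡ (nonzeroCount a b))))
              (λ e → q≢0 (ℤ.+-injective e))
  ...     | inj₂ (inj₁ refl) = inj₂ (inj₁ (sym u²≡r))
  ...     | inj₂ (inj₂ (inj₁ refl)) = inj₂ (inj₂ (inj₁ (sym u²≡r)))
  ...     | inj₂ (inj₂ (inj₂ (inj₁ refl))) = contradiction (divides (3 ℕ.* ℤ.∣ nonzeroCount a b ∣) (begin
              2 ℕ.^ (2 ℕ.* s)                            ≡⟨ sym q≡ ⟩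
              ℤ.∣ + q ∣                                  ≡⟨ cong ℤ.∣_∣ (sym (radicalSize*nonzeroCount a b)) ⟩
              ℤ.∣ radicalSize a b * nonzeroCount a b ∣   ≡⟨ cong (λ r → ℤ.∣ r * nonzeroCount a b ∣) (sym u²≡r) ⟩
              ℤ.∣ + 9 * nonzeroCount a b ∣               ≡⟨ ℤ.abs-* (+ 9) (nonzeroCount a b) ⟩
              9 ℕ.* ℤ.∣ nonzeroCount a b ∣               ≡⟨ regroup ℤ.∣ nonzeroCount a b ∣ ⟩
              3 ℕ.* ℤ.∣ nonzeroCount a b ∣ ℕ.* 3         ∎)) (3∤2^ (2 ℕ.* s))
            where
            regroup : ∀ n → 9 ℕ.* n ≡ 3 ℕ.* n ℕ.* 3
            regroup = ℕSolver.solve-∀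
  ...     | inj₂ (inj₂ (inj₂ (inj₂ refl))) = inj₂ (inj₂ (inj₂ (sym u²≡r)))

-- Numbers of codewords with a given exponential sum

square-zero : ∀ i → i * i ≡ 0ℤ → i ≡ 0ℤ
square-zero i e = reduce (ℤ.i*j≡0⇒i≡0∨j≡0 i e)

squares-equal : ∀ i j → i * i ≡ j * j → i ≡ j ⊎ - i ≡ j
squares-equal i j e with ℤ.i*j≡0⇒i≡0∨j≡0 (i - j) (trans (factor i j) (ℤ.i≡j⇒i-j≡0 {i * i} {j * j} e))
  where
  factor : ∀ i j → (i - j) * (i + j) ≡ i * i - j * j
  factor = solve-∀
... | inj₁ i-j≡0 = inj₁ (ℤ.i-j≡0⇒i≡j i j i-j≡0)
... | inj₂ i+j≡0 = inj₂ (sym (ℤ.i-j≡0⇒i≡j j (- i) (trans (flip i j) i+j≡0)))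
  where
  flip : ∀ i j → j - (- i) ≡ i + j
  flip = solve-∀

module WeightCounts {q : ℕ} (𝔽 : FieldStructure q) (s : ℕ) (q≡ : q ≡ 2 ℕ.^ (2 ℕ.* s)) (17≤q : 17 ℕ.≤ q) where
  open Radicals 𝔽 s q≡ public

  -- Separates the radical at a = b = 0, which is the whole field, from those of size 1, 4 and 16.
  q≢ : ∀ k → k ℕ.≤ 16 → + q ≢ + k
  q≢ k k≤16 e = ℕ.<⇒≢ (ℕ.≤-trans (s≤s k≤16) 17≤q) (sym (ℤ.+-injective e))

  origin : K → K → ℤ
  origin a b = [ a ≟ 𝟘 ] * [ b ≟ 𝟘 ]

  [r≡_] : ℤ → K → K → ℤ
  [r≡ k ] a b = [ radicalSize a b ℤ.≟ k ]

  opaque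
    rankCount : ℤ → ℤ
    rankCount k = sum₂ [r≡ k ]

    rankCount-def : ∀ k → rankCount k ≡ sum₂ [r≡ k ]
    rankCount-def k = refl

  origin-sum : sum₂ origin ≡ 1ℤ
  origin-sum = trans (sum-× (λ a → [ a ≟ 𝟘 ]) (λ b → [ b ≟ 𝟘 ])) (cong₂ _*_ (sum-pick₁ 𝟘) (sum-pick₁ 𝟘))

  module _ (f : K → K → ℤ) {v₁ v₄ v₁₆ vq : ℤ}
           (f₁ : ∀ a b → radicalSize a b ≡ + 1 → f a b ≡ v₁) (f₄ : ∀ a b → radicalSize a b ≡ + 4 → f a b ≡ v₄)
           (f₁₆ : ∀ a b → radicalSize a b ≡ + 16 → f a b ≡ v₁₆) (fq : ∀ a b → radicalSize a b ≡ + q → f a b ≡ vq) where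

    private
      expansion : ℤ → ℤ → ℤ → ℤ → ℤ
      expansion i j k l = v₁ * i + v₄ * j + v₁₆ * k + vq * l

      at : ∀ {a b} r {i j k l} → [ r ℤ.≟ + 1 ] ≡ i → [ r ℤ.≟ + 4 ] ≡ j → [ r ℤ.≟ + 16 ] ≡ k →
           origin a b ≡ l → radicalSize a b ≡ r →
           expansion ([r≡ + 1 ] a b) ([r≡ + 4 ] a b) ([r≡ + 16 ] a b) (origin a b) ≡ expansion i j k l
      at {a} {b} r refl refl refl refl e =
        cong (λ r → expansion [ r ℤ.≟ + 1 ] [ r ℤ.≟ + 4 ] [ r ℤ.≟ + 16 ] (origin a b)) e

      origin≡0 : ∀ a b → radicalSize a b ≢ + q → origin a b ≡ 0ℤ
      origin≡0 a b r≢q = trans (sym ([]-× (a ≟ 𝟘) (b ≟ 𝟘)))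
        ([]-no ((a ≟ 𝟘) ×-dec (b ≟ 𝟘)) λ { (refl , refl) → r≢q radicalSize-𝟘 })

    decompose : ∀ a b → f a b ≡ expansion ([r≡ + 1 ] a b) ([r≡ + 4 ] a b) ([r≡ + 16 ] a b) (origin a b)
    decompose a b with radicalSize-values a b
    ... | inj₁ (refl , refl) = trans (fq 𝟘 𝟘 radicalSize-𝟘) (sym (trans
        (at (+ q) {0ℤ} {0ℤ} {0ℤ} {1ℤ} ([]-no (+ q ℤ.≟ + 1) (q≢ 1 (ℕ.m≤m+n 1 15))) ([]-no (+ q ℤ.≟ + 4) (q≢ 4 (ℕ.m≤m+n 4 12)))
          ([]-no (+ q ℤ.≟ + 16) (q≢ 16 ℕ.≤-refl)) (cong (λ t → t * t) ([]-yes (𝟘 ≟ 𝟘) refl)) radicalSize-𝟘)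
        (pick v₁ v₄ v₁₆ vq)))
      where
      pick : ∀ i j k l → i * 0ℤ + j * 0ℤ + k * 0ℤ + l * 1ℤ ≡ l
      pick = solve-∀
    ... | inj₂ (inj₁ r≡) = trans (f₁ a b r≡) (sym (trans
        (at (+ 1) {1ℤ} {0ℤ} {0ℤ} {0ℤ} refl refl refl (origin≡0 a b λ e → q≢ 1 (ℕ.m≤m+n 1 15) (trans (sym e) r≡)) r≡)
        (pick v₁ v₄ v₁₆ vq)))
      where
      pick : ∀ i j k l → i * 1ℤ + j * 0ℤ + k * 0ℤ + l * 0ℤ ≡ i
      pick = solve-∀
    ... | inj₂ (inj₂ (inj₁ r≡)) = trans (f₄ a b r≡) (sym (trans
        (at (+ 4) {0ℤ} {1ℤ} {0ℤ} {0ℤ} refl refl refl (origin≡0 a b λ e → q≢ 4 (ℕ.m≤m+n 4 12) (trans (sym e) r≡)) r≡)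
        (pick v₁ v₄ v₁₆ vq)))
      where
      pick : ∀ i j k l → i * 0ℤ + j * 1ℤ + k * 0ℤ + l * 0ℤ ≡ j
      pick = solve-∀
    ... | inj₂ (inj₂ (inj₂ r≡)) = trans (f₁₆ a b r≡) (sym (trans
        (at (+ 16) {0ℤ} {0ℤ} {1ℤ} {0ℤ} refl refl refl (origin≡0 a b λ e → q≢ 16 ℕ.≤-refl (trans (sym e) r≡)) r≡)
        (pick v₁ v₄ v₁₆ vq)))
      where
      pick : ∀ i j k l → i * 0ℤ + j * 0ℤ + k * 1ℤ + l * 0ℤ ≡ k
      pick = solve-∀

    -- The three moments and the total number of nonzero V are all sums of a function of the radical
    -- size. The last summand belongs to a = b = 0, the only pair of radical size q.
    sum₂-decompose : sum₂ f ≡ v₁ * rankCount (+ 1) + v₄ * rankCount (+ 4) + v₁₆ * rankCount (+ 16) + vq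
    sum₂-decompose = begin
      sum₂ f
        ≡⟨ sum-cong₂ decompose ⟩
      sum₂ (λ a b → v₁ * [r≡ + 1 ] a b + v₄ * [r≡ + 4 ] a b + v₁₆ * [r≡ + 16 ] a b + vq * origin a b)
        ≡⟨ sum₂-+ (λ a b → v₁ * [r≡ + 1 ] a b + v₄ * [r≡ + 4 ] a b + v₁₆ * [r≡ + 16 ] a b) (λ a b → vq * origin a b) ⟩
      sum₂ (λ a b → v₁ * [r≡ + 1 ] a b + v₄ * [r≡ + 4 ] a b + v₁₆ * [r≡ + 16 ] a b) + sum₂ (λ a b → vq * origin a b)
        ≡⟨ cong₂ _+_ (trans (sum₂-+ (λ a b → v₁ * [r≡ + 1 ] a b + v₄ * [r≡ + 4 ] a b) (λ a b → v₁₆ * [r≡ + 16 ] a b))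
             (cong₂ _+_ (trans (sum₂-+ (λ a b → v₁ * [r≡ + 1 ] a b) (λ a b → v₄ * [r≡ + 4 ] a b))
               (cong₂ _+_ (scale v₁ (+ 1)) (scale v₄ (+ 4)))) (scale v₁₆ (+ 16))))
             (trans (sum₂-*ˡ vq origin) (trans (cong (vq *_) origin-sum) (ℤ.*-identityʳ vq))) ⟩
      v₁ * rankCount (+ 1) + v₄ * rankCount (+ 4) + v₁₆ * rankCount (+ 16) + vq ∎
      where
      scale : ∀ v k → sum₂ (λ a b → v * [r≡ k ] a b) ≡ v * rankCount k
      scale v k = trans (sum₂-*ˡ v [r≡ k ]) (cong (v *_) (sym (rankCount-def k)))

  private
    N₁ N₄ N₁₆ Q : ℤ
    N₁ = rankCount (+ 1)
    N₄ = rankCount (+ 4)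
    N₁₆ = rankCount (+ 16)
    Q = + q

  moment₀ : 1ℤ * N₁ + 1ℤ * N₄ + 1ℤ * N₁₆ + 1ℤ ≡ Q * Q
  moment₀ = trans (sym (sum₂-decompose (λ _ _ → 1ℤ) (λ _ _ _ → refl) (λ _ _ _ → refl) (λ _ _ _ → refl) (λ _ _ _ → refl)))
    (trans (sum-cong-≗ λ _ → trans (sum-const q 1ℤ) (ℤ.*-identityʳ Q)) (sum-const q Q))

  moment₁ : + 1 * N₁ + + 4 * N₄ + + 16 * N₁₆ + Q ≡ Q * (+ 3 * Q - + 2)
  moment₁ = trans (sym (sum₂-decompose radicalSize (λ _ _ e → e) (λ _ _ e → e) (λ _ _ e → e) (λ _ _ e → e))) first-moment

  moment₂ : + 1 * N₁ + + 16 * N₄ + + 256 * N₁₆ + Q * Q ≡ + 15 * (Q * Q) - + 30 * Q + + 16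
  moment₂ = trans (sym (sum₂-decompose (λ a b → radicalSize a b * radicalSize a b)
    (λ _ _ → cong (λ r → r * r)) (λ _ _ → cong (λ r → r * r)) (λ _ _ → cong (λ r → r * r)) (λ _ _ → cong (λ r → r * r))))
    second-moment

  -- The combination (r - 1)(r - 4) = r² - 5r + 4 of the moments removes r = 1 and r = 4, and is 180
  -- = 3 · 60 at r = 16; its value at r = q is the contribution of the origin.
  rankCount-16 : + 60 * rankCount (+ 16) ≡ (Q - + 1) * (Q - + 4)
  rankCount-16 = ℤ.*-cancelˡ-≡ (+ 3) _ _ (begin
    + 3 * (+ 60 * N₁₆)  ≡⟨ before N₁ N₄ N₁₆ Q ⟩
    (+ 1 * N₁ + + 16 * N₄ + + 256 * N₁₆ + Q * Q) - + 5 * (+ 1 * N₁ + + 4 * N₄ + + 16 * N₁₆ + Q)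
      + + 4 * (1ℤ * N₁ + 1ℤ * N₄ + 1ℤ * N₁₆ + 1ℤ) - (Q * Q - + 5 * Q + + 4)
      ≡⟨ cong₂ (λ i j → i + j - (Q * Q - + 5 * Q + + 4)) (cong₂ (λ i j → i - + 5 * j) moment₂ moment₁) (cong (+ 4 *_) moment₀) ⟩
    (+ 15 * (Q * Q) - + 30 * Q + + 16) - + 5 * (Q * (+ 3 * Q - + 2)) + + 4 * (Q * Q) - (Q * Q - + 5 * Q + + 4)
      ≡⟨ after Q ⟩
    + 3 * ((Q - + 1) * (Q - + 4)) ∎)
    where
    before : ∀ i j k q → + 3 * (+ 60 * k) ≡
      (+ 1 * i + + 16 * j + + 256 * k + q * q) - + 5 * (+ 1 * i + + 4 * j + + 16 * k + q)
      + + 4 * (1ℤ * i + 1ℤ * j + 1ℤ * k + 1ℤ) - (q * q - + 5 * q + + 4)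
    before = solve-∀
    after : ∀ q → (+ 15 * (q * q) - + 30 * q + + 16) - + 5 * (q * (+ 3 * q - + 2)) + + 4 * (q * q) - (q * q - + 5 * q + + 4)
      ≡ + 3 * ((q - + 1) * (q - + 4))
    after = solve-∀

  -- Likewise with -(r - 1)(r - 16) = 17r - r² - 16, which is 36 = 3 · 12 at r = 4.
  rankCount-4 : + 12 * rankCount (+ 4) ≡ + 7 * (Q * (Q - + 1))
  rankCount-4 = ℤ.*-cancelˡ-≡ (+ 3) _ _ (begin
    + 3 * (+ 12 * N₄)  ≡⟨ before N₁ N₄ N₁₆ Q ⟩
    + 17 * (+ 1 * N₁ + + 4 * N₄ + + 16 * N₁₆ + Q) - (+ 1 * N₁ + + 16 * N₄ + + 256 * N₁₆ + Q * Q)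
      - + 16 * (1ℤ * N₁ + 1ℤ * N₄ + 1ℤ * N₁₆ + 1ℤ) + (Q * Q - + 17 * Q + + 16)
      ≡⟨ cong₂ (λ i j → i - j + (Q * Q - + 17 * Q + + 16)) (cong₂ (λ i j → + 17 * i - j) moment₁ moment₂) (cong (+ 16 *_) moment₀) ⟩
    + 17 * (Q * (+ 3 * Q - + 2)) - (+ 15 * (Q * Q) - + 30 * Q + + 16) - + 16 * (Q * Q) + (Q * Q - + 17 * Q + + 16)
      ≡⟨ after Q ⟩
    + 3 * (+ 7 * (Q * (Q - + 1))) ∎)
    where
    before : ∀ i j k q → + 3 * (+ 12 * j) ≡
      + 17 * (+ 1 * i + + 4 * j + + 16 * k + q) - (+ 1 * i + + 16 * j + + 256 * k + q * q)
      - + 16 * (1ℤ * i + 1ℤ * j + 1ℤ * k + 1ℤ) + (q * q - + 17 * q + + 16)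
    before = solve-∀
    after : ∀ q → + 17 * (q * (+ 3 * q - + 2)) - (+ 15 * (q * q) - + 30 * q + + 16) - + 16 * (q * q) + (q * q - + 17 * q + + 16)
      ≡ + 3 * (+ 7 * (q * (q - + 1)))
    after = solve-∀

  -- Likewise with (r - 4)(r - 16) = r² - 20r + 64, which is 45 = 3 · 15 at r = 1.
  rankCount-1 : + 15 * rankCount (+ 1) ≡ + 2 * (+ 3 * (Q * Q) + + 5 * Q - + 8)
  rankCount-1 = ℤ.*-cancelˡ-≡ (+ 3) _ _ (begin
    + 3 * (+ 15 * N₁)  ≡⟨ before N₁ N₄ N₁₆ Q ⟩
    (+ 1 * N₁ + + 16 * N₄ + + 256 * N₁₆ + Q * Q) - + 20 * (+ 1 * N₁ + + 4 * N₄ + + 16 * N₁₆ + Q)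
      + + 64 * (1ℤ * N₁ + 1ℤ * N₄ + 1ℤ * N₁₆ + 1ℤ) - (Q * Q - + 20 * Q + + 64)
      ≡⟨ cong₂ (λ i j → i + j - (Q * Q - + 20 * Q + + 64)) (cong₂ (λ i j → i - + 20 * j) moment₂ moment₁) (cong (+ 64 *_) moment₀) ⟩
    (+ 15 * (Q * Q) - + 30 * Q + + 16) - + 20 * (Q * (+ 3 * Q - + 2)) + + 64 * (Q * Q) - (Q * Q - + 20 * Q + + 64)
      ≡⟨ after Q ⟩
    + 3 * (+ 2 * (+ 3 * (Q * Q) + + 5 * Q - + 8)) ∎)
    where
    before : ∀ i j k q → + 3 * (+ 15 * i) ≡
      (+ 1 * i + + 16 * j + + 256 * k + q * q) - + 20 * (+ 1 * i + + 4 * j + + 16 * k + q)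
      + + 64 * (1ℤ * i + 1ℤ * j + 1ℤ * k + 1ℤ) - (q * q - + 20 * q + + 64)
    before = solve-∀
    after : ∀ q → (+ 15 * (q * q) - + 30 * q + + 16) - + 20 * (q * (+ 3 * q - + 2)) + + 64 * (q * q) - (q * q - + 20 * q + + 64)
      ≡ + 3 * (+ 2 * (+ 3 * (q * q) + + 5 * q - + 8))
    after = solve-∀

  opaque
    -- The two indicators stand for the two values of h, so this counts codewords, with ω = q minus
    -- twice the weight. At ω = 0 each triple (a, b, c) counts twice.
    signedCount : ℤ → ℤ
    signedCount ω = sum₂ (λ a b → sum (λ c → [ V a b c ℤ.≟ ω ] + [ - V a b c ℤ.≟ ω ]))

    signedCount-def : ∀ ω → signedCount ω ≡ sum₂ (λ a b → sum (λ c → [ V a b c ℤ.≟ ω ] + [ - V a b c ℤ.≟ ω ]))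
    signedCount-def ω = refl

  module _ (ω k : ℤ) (ω≢0 : ω ≢ 0ℤ) (ω²≡qk : ω * ω ≡ Q * k) where

    -- For a radical of size k, V² is 0 or qk = ω²; for any other size it is never ω². So both sides
    -- are ω² where V = ±ω and 0 elsewhere.
    V≡±ω : ∀ a b c → ω * ω * ([ V a b c ℤ.≟ ω ] + [ - V a b c ℤ.≟ ω ]) ≡ [r≡ k ] a b * (V a b c * V a b c)
    V≡±ω a b c with V a b c ℤ.≟ ω | - V a b c ℤ.≟ ω
    ... | yes V≡ω | yes -V≡ω = contradiction (self-negative ω (trans (sym -V≡ω) (cong (λ t → - t) V≡ω))) ω≢0
    ... | yes V≡ω | no _ = begin
      ω * ω * 1ℤ                            ≡⟨ ℤ.*-comm (ω * ω) 1ℤ ⟩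
      1ℤ * (ω * ω)                          ≡⟨ cong₂ _*_ (sym ([]-yes (radicalSize a b ℤ.≟ k) (r≡k ω²≡V²))) ω²≡V² ⟩
      [r≡ k ] a b * (V a b c * V a b c)     ∎
      where
      ω²≡V² : ω * ω ≡ V a b c * V a b c
      ω²≡V² = sym (cong (λ t → t * t) V≡ω)
      r≡k : ω * ω ≡ V a b c * V a b c → radicalSize a b ≡ k
      r≡k e with V²-values a b c
      ... | inj₁ V²≡0 = contradiction (square-zero ω (trans e V²≡0)) ω≢0
      ... | inj₂ V²≡qr = ℤ.*-cancelˡ-≡ Q _ _ (trans (sym V²≡qr) (trans (sym e) ω²≡qk))
    ... | no _ | yes -V≡ω = begin
      ω * ω * 1ℤ                            ≡⟨ ℤ.*-comm (ω * ω) 1ℤ ⟩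
      1ℤ * (ω * ω)                          ≡⟨ cong₂ _*_ (sym ([]-yes (radicalSize a b ℤ.≟ k) (r≡k ω²≡V²))) ω²≡V² ⟩
      [r≡ k ] a b * (V a b c * V a b c)     ∎
      where
      negative-square : ∀ i → - i * - i ≡ i * i
      negative-square = solve-∀
      ω²≡V² : ω * ω ≡ V a b c * V a b c
      ω²≡V² = trans (sym (cong (λ t → t * t) -V≡ω)) (negative-square (V a b c))
      r≡k : ω * ω ≡ V a b c * V a b c → radicalSize a b ≡ k
      r≡k e with V²-values a b c
      ... | inj₁ V²≡0 = contradiction (square-zero ω (trans e V²≡0)) ω≢0
      ... | inj₂ V²≡qr = ℤ.*-cancelˡ-≡ Q _ _ (trans (sym V²≡qr) (trans (sym e) ω²≡qk))
    ... | no V≢ω | no -V≢ω = trans (ℤ.*-zeroʳ (ω * ω)) (sym (trans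
      ([]-subst (radicalSize a b ℤ.≟ k) V²≡0) (ℤ.*-zeroʳ ([r≡ k ] a b))))
      where
      V²≡0 : radicalSize a b ≡ k → V a b c * V a b c ≡ 0ℤ
      V²≡0 r≡k with V²-values a b c
      ... | inj₁ e = e
      ... | inj₂ V²≡qr with squares-equal (V a b c) ω (trans V²≡qr (trans (cong (Q *_) r≡k) (sym ω²≡qk)))
      ...   | inj₁ V≡ω = contradiction V≡ω V≢ω
      ...   | inj₂ -V≡ω = contradiction -V≡ω -V≢ω

    -- Summing `V≡±ω` over c gives q² for every (a, b) with radical size k, by Parseval; so ω² = qk
    -- times the count is q² times `rankCount k`.
    signedCount-≢0 : k * signedCount ω ≡ Q * rankCount k
    signedCount-≢0 = ℤ.*-cancelˡ-≡ Q _ _ (begin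
      Q * (k * signedCount ω)
        ≡⟨ sym (ℤ.*-assoc Q k (signedCount ω)) ⟩
      Q * k * signedCount ω
        ≡⟨ cong₂ _*_ (sym ω²≡qk) (signedCount-def ω) ⟩
      ω * ω * sum₂ (λ a b → sum (λ c → [ V a b c ℤ.≟ ω ] + [ - V a b c ℤ.≟ ω ]))
        ≡⟨ sym (sum₂-*ˡ (ω * ω) (λ a b → sum (λ c → [ V a b c ℤ.≟ ω ] + [ - V a b c ℤ.≟ ω ]))) ⟩
      sum₂ (λ a b → ω * ω * sum (λ c → [ V a b c ℤ.≟ ω ] + [ - V a b c ℤ.≟ ω ]))
        ≡⟨ sum-cong₂ (λ a b → trans (sym (sum-*ˡ (ω * ω) (λ c → [ V a b c ℤ.≟ ω ] + [ - V a b c ℤ.≟ ω ])))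
             (trans (sum-cong-≗ (V≡±ω a b)) (trans (sum-*ˡ ([r≡ k ] a b) (λ c → V a b c * V a b c))
               (cong ([r≡ k ] a b *_) (sum-V² a b))))) ⟩
      sum₂ (λ a b → [r≡ k ] a b * (Q * Q))
        ≡⟨ sum₂-*ʳ (Q * Q) [r≡ k ] ⟩
      sum₂ [r≡ k ] * (Q * Q)
        ≡⟨ cong (_* (Q * Q)) (sym (rankCount-def k)) ⟩
      rankCount k * (Q * Q)
        ≡⟨ rearrange Q (rankCount k) ⟩
      Q * (Q * rankCount k) ∎)
      where
      rearrange : ∀ q n → n * (q * q) ≡ q * (q * n)
      rearrange = solve-∀

  -- For fixed (a, b), V vanishes at q - q/r values of c, each counted for both signs. The factor 8
  -- turns 2q/r into 16q/r, which is 16q, 4q and q for r = 1, 4, 16, and 16 at the origin, where r =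
  -- q.
  signedCount-0 : + 8 * signedCount 0ℤ ≡ + 16 * (Q * (Q * Q)) - (+ 16 * Q * N₁ + + 4 * Q * N₄ + Q * N₁₆ + + 16)
  signedCount-0 = begin
    + 8 * signedCount 0ℤ
      ≡⟨ cong (+ 8 *_) (signedCount-def 0ℤ) ⟩
    + 8 * sum₂ (λ a b → sum (λ c → [ V a b c ℤ.≟ 0ℤ ] + [ - V a b c ℤ.≟ 0ℤ ]))
      ≡⟨ sym (sum₂-*ˡ (+ 8) (λ a b → sum (λ c → [ V a b c ℤ.≟ 0ℤ ] + [ - V a b c ℤ.≟ 0ℤ ]))) ⟩
    sum₂ (λ a b → + 8 * sum (λ c → [ V a b c ℤ.≟ 0ℤ ] + [ - V a b c ℤ.≟ 0ℤ ]))
      ≡⟨ sum-cong₂ row ⟩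
    sum₂ (λ a b → + 16 * Q - + 16 * nonzeroCount a b)
      ≡⟨ sum₂-+ (λ a b → + 16 * Q) (λ a b → - (+ 16 * nonzeroCount a b)) ⟩
    sum₂ {q} {q} (λ a b → + 16 * Q) + sum₂ (λ a b → - (+ 16 * nonzeroCount a b))
      ≡⟨ cong₂ _+_ (trans (sum-cong-≗ λ _ → sum-const q (+ 16 * Q)) (sum-const q (Q * (+ 16 * Q))))
           (trans (sum-cong-≗ λ a → sum-neg (λ b → + 16 * nonzeroCount a b))
             (trans (sum-neg (λ a → sum (λ b → + 16 * nonzeroCount a b))) (cong (λ t → - t) total))) ⟩
    Q * (Q * (+ 16 * Q)) - (+ 16 * Q * N₁ + + 4 * Q * N₄ + Q * N₁₆ + + 16)
      ≡⟨ cong (λ t → t - (+ 16 * Q * N₁ + + 4 * Q * N₄ + Q * N₁₆ + + 16)) (regroup Q) ⟩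
    + 16 * (Q * (Q * Q)) - (+ 16 * Q * N₁ + + 4 * Q * N₄ + Q * N₁₆ + + 16) ∎
    where
    regroup : ∀ q → q * (q * (+ 16 * q)) ≡ + 16 * (q * (q * q))
    regroup = solve-∀
    point : ∀ v → [ v ℤ.≟ 0ℤ ] + [ - v ℤ.≟ 0ℤ ] ≡ + 2 * (1ℤ - [ ¬? (v ℤ.≟ 0ℤ) ])
    point v = trans (cong (λ t → [ v ℤ.≟ 0ℤ ] + t) ([]-cong (- v ℤ.≟ 0ℤ) (v ℤ.≟ 0ℤ)
        (λ e → trans (sym (ℤ.neg-involutive v)) (cong (λ t → - t) e)) (cong (λ t → - t))))
      (trans (double [ v ℤ.≟ 0ℤ ]) (cong (λ t → + 2 * (1ℤ - t)) (sym ([]-¬ (v ℤ.≟ 0ℤ)))))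
      where
      double : ∀ i → i + i ≡ + 2 * (1ℤ - (1ℤ - i))
      double = solve-∀
    row : ∀ a b → + 8 * sum (λ c → [ V a b c ℤ.≟ 0ℤ ] + [ - V a b c ℤ.≟ 0ℤ ]) ≡ + 16 * Q - + 16 * nonzeroCount a b
    row a b = trans (cong (+ 8 *_) (trans (sum-cong-≗ λ c → point (V a b c))
        (trans (sum-*ˡ (+ 2) (λ c → 1ℤ - [ ¬? (V a b c ℤ.≟ 0ℤ) ]))
          (cong (+ 2 *_) (trans (sum-- (λ _ → 1ℤ) (λ c → [ ¬? (V a b c ℤ.≟ 0ℤ) ]))
            (cong (λ t → t - nonzeroCount a b) (sum-const q 1ℤ)))))))
      (arith Q (nonzeroCount a b))
      where
      arith : ∀ q n → + 8 * (+ 2 * (q * 1ℤ - n)) ≡ + 16 * q - + 16 * n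
      arith = solve-∀
    module _ (a b : K) where
      solved : ∀ {r v} (t : ℤ) .{{_ : ℤ.NonZero t}} → + 16 * Q ≡ t * v → radicalSize a b ≡ r → t ≡ r → + 16 * nonzeroCount a b ≡ v
      solved {r} {v} t e r≡ refl = ℤ.*-cancelˡ-≡ t _ _ (begin
        t * (+ 16 * nonzeroCount a b)                 ≡⟨ swap t (nonzeroCount a b) ⟩
        + 16 * (t * nonzeroCount a b)                 ≡⟨ cong (λ t → + 16 * (t * nonzeroCount a b)) (sym r≡) ⟩
        + 16 * (radicalSize a b * nonzeroCount a b)   ≡⟨ cong (+ 16 *_) (radicalSize*nonzeroCount a b) ⟩
        + 16 * Q                                      ≡⟨ e ⟩
        t * v                                         ∎)
        where
        swap : ∀ t n → t * (+ 16 * n) ≡ + 16 * (t * n)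
        swap = solve-∀
    total : sum₂ (λ a b → + 16 * nonzeroCount a b) ≡ + 16 * Q * N₁ + + 4 * Q * N₄ + Q * N₁₆ + + 16
    total = sum₂-decompose (λ a b → + 16 * nonzeroCount a b)
      (λ a b r≡ → solved a b (+ 1) (by₁ Q) r≡ refl)
      (λ a b r≡ → solved a b (+ 4) (by₄ Q) r≡ refl)
      (λ a b r≡ → solved a b {v = Q} (+ 16) refl r≡ refl)
      (λ a b r≡ → solved a b Q (ℤ.*-comm (+ 16) Q) r≡ refl)
      where
      by₁ : ∀ q → + 16 * q ≡ + 1 * (+ 16 * q)
      by₁ = solve-∀
      by₄ : ∀ q → + 16 * q ≡ + 4 * (+ 4 * q)
      by₄ = solve-∀

-- Affine invariance, double counting, and words determined by their signs

sum± : (ℤ → ℤ) → ℤ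
sum± f = f 1ℤ + f -1ℤ

module Designs {q : ℕ} (𝔽 : FieldStructure q) (s : ℕ) (q≡ : q ≡ 2 ℕ.^ (2 ℕ.* s)) (17≤q : 17 ℕ.≤ q) where
  open WeightCounts 𝔽 s q≡ 17≤q public

  -- A codeword with entries in 𝔽₂ is represented by its signs, so that the support is the preimage of -1.
  isNegative : ℤ → ℤ
  isNegative i = [ i ℤ.≟ -1ℤ ]

  negatives : (K → ℤ) → ℤ
  negatives e = sum (λ x → isNegative (e x))

  signs : K → K → K → ℤ → K → ℤ
  signs a b c h x = h * χ (form a b c x)

  incidence : ℤ → (K → ℤ) → K → K → ℤ
  incidence i e x y = [ negatives e ℤ.≟ i ] * (isNegative (e x) * isNegative (e y))

  sumCode : (K → K → K → ℤ → ℤ) → ℤ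
  sumCode F = sum₂ (λ a b → sum (λ c → sum± (F a b c)))

  sumCode-cong : ∀ {F G} → (∀ a b c h → F a b c h ≡ G a b c h) → sumCode F ≡ sumCode G
  sumCode-cong e = sum-cong₂ λ a b → sum-cong-≗ λ c → cong₂ _+_ (e a b c 1ℤ) (e a b c -1ℤ)

  pairCount : ℤ → K → K → ℤ
  pairCount i x y = sumCode (λ a b c h → incidence i (signs a b c h) x y)

  incidence-cong : ∀ i {e f : K → ℤ} → (∀ x → e x ≡ f x) → ∀ x y → incidence i e x y ≡ incidence i f x y
  incidence-cong i e≗f x y = cong₂ _*_
    (cong (λ n → [ n ℤ.≟ i ]) (sum-cong-≗ λ x → cong isNegative (e≗f x)))
    (cong₂ (λ s t → isNegative s * isNegative t) (e≗f x) (e≗f y))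

  -- The argument is the fourth power of t times the fourth root of l, and `χ` is invariant under
  -- squaring. This makes the polar term linear in t.
  χ-linear : ∀ l t → χ (sq (sq t) ⊗ l) ≡ χ ((√ √ l) ⊗ t)
  χ-linear l t = begin
    χ (sq (sq t) ⊗ l)                    ≡⟨ cong (λ l → χ (sq (sq t) ⊗ l)) (sym (trans (cong sq (√-sq (√ l))) (√-sq l))) ⟩
    χ (sq (sq t) ⊗ sq (sq (√ √ l)))
      ≡⟨ cong χ (solve 2 (λ t r → let sq = λ x → x :* x in sq (sq t) :* sq (sq r) := sq (sq (r :* t))) refl t (√ √ l)) ⟩
    χ (sq (sq ((√ √ l) ⊗ t)))            ≡⟨ trans (χ-sq (sq ((√ √ l) ⊗ t))) (χ-sq ((√ √ l) ⊗ t)) ⟩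
    χ ((√ √ l) ⊗ t)                      ∎

  -- The polar term is absorbed into c, the constant `form a b c x` into the sign h, and the scaling
  -- u into all three coefficients.
  signs-affine : ∀ u x a b c h t → signs a b c h (u ⊗ t ⊕ x) ≡
    signs (u ^ 5 ⊗ a) (u ^ 3 ⊗ b) (u ⊗ (c ⊕ (√ √ L a b x))) (h * χ (form a b c x)) t
  signs-affine u x a b c h t = begin
    h * χ (form a b c (u ⊗ t ⊕ x))
      ≡⟨ cong (λ y → h * χ y) (form-polar a b c (u ⊗ t) x) ⟩
    h * χ (form a b c (u ⊗ t) ⊕ form a b c x ⊕ (a ⊗ β (u ⊗ t) x ⊕ b ⊗ γ (u ⊗ t) x))
      ≡⟨ cong (h *_) (trans (χ-⊕ (form a b c (u ⊗ t) ⊕ form a b c x) (a ⊗ β (u ⊗ t) x ⊕ b ⊗ γ (u ⊗ t) x))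
           (cong₂ _*_ (χ-⊕ (form a b c (u ⊗ t)) (form a b c x)) (trans (χ-bilinear a b (u ⊗ t) x) (χ-linear (L a b x) (u ⊗ t))))) ⟩
    h * (χ (form a b c (u ⊗ t)) * χ (form a b c x) * χ ((√ √ L a b x) ⊗ (u ⊗ t)))
      ≡⟨ rearrange h (χ (form a b c (u ⊗ t))) (χ (form a b c x)) (χ ((√ √ L a b x) ⊗ (u ⊗ t))) ⟩
    h * χ (form a b c x) * (χ (form a b c (u ⊗ t)) * χ ((√ √ L a b x) ⊗ (u ⊗ t)))
      ≡⟨ cong (h * χ (form a b c x) *_) (trans (sym (χ-⊕ (form a b c (u ⊗ t)) ((√ √ L a b x) ⊗ (u ⊗ t))))
           (cong χ (collect u a b c (√ √ L a b x) t))) ⟩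
    h * χ (form a b c x) * χ (form (u ^ 5 ⊗ a) (u ^ 3 ⊗ b) (u ⊗ (c ⊕ (√ √ L a b x))) t) ∎
    where
    rearrange : ∀ h i j k → h * (i * j * k) ≡ h * j * (i * k)
    rearrange = solve-∀
    collect : ∀ u a b c d t → form a b c (u ⊗ t) ⊕ d ⊗ (u ⊗ t) ≡ form (u ^ 5 ⊗ a) (u ^ 3 ⊗ b) (u ⊗ (c ⊕ d)) t
    collect = solve 6 (λ u a b c d t →
      let f = λ a b c x → a :* x :^ 5 :+ b :* x :^ 3 :+ c :* x
      in f a b c (u :* t) :+ d :* (u :* t) := f (u :^ 5 :* a) (u :^ 3 :* b) (u :* (c :+ d)) t) refl

  sum±-flip : ∀ (g : ℤ → ℤ) {ε} → ε ≡ 1ℤ ⊎ ε ≡ -1ℤ → sum± (λ h → g (h * ε)) ≡ sum± g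
  sum±-flip g (inj₁ refl) = refl
  sum±-flip g (inj₂ refl) = ℤ.+-comm (g -1ℤ) (g 1ℤ)

  ^-≢0 : ∀ {u} n → u ≢ 𝟘 → u ^ n ≢ 𝟘
  ^-≢0 zero u≢0 = 𝟙≢𝟘
  ^-≢0 (suc n) u≢0 = ⊗-≢0 u≢0 (^-≢0 n u≢0)

  -- The change of parameters is triangular: the sign flip depends on a, b, c and the shift of c on
  -- a, b only. It can thus be undone from the innermost sum outwards.
  sumCode-affine : ∀ {u} → u ≢ 𝟘 → ∀ x (F : K → K → K → ℤ → ℤ) →
    sumCode (λ a b c h → F (u ^ 5 ⊗ a) (u ^ 3 ⊗ b) (u ⊗ (c ⊕ (√ √ L a b x))) (h * χ (form a b c x))) ≡ sumCode F
  sumCode-affine {u} u≢0 x F = begin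
    sumCode (λ a b c h → F (u ^ 5 ⊗ a) (u ^ 3 ⊗ b) (u ⊗ (c ⊕ (√ √ L a b x))) (h * χ (form a b c x)))
      ≡⟨ sum-cong₂ (λ a b → sum-cong-≗ λ c →
           sum±-flip (F (u ^ 5 ⊗ a) (u ^ 3 ⊗ b) (u ⊗ (c ⊕ (√ √ L a b x)))) (χ-±1 (form a b c x))) ⟩
    sum₂ (λ a b → sum (λ c → sum± (F (u ^ 5 ⊗ a) (u ^ 3 ⊗ b) (u ⊗ (c ⊕ (√ √ L a b x))))))
      ≡⟨ sum-cong₂ (λ a b → trans
           (sum-shift (√ √ L a b x) (λ c → sum± (F (u ^ 5 ⊗ a) (u ^ 3 ⊗ b) (u ⊗ c))))
           (sum-scale u≢0 (λ c → sum± (F (u ^ 5 ⊗ a) (u ^ 3 ⊗ b) c)))) ⟩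
    sum₂ (λ a b → sum (λ c → sum± (F (u ^ 5 ⊗ a) (u ^ 3 ⊗ b) c)))
      ≡⟨ sum-cong-≗ (λ a → sum-scale (^-≢0 3 u≢0) (λ b → sum (λ c → sum± (F (u ^ 5 ⊗ a) b c)))) ⟩
    sum₂ (λ a b → sum (λ c → sum± (F (u ^ 5 ⊗ a) b c)))
      ≡⟨ sum-scale (^-≢0 5 u≢0) (λ a → sum (λ b → sum (λ c → sum± (F a b c)))) ⟩
    sumCode F ∎

  negatives-affine : ∀ {u} → u ≢ 𝟘 → ∀ x e → negatives (λ t → e (u ⊗ t ⊕ x)) ≡ negatives e
  negatives-affine {u} u≢0 x e = trans
    (sum-scale u≢0 (λ t → isNegative (e (t ⊕ x)))) (sum-shift x (λ t → isNegative (e t)))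

  -- The affine maps are doubly transitive and preserve the code.
  pairCount-const : ∀ i {x y} → x ≢ y → pairCount i x y ≡ pairCount i 𝟘 𝟙
  pairCount-const i {x} {y} x≢y = begin
    pairCount i x y
      ≡⟨ sumCode-cong (λ a b c h → pull (signs a b c h)) ⟩
    sumCode (λ a b c h → incidence i (λ t → signs a b c h (u ⊗ t ⊕ x)) 𝟘 𝟙)
      ≡⟨ sumCode-cong (λ a b c h → incidence-cong i (signs-affine u x a b c h) 𝟘 𝟙) ⟩
    sumCode (λ a b c h → incidence i
      (signs (u ^ 5 ⊗ a) (u ^ 3 ⊗ b) (u ⊗ (c ⊕ (√ √ L a b x))) (h * χ (form a b c x))) 𝟘 𝟙)
      ≡⟨ sumCode-affine u≢0 x (λ a b c h → incidence i (signs a b c h) 𝟘 𝟙) ⟩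
    pairCount i 𝟘 𝟙 ∎
    where
    -- The map t ↦ (y + x) t + x takes 0 to x and 1 to y.
    u = y ⊕ x
    u≢0 : u ≢ 𝟘
    u≢0 e = x≢y (sym (⊕-≡𝟘 y x e))
    pull : ∀ e → incidence i e x y ≡ incidence i (λ t → e (u ⊗ t ⊕ x)) 𝟘 𝟙
    pull e = cong₂ _*_ (cong (λ n → [ n ℤ.≟ i ]) (sym (negatives-affine u≢0 x e)))
      (cong₂ (λ s t → isNegative (e s) * isNegative (e t))
        (solve 2 (λ x y → x := (y :+ x) :* con false :+ x) refl x y)
        (solve 2 (λ x y → y := (y :+ x) :* con true :+ x) refl x y))

  codewordCount : ℤ → ℤ
  codewordCount i = sumCode (λ a b c h → [ negatives (signs a b c h) ℤ.≟ i ])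

  2*isNegative : ∀ {e} → e ≡ 1ℤ ⊎ e ≡ -1ℤ → + 2 * isNegative e ≡ 1ℤ - e
  2*isNegative (inj₁ refl) = refl
  2*isNegative (inj₂ refl) = refl

  signs-±1 : ∀ a b c {h} → h ≡ 1ℤ ⊎ h ≡ -1ℤ → ∀ x → signs a b c h x ≡ 1ℤ ⊎ signs a b c h x ≡ -1ℤ
  signs-±1 a b c {h} h± x with χ (form a b c x) | χ-±1 (form a b c x)
  signs-±1 a b c (inj₁ refl) x | _ | inj₁ refl = inj₁ refl
  signs-±1 a b c (inj₁ refl) x | _ | inj₂ refl = inj₂ refl
  signs-±1 a b c (inj₂ refl) x | _ | inj₁ refl = inj₂ refl
  signs-±1 a b c (inj₂ refl) x | _ | inj₂ refl = inj₁ refl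

  -- For e = ±1 the indicator of e = -1 is (1 - e)/2; the doubled form keeps everything integral.
  2*negatives : ∀ a b c {h} → h ≡ 1ℤ ⊎ h ≡ -1ℤ → + 2 * negatives (signs a b c h) ≡ + q - h * V a b c
  2*negatives a b c {h} h± = begin
    + 2 * negatives (signs a b c h)
      ≡⟨ sym (sum-*ˡ (+ 2) (λ x → isNegative (signs a b c h x))) ⟩
    sum (λ x → + 2 * isNegative (signs a b c h x))
      ≡⟨ sum-cong-≗ (λ x → 2*isNegative (signs-±1 a b c h± x)) ⟩
    sum (λ x → 1ℤ - h * χ (form a b c x))
      ≡⟨ sum-- (λ _ → 1ℤ) (λ x → h * χ (form a b c x)) ⟩
    sum {q} (λ _ → 1ℤ) - sum (λ x → h * χ (form a b c x))
      ≡⟨ cong₂ _-_ (trans (sum-const q 1ℤ) (ℤ.*-identityʳ (+ q))) (sum-*ˡ h (λ x → χ (form a b c x))) ⟩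
    + q - h * V a b c ∎

  [negatives] : ∀ a b c {h} → h ≡ 1ℤ ⊎ h ≡ -1ℤ → ∀ i →
    [ negatives (signs a b c h) ℤ.≟ i ] ≡ [ h * V a b c ℤ.≟ + q - + 2 * i ]
  [negatives] a b c {h} h± i = []-cong (negatives (signs a b c h) ℤ.≟ i) (h * V a b c ℤ.≟ + q - + 2 * i) to from
    where
    complement : ∀ q n → q - (q - n) ≡ n
    complement = solve-∀
    to : negatives (signs a b c h) ≡ i → h * V a b c ≡ + q - + 2 * i
    to refl = sym (trans (cong (λ t → + q - t) (2*negatives a b c h±)) (complement (+ q) (h * V a b c)))
    from : h * V a b c ≡ + q - + 2 * i → negatives (signs a b c h) ≡ i
    from e = ℤ.*-cancelˡ-≡ (+ 2) _ _ (trans (2*negatives a b c h±)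
      (trans (cong (λ t → + q - t) e) (complement (+ q) (+ 2 * i))))

  codewordCount≡signedCount : ∀ i → codewordCount i ≡ signedCount (+ q - + 2 * i)
  codewordCount≡signedCount i = trans (sum-cong₂ λ a b → sum-cong-≗ λ c → cong₂ _+_
      (trans ([negatives] a b c (inj₁ refl) i) (cong (λ v → [ v ℤ.≟ + q - + 2 * i ]) (ℤ.*-identityˡ (V a b c))))
      (trans ([negatives] a b c (inj₂ refl) i) (cong (λ v → [ v ℤ.≟ + q - + 2 * i ]) (ℤ.-1*i≡-i (V a b c)))))
    (sym (signedCount-def (+ q - + 2 * i)))

  distinct : K → K → ℤ
  distinct x y = 1ℤ - [ y ≟ x ]

  sumCode-sum₂ : (F : K → K → K → ℤ → K → K → ℤ) →
    sum₂ (λ x y → sumCode (λ a b c h → F a b c h x y)) ≡ sumCode (λ a b c h → sum₂ (F a b c h))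
  sumCode-sum₂ F = begin
    sum₂ (λ x y → sum₂ (λ a b → sum (λ c → sum± (λ h → F a b c h x y))))
      ≡⟨ sum₂-comm (λ x y a b → sum (λ c → sum± (λ h → F a b c h x y))) ⟩
    sum₂ (λ a b → sum₂ (λ x y → sum (λ c → sum± (λ h → F a b c h x y))))
      ≡⟨ sum-cong₂ (λ a b → trans (sum-cong-≗ λ x → ∑-comm (λ y c → sum± (λ h → F a b c h x y)))
           (∑-comm (λ x c → sum (λ y → sum± (λ h → F a b c h x y))))) ⟩
    sum₂ (λ a b → sum (λ c → sum₂ (λ x y → sum± (λ h → F a b c h x y))))
      ≡⟨ sum-cong₂ (λ a b → sum-cong-≗ λ c → sum₂-+ (F a b c 1ℤ) (F a b c -1ℤ)) ⟩
    sumCode (λ a b c h → sum₂ (F a b c h)) ∎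

  sumCode-*ʳ : ∀ c F → sumCode (λ a b c′ h → F a b c′ h * c) ≡ sumCode F * c
  sumCode-*ʳ k F = trans (sum-cong₂ λ a b → trans (sum-cong-≗ λ c → sym (ℤ.*-distribʳ-+ k (F a b c 1ℤ) (F a b c -1ℤ)))
      (sum-*ʳ k (λ c → sum± (F a b c))))
    (sum₂-*ʳ k (λ a b → sum (λ c → sum± (F a b c))))

  distinct-count : sum₂ distinct ≡ + q * (+ q - 1ℤ)
  distinct-count = trans (sum-cong-≗ λ x → trans (sum-- (λ _ → 1ℤ) (λ y → [ y ≟ x ]))
      (cong₂ _-_ (trans (sum-const q 1ℤ) (ℤ.*-identityʳ (+ q))) (sum-pick₁ x)))
    (sum-const q (+ q - 1ℤ))

  -- Counts ordered pairs of distinct points inside supports of size i: there are i² - i for each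
  -- codeword, and equally many codewords for each of the q(q - 1) pairs.
  double-count : ∀ i → pairCount i 𝟘 𝟙 * (+ q * (+ q - 1ℤ)) ≡ codewordCount i * (i * i - i)
  double-count i = begin
    pairCount i 𝟘 𝟙 * (+ q * (+ q - 1ℤ))
      ≡⟨ cong (pairCount i 𝟘 𝟙 *_) (sym distinct-count) ⟩
    pairCount i 𝟘 𝟙 * sum₂ distinct
      ≡⟨ sym (sum₂-*ˡ (pairCount i 𝟘 𝟙) distinct) ⟩
    sum₂ (λ x y → pairCount i 𝟘 𝟙 * distinct x y)
      ≡⟨ sum-cong₂ (λ x y → sym (off-diagonal x y)) ⟩
    sum₂ (λ x y → pairCount i x y * distinct x y)
      ≡⟨ sum-cong₂ (λ x y → sym (sumCode-*ʳ (distinct x y) (λ a b c h → incidence i (signs a b c h) x y))) ⟩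
    sum₂ (λ x y → sumCode (λ a b c h → incidence i (signs a b c h) x y * distinct x y))
      ≡⟨ sumCode-sum₂ (λ a b c h x y → incidence i (signs a b c h) x y * distinct x y) ⟩
    sumCode (λ a b c h → sum₂ (λ x y → incidence i (signs a b c h) x y * distinct x y))
      ≡⟨ sumCode-cong (λ a b c h → block (signs a b c h)) ⟩
    sumCode (λ a b c h → [ negatives (signs a b c h) ℤ.≟ i ] * (i * i - i))
      ≡⟨ sumCode-*ʳ (i * i - i) (λ a b c h → [ negatives (signs a b c h) ℤ.≟ i ]) ⟩
    codewordCount i * (i * i - i) ∎
    where
    off-diagonal : ∀ x y → pairCount i x y * distinct x y ≡ pairCount i 𝟘 𝟙 * distinct x y
    off-diagonal x y with y ≟ x
    ... | yes _ = trans (ℤ.*-zeroʳ (pairCount i x y)) (sym (ℤ.*-zeroʳ (pairCount i 𝟘 𝟙)))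
    ... | no y≢x = cong (_* (1ℤ - 0ℤ)) (pairCount-const i λ x≡y → y≢x (sym x≡y))
    block : ∀ e → sum₂ (λ x y → incidence i e x y * distinct x y) ≡ [ negatives e ℤ.≟ i ] * (i * i - i)
    block e = begin
      sum₂ (λ x y → incidence i e x y * distinct x y)
        ≡⟨ sum-cong₂ (λ x y → expand [ negatives e ℤ.≟ i ] (n x) (n y) [ y ≟ x ]) ⟩
      sum₂ (λ x y → [ negatives e ℤ.≟ i ] * (n x * (n y - [ y ≟ x ] * n y)))
        ≡⟨ sum₂-*ˡ [ negatives e ℤ.≟ i ] (λ x y → n x * (n y - [ y ≟ x ] * n y)) ⟩
      [ negatives e ℤ.≟ i ] * sum₂ (λ x y → n x * (n y - [ y ≟ x ] * n y))
        ≡⟨ cong ([ negatives e ℤ.≟ i ] *_) (sum-cong-≗ row) ⟩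
      [ negatives e ℤ.≟ i ] * sum (λ x → n x * negatives e - n x)
        ≡⟨ cong ([ negatives e ℤ.≟ i ] *_) (trans (sum-- (λ x → n x * negatives e) n)
             (cong (λ t → t - negatives e) (sum-*ʳ (negatives e) n))) ⟩
      [ negatives e ℤ.≟ i ] * (negatives e * negatives e - negatives e)
        ≡⟨ []-subst (negatives e ℤ.≟ i) (cong (λ j → j * j - j)) ⟩
      [ negatives e ℤ.≟ i ] * (i * i - i) ∎
      where
      n : K → ℤ
      n x = isNegative (e x)
      expand : ∀ w i j d → w * (i * j) * (1ℤ - d) ≡ w * (i * (j - d * j))
      expand = solve-∀
      distribute : ∀ i w → i * (w - i) ≡ i * w - i * i
      distribute = solve-∀
      row : ∀ x → sum (λ y → n x * (n y - [ y ≟ x ] * n y)) ≡ n x * negatives e - n x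
      row x = begin
        sum (λ y → n x * (n y - [ y ≟ x ] * n y))     ≡⟨ sum-*ˡ (n x) (λ y → n y - [ y ≟ x ] * n y) ⟩
        n x * sum (λ y → n y - [ y ≟ x ] * n y)       ≡⟨ cong (n x *_) (trans (sum-- n (λ y → [ y ≟ x ] * n y))
                                                          (cong (λ t → negatives e - t) (sum-pick n x))) ⟩
        n x * (negatives e - n x)                     ≡⟨ distribute (n x) (negatives e) ⟩
        n x * negatives e - n x * n x                 ≡⟨ cong (λ t → n x * negatives e - t) ([]-idem (e x ℤ.≟ -1ℤ)) ⟩
        n x * negatives e - n x                       ∎

  -- The hypothesis forces a radical of size q, which exceeds 16, so a = b = 0. The form is then
  -- linear, and V vanishes unless c = 0.
  V-extremal : ∀ a b c → V a b c * V a b c ≡ + q * + q → a ≡ 𝟘 × b ≡ 𝟘 × c ≡ 𝟘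
  V-extremal a b c e with V²-values a b c
  ... | inj₁ V²≡0 = contradiction (ℤ.+-injective (square-zero (+ q) (trans (sym e) V²≡0))) q≢0
  ... | inj₂ V²≡qr with radicalSize-values a b | ℤ.*-cancelˡ-≡ (+ q) (+ q) (radicalSize a b) (trans (sym e) V²≡qr)
  ...   | inj₂ (inj₁ r≡) | q≡r = contradiction (trans q≡r r≡) (q≢ 1 (ℕ.m≤m+n 1 15))
  ...   | inj₂ (inj₂ (inj₁ r≡)) | q≡r = contradiction (trans q≡r r≡) (q≢ 4 (ℕ.m≤m+n 4 12))
  ...   | inj₂ (inj₂ (inj₂ r≡)) | q≡r = contradiction (trans q≡r r≡) (q≢ 16 ℕ.≤-refl)
  ...   | inj₁ (refl , refl) | q≡r with c ≟ 𝟘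
  ...     | yes c≡0 = refl , refl , c≡0
  ...     | no c≢0 = contradiction (trans (sym e) (cong (λ v → v * v) (begin
    V 𝟘 𝟘 c                ≡⟨ sum-cong-≗ (λ x → cong χ (linear c x)) ⟩
    sum (λ x → χ (c ⊗ x))  ≡⟨ sum-χ c ⟩
    + q * [ c ≟ 𝟘 ]        ≡⟨ cong (+ q *_) ([]-no (c ≟ 𝟘) c≢0) ⟩
    + q * 0ℤ               ≡⟨ ℤ.*-zeroʳ (+ q) ⟩
    0ℤ                     ∎))) (λ e → q≢0 (ℤ.+-injective (square-zero (+ q) e)))
    where
    linear : ∀ c x → form 𝟘 𝟘 c x ≡ c ⊗ x
    linear = solve 2 (λ c x → con false :* x :^ 5 :+ con false :* x :^ 3 :+ c :* x := c :* x) refl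

  -- The product of the two sign functions belongs to the sum of the coefficients, on which
  -- `χ ∘ form` is constantly h h′. So its V is ±q and `V-extremal` applies; the value at 0 compares
  -- h with h′.
  signs-injective : ∀ {a b c h a′ b′ c′ h′} → h ≡ 1ℤ ⊎ h ≡ -1ℤ → h′ ≡ 1ℤ ⊎ h′ ≡ -1ℤ →
    (∀ x → signs a b c h x ≡ signs a′ b′ c′ h′ x) → a ≡ a′ × b ≡ b′ × c ≡ c′ × h ≡ h′
  signs-injective {a} {b} {c} {h} {a′} {b′} {c′} {h′} h± h′± e =
    let a≡ , b≡ , c≡ = V-extremal (a ⊕ a′) (b ⊕ b′) (c ⊕ c′) V²≡q²
    in ⊕-≡𝟘 a a′ a≡ , ⊕-≡𝟘 b b′ b≡ , ⊕-≡𝟘 c c′ c≡ , h≡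
    where
    regroup : ∀ q h h′ → q * (h * h′) * (q * (h * h′)) ≡ q * q * ((h * h) * (h′ * h′))
    regroup = solve-∀
    unit : ∀ {h} → h ≡ 1ℤ ⊎ h ≡ -1ℤ → h * h ≡ 1ℤ
    unit (inj₁ refl) = refl
    unit (inj₂ refl) = refl
    product : ∀ x → χ (form (a ⊕ a′) (b ⊕ b′) (c ⊕ c′) x) ≡ h * h′
    product x = begin
      χ (form (a ⊕ a′) (b ⊕ b′) (c ⊕ c′) x)
        ≡⟨ cong χ (solve 7 (λ a b c a′ b′ c′ x →
             let f = λ a b c x → a :* x :^ 5 :+ b :* x :^ 3 :+ c :* x
             in f (a :+ a′) (b :+ b′) (c :+ c′) x := f a b c x :+ f a′ b′ c′ x) refl a b c a′ b′ c′ x) ⟩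
      χ (form a b c x ⊕ form a′ b′ c′ x)
        ≡⟨ χ-⊕ (form a b c x) (form a′ b′ c′ x) ⟩
      χ (form a b c x) * χ (form a′ b′ c′ x)
        ≡⟨ sym (trans (cong (λ t → t * (χ (form a b c x) * χ (form a′ b′ c′ x))) (unit h±)) (ℤ.*-identityˡ _)) ⟩
      h * h * (χ (form a b c x) * χ (form a′ b′ c′ x))
        ≡⟨ move h (χ (form a b c x)) (χ (form a′ b′ c′ x)) ⟩
      h * (h * χ (form a b c x)) * χ (form a′ b′ c′ x)
        ≡⟨ cong (λ t → h * t * χ (form a′ b′ c′ x)) (e x) ⟩
      h * (h′ * χ (form a′ b′ c′ x)) * χ (form a′ b′ c′ x)
        ≡⟨ move′ h h′ (χ (form a′ b′ c′ x)) ⟩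
      h * h′ * (χ (form a′ b′ c′ x) * χ (form a′ b′ c′ x))
        ≡⟨ trans (cong (h * h′ *_) (χ-*-idem (form a′ b′ c′ x))) (ℤ.*-identityʳ (h * h′)) ⟩
      h * h′ ∎
      where
      move : ∀ h i j → h * h * (i * j) ≡ h * (h * i) * j
      move = solve-∀
      move′ : ∀ h h′ j → h * (h′ * j) * j ≡ h * h′ * (j * j)
      move′ = solve-∀
    V≡ : V (a ⊕ a′) (b ⊕ b′) (c ⊕ c′) ≡ + q * (h * h′)
    V≡ = trans (sum-cong-≗ product) (sum-const q (h * h′))
    V²≡q² : V (a ⊕ a′) (b ⊕ b′) (c ⊕ c′) * V (a ⊕ a′) (b ⊕ b′) (c ⊕ c′) ≡ + q * + q
    V²≡q² = begin
      V (a ⊕ a′) (b ⊕ b′) (c ⊕ c′) * V (a ⊕ a′) (b ⊕ b′) (c ⊕ c′)   ≡⟨ cong (λ v → v * v) V≡ ⟩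
      + q * (h * h′) * (+ q * (h * h′))                             ≡⟨ regroup (+ q) h h′ ⟩
      + q * + q * ((h * h) * (h′ * h′))                             ≡⟨ cong₂ (λ i j → + q * + q * (i * j)) (unit h±) (unit h′±) ⟩
      + q * + q * 1ℤ                                                ≡⟨ ℤ.*-identityʳ (+ q * + q) ⟩
      + q * + q                                                     ∎
    at-𝟘 : ∀ h a b c → signs a b c h 𝟘 ≡ h
    at-𝟘 h a b c = trans (cong (λ t → h * t) (trans (cong χ (form-𝟘 a b c)) χ-𝟘)) (ℤ.*-identityʳ h)
      where
      form-𝟘 : ∀ a b c → form a b c 𝟘 ≡ 𝟘
      form-𝟘 = solve 3 (λ a b c → a :* con false :^ 5 :+ b :* con false :^ 3 :+ c :* con false := con false) refl
    h≡ : h ≡ h′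
    h≡ = trans (sym (at-𝟘 h a b c)) (trans (e 𝟘) (at-𝟘 h′ a′ b′ c′))

  -- Weight 1 means hV = q - 2, so (q - 2)² is 0 or qr. The latter gives 4 = (r - q + 4) q, so q
  -- would divide 4. This rules out blocks too small for a 2-design.
  negatives≢1 : ∀ a b c {h} → h ≡ 1ℤ ⊎ h ≡ -1ℤ → negatives (signs a b c h) ≢ 1ℤ
  negatives≢1 a b c {h} h± e = small (V²-values a b c)
    where
    hV≡ : h * V a b c ≡ + q - + 2
    hV≡ = trans (complement (+ q) (h * V a b c)) (cong (λ t → + q - t) (trans (sym (2*negatives a b c h±)) (cong (+ 2 *_) e)))
      where
      complement : ∀ q v → v ≡ q - (q - v)
      complement = solve-∀
    V²≡ʷ : V a b c * V a b c ≡ (+ q - + 2) * (+ q - + 2)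
    V²≡ʷ = trans (units h±) (cong (λ v → v * v) hV≡)
      where
      units : ∀ {h} → h ≡ 1ℤ ⊎ h ≡ -1ℤ → V a b c * V a b c ≡ h * V a b c * (h * V a b c)
      units (inj₁ refl) = cong (λ v → v * v) (sym (ℤ.*-identityˡ (V a b c)))
      units (inj₂ refl) = signs² (V a b c)
        where
        signs² : ∀ v → v * v ≡ -1ℤ * v * (-1ℤ * v)
        signs² = solve-∀
    small : V a b c * V a b c ≡ 0ℤ ⊎ V a b c * V a b c ≡ + q * radicalSize a b → ⊥
    small (inj₁ V²≡0) = q≢ 2 (ℕ.m≤m+n 2 14) (ℤ.i-j≡0⇒i≡j (+ q) (+ 2) (square-zero (+ q - + 2) (trans (sym V²≡ʷ) V²≡0)))
    small (inj₂ V²≡qr) = ℕ.<⇒≱ 17≤q (ℕ.≤-trans (∣⇒≤ (divides ℤ.∣ radicalSize a b - + q + + 4 ∣ 4≡)) (ℕ.m≤m+n 4 12))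
      where
      isolate : ∀ q r → (q - + 2) * (q - + 2) ≡ q * r → + 4 ≡ (r - q + + 4) * q
      isolate q r e = trans (expand q) (trans (cong (λ t → t - q * q + + 4 * q) e) (factor q r))
        where
        expand : ∀ q → + 4 ≡ (q - + 2) * (q - + 2) - q * q + + 4 * q
        expand = solve-∀
        factor : ∀ q r → q * r - q * q + + 4 * q ≡ (r - q + + 4) * q
        factor = solve-∀
      4≡ : 4 ≡ ℤ.∣ radicalSize a b - + q + + 4 ∣ ℕ.* q
      4≡ = trans (cong ℤ.∣_∣ (isolate (+ q) (radicalSize a b) (trans (sym V²≡ʷ) V²≡qr)))
        (ℤ.abs-* (radicalSize a b - + q + + 4) (+ q))

-- Subsets of `Fin n`, and designs up to equivalent block sets

∣tabulate∣ : ∀ {n} (f : Fin n → Bool) → + ∣ Vec.tabulate f ∣ ≡ sum (λ x → if f x then 1ℤ else 0ℤ)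
∣tabulate∣ {zero} f = sym (sum-empty (λ x → if f x then 1ℤ else 0ℤ))
∣tabulate∣ {suc n} f = trans step (sym (sum-suc (λ x → if f x then 1ℤ else 0ℤ)))
  where
  step : + ∣ Vec.tabulate f ∣ ≡ (if f zero then 1ℤ else 0ℤ) + sum (λ x → if f (suc x) then 1ℤ else 0ℤ)
  step with f zero
  ... | true = cong (λ t → 1ℤ + t) (∣tabulate∣ (f ∘ suc))
  ... | false = trans (∣tabulate∣ (f ∘ suc)) (sym (ℤ.+-identityˡ _))

∈-tabulate⁻ : ∀ {n} (f : Fin n → Bool) {x} → x ∈ Vec.tabulate f → f x ≡ true
∈-tabulate⁻ f {x} x∈ = trans (sym (lookup∘tabulate f x)) ([]=⇒lookup x∈)

∈-tabulate⁺ : ∀ {n} (f : Fin n → Bool) {x} → f x ≡ true → x ∈ Vec.tabulate f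
∈-tabulate⁺ f {x} fx = lookup⇒[]= x (Vec.tabulate f) (trans (lookup∘tabulate f x) fx)

∣p∣≡0⇒∉ : ∀ {n} (p : Subset n) → ∣ p ∣ ≡ 0 → ∀ {x} → ¬ (x ∈ p)
∣p∣≡0⇒∉ (outside ∷ p) e (there x∈p) = ∣p∣≡0⇒∉ p e x∈p

∣p∣≡1⇒singleton : ∀ {n} (p : Subset n) → ∣ p ∣ ≡ 1 → ∃[ x ] x ∈ p × (∀ {z} → z ∈ p → z ≡ x)
∣p∣≡1⇒singleton (inside ∷ p) e = zero , here , λ
  { here → refl ; (there z∈p) → contradiction z∈p (∣p∣≡0⇒∉ p (ℕ.suc-injective e)) }
∣p∣≡1⇒singleton (outside ∷ p) e with ∣p∣≡1⇒singleton p e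
... | x , x∈p , unique = suc x , there x∈p , λ { (there z∈p) → cong suc (unique z∈p) }

∣p∣≡2⇒pair : ∀ {n} (p : Subset n) → ∣ p ∣ ≡ 2 →
  ∃[ x ] ∃[ y ] x ≢ y × x ∈ p × y ∈ p × (∀ {z} → z ∈ p → z ≡ x ⊎ z ≡ y)
∣p∣≡2⇒pair (inside ∷ p) e with ∣p∣≡1⇒singleton p (ℕ.suc-injective e)
... | y , y∈p , unique = zero , suc y , (λ ()) , here , there y∈p , λ
  { here → inj₁ refl ; (there z∈p) → inj₂ (cong suc (unique z∈p)) }
∣p∣≡2⇒pair (outside ∷ p) e with ∣p∣≡2⇒pair p e
... | x , y , x≢y , x∈p , y∈p , only = suc x , suc y , x≢y ∘ Fin.suc-injective , there x∈p , there y∈p , λ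
  { (there z∈p) → [ inj₁ ∘ cong suc , inj₂ ∘ cong suc ]′ (only z∈p) }

HasCardinality-cong : ∀ {a p q} {A : Set a} {P : Pred A p} {Q : Pred A q} {n} →
  (∀ x → P x ⇔ Q x) → HasCardinality P n → HasCardinality Q n
HasCardinality-cong P⇔Q (xs , xs! , ∈⇔ , len) = xs , xs! ,
  (λ x → mk⇔ (Equivalence.to (P⇔Q x) ∘ Equivalence.to (∈⇔ x)) (Equivalence.from (∈⇔ x) ∘ Equivalence.from (P⇔Q x))) , len

IsDesign-cong : ∀ {p q t v k l} {ℬ : Pred (Subset v) p} {𝒞 : Pred (Subset v) q} →
  (∀ B → ℬ B ⇔ 𝒞 B) → IsDesign t v k l ℬ → IsDesign t v k l 𝒞
IsDesign-cong ℬ⇔𝒞 design = record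
  { 1≤t = 1≤t ; t≤k = t≤k ; k≤v = k≤v
  ; blockSize = λ B → blockSize B ∘ Equivalence.from (ℬ⇔𝒞 B)
  ; balanced = λ T ∣T∣≡t → HasCardinality-cong (λ B → mk⇔
      (λ (b , T⊆B) → Equivalence.to (ℬ⇔𝒞 B) b , λ {x} → T⊆B {x})
      (λ (c , T⊆B) → Equivalence.from (ℬ⇔𝒞 B) c , λ {x} → T⊆B {x})) (balanced T ∣T∣≡t)
  }
  where open IsDesign design

-- The block sets and their index

module Blocks {q : ℕ} (𝔽 : FieldStructure q) (s : ℕ) (q≡ : q ≡ 2 ℕ.^ (2 ℕ.* s)) (17≤q : 17 ℕ.≤ q) where
  open Designs 𝔽 s q≡ 17≤q public

  Parameter : Set
  Parameter = K × K × K × Bool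

  constantTerm : Bool → K
  constantTerm h = if h then 𝟙 else 𝟘

  constantSign : Bool → ℤ
  constantSign h = if h then -1ℤ else 1ℤ

  constantSign± : ∀ h → constantSign h ≡ 1ℤ ⊎ constantSign h ≡ -1ℤ
  constantSign± true = inj₂ refl
  constantSign± false = inj₁ refl

  value : Parameter → K → K
  value (a , b , c , h) x = Tr (form a b c x) ⊕ constantTerm h

  sign : Parameter → K → ℤ
  sign (a , b , c , h) = signs a b c (constantSign h)

  sgn-value : ∀ p x → sgn (value p x) ≡ sign p x
  sgn-value (a , b , c , true) x = trans (sgn-⊕ (Tr-𝔽₂ (form a b c x)) (inj₂ refl))
    (trans (ℤ.*-comm (sgn (Tr (form a b c x))) (sgn 𝟙)) (cong₂ _*_ sgn-𝟙 (sym (χ-def (form a b c x)))))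
  sgn-value (a , b , c , false) x = trans (sgn-⊕ (Tr-𝔽₂ (form a b c x)) (inj₁ refl))
    (trans (ℤ.*-comm (sgn (Tr (form a b c x))) (sgn 𝟘)) (cong₂ _*_ sgn-𝟘 (sym (χ-def (form a b c x)))))

  nonzero? : ∀ p x → Dec (¬ (value p x ≡ 𝟘))
  nonzero? p x = ¬? (value p x ≟ 𝟘)

  supp : Parameter → Subset q
  supp p = Vec.tabulate (λ x → does (nonzero? p x))

  nonzero⇒sign : ∀ p x → value p x ≢ 𝟘 → sign p x ≡ -1ℤ
  nonzero⇒sign p x v≢0 = trans (sym (sgn-value p x)) (negative (value p x) v≢0)
    where
    negative : ∀ t → t ≢ 𝟘 → sgn t ≡ -1ℤ
    negative t t≢0 with t ≟ 𝟘
    ... | yes t≡0 = contradiction t≡0 t≢0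
    ... | no _ = refl

  sign⇒nonzero : ∀ p x → sign p x ≡ -1ℤ → value p x ≢ 𝟘
  sign⇒nonzero p x e v≡0 = contradiction (trans (sym (trans (cong sgn v≡0) sgn-𝟘)) (trans (sgn-value p x) e)) λ ()

  [nonzero] : ∀ p x → [ nonzero? p x ] ≡ isNegative (sign p x)
  [nonzero] p x = []-cong (nonzero? p x) (sign p x ℤ.≟ -1ℤ) (nonzero⇒sign p x) (sign⇒nonzero p x)

  ∣supp∣ : ∀ p → + ∣ supp p ∣ ≡ negatives (sign p)
  ∣supp∣ p = trans (∣tabulate∣ (λ x → does (nonzero? p x))) (sum-cong-≗ ([nonzero] p))

  does-true : ∀ {p} {P : Set p} (d : Dec P) → does d ≡ true → P
  does-true (yes p) _ = p

  ∈supp⇒ : ∀ p {x} → x ∈ supp p → sign p x ≡ -1ℤ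
  ∈supp⇒ p {x} x∈ = nonzero⇒sign p x (does-true (nonzero? p x) (∈-tabulate⁻ (λ x → does (nonzero? p x)) x∈))

  ⇒∈supp : ∀ p {x} → sign p x ≡ -1ℤ → x ∈ supp p
  ⇒∈supp p {x} e = ∈-tabulate⁺ (λ x → does (nonzero? p x)) (dec-true (nonzero? p x) (sign⇒nonzero p x e))

  -- Signs are ±1, so a support fixes all of them, and they fix the parameters. Hence counting
  -- parameters is counting blocks.
  supp-injective : ∀ {p p′} → supp p ≡ supp p′ → p ≡ p′
  supp-injective {p@(a , b , c , h)} {p′@(a′ , b′ , c′ , h′)} e =
    let a≡ , b≡ , c≡ , h≡ = signs-injective (constantSign± h) (constantSign± h′) same
    in cong₂ _,_ a≡ (cong₂ _,_ b≡ (cong₂ _,_ c≡ (constantSign-injective h h′ h≡)))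
    where
    ±-equal : ∀ {i j : ℤ} → i ≡ 1ℤ ⊎ i ≡ -1ℤ → j ≡ 1ℤ ⊎ j ≡ -1ℤ → (i ≡ -1ℤ → j ≡ -1ℤ) → (j ≡ -1ℤ → i ≡ -1ℤ) → i ≡ j
    ±-equal (inj₁ i) (inj₁ j) _ _ = trans i (sym j)
    ±-equal (inj₂ i) (inj₂ j) _ _ = trans i (sym j)
    ±-equal (inj₁ i) (inj₂ j) _ g = trans (g j) (sym j)
    ±-equal (inj₂ i) (inj₁ j) f _ = trans i (sym (f i))
    same : ∀ x → sign p x ≡ sign p′ x
    same x = ±-equal (signs-±1 a b c (constantSign± h) x) (signs-±1 a′ b′ c′ (constantSign± h′) x)
      (λ i → ∈supp⇒ p′ (subst (x ∈_) e (⇒∈supp p i))) (λ j → ∈supp⇒ p (subst (x ∈_) (sym e) (⇒∈supp p′ j)))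
    constantSign-injective : ∀ h h′ → constantSign h ≡ constantSign h′ → h ≡ h′
    constantSign-injective true true _ = refl
    constantSign-injective false false _ = refl

  bools : List Bool
  bools = false ∷ true ∷ []

  parameters : List Parameter
  parameters = cartesianProduct (allFin q) (cartesianProduct (allFin q) (cartesianProduct (allFin q) bools))

  parameters! : Unique parameters
  parameters! = cartesianProduct⁺ (allFin⁺ q) (cartesianProduct⁺ (allFin⁺ q) (cartesianProduct⁺ (allFin⁺ q) bools!))
    where
    bools! : Unique bools
    bools! = ((λ ()) ∷ []) ∷ [] ∷ []

  ∈-parameters : ∀ p → p List.∈ parameters
  ∈-parameters (a , b , c , h) = ∈-cartesianProduct⁺ (∈-allFin a) (∈-cartesianProduct⁺ (∈-allFin b) (∈-cartesianProduct⁺ (∈-allFin c) (∈-bools h)))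
    where
    ∈-bools : ∀ h → h List.∈ bools
    ∈-bools false = here refl
    ∈-bools true = there (here refl)

  sumList-parameters : (F : K → K → K → ℤ → ℤ) →
    sumList (λ (a , b , c , h) → F a b c (constantSign h)) parameters ≡ sumCode F
  sumList-parameters F =
    trans (sumList-cartesianProduct f₁ (allFin q) bch) (trans (sumList-tabulate (λ a → sumList (f₂ a) bch) (λ a → a)) (sum-cong-≗ λ a →
    trans (sumList-cartesianProduct (f₂ a) (allFin q) ch) (trans (sumList-tabulate (λ b → sumList (f₃ a b) ch) (λ b → b)) (sum-cong-≗ λ b →
    trans (sumList-cartesianProduct (f₃ a b) (allFin q) bools) (trans (sumList-tabulate (λ c → sumList (λ h → f₃ a b (c , h)) bools) (λ c → c)) (sum-cong-≗ λ c →
    cong (λ t → F a b c 1ℤ + t) (ℤ.+-identityʳ (F a b c -1ℤ))))))))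
    where
    ch = cartesianProduct (allFin q) bools
    bch = cartesianProduct (allFin q) ch
    f₁ : Parameter → ℤ
    f₁ (a , b , c , h) = F a b c (constantSign h)
    f₂ : K → K × K × Bool → ℤ
    f₂ a p = f₁ (a , p)
    f₃ : K → K → K × Bool → ℤ
    f₃ a b p = f₂ a (b , p)

  Block : ℕ → Pred (Subset q) _
  Block i B = ∃[ p ] supp p ≡ B × ∣ B ∣ ≡ i

  module _ (i : ℕ) where

    selected? : ∀ x y p → Dec (∣ supp p ∣ ≡ i × x ∈ supp p × y ∈ supp p)
    selected? x y p = (∣ supp p ∣ ℕ.≟ i) ×-dec ((x ∈? supp p) ×-dec (y ∈? supp p))

    selected : K → K → List Parameter
    selected x y = filter (selected? x y) parameters

    length-selected : ∀ x y → + length (selected x y) ≡ pairCount (+ i) x y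
    length-selected x y = trans (sumList-filter (selected? x y) parameters)
      (trans (sumList-cong indicator parameters) (sumList-parameters (λ a b c h → incidence (+ i) (signs a b c h) x y)))
      where
      sumList-cong : ∀ {f g : Parameter → ℤ} → (∀ p → f p ≡ g p) → ∀ ps → sumList f ps ≡ sumList g ps
      sumList-cong e [] = refl
      sumList-cong e (p ∷ ps) = cong₂ _+_ (e p) (sumList-cong e ps)
      indicator : ∀ p → [ selected? x y p ] ≡ incidence (+ i) (sign p) x y
      indicator p = trans ([]-× (∣ supp p ∣ ℕ.≟ i) ((x ∈? supp p) ×-dec (y ∈? supp p))) (cong₂ _*_
        ([]-cong (∣ supp p ∣ ℕ.≟ i) (negatives (sign p) ℤ.≟ + i)
          (λ e → trans (sym (∣supp∣ p)) (cong +_ e)) (λ e → ℤ.+-injective (trans (∣supp∣ p) e)))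
        (trans ([]-× (x ∈? supp p) (y ∈? supp p)) (cong₂ _*_
          ([]-cong (x ∈? supp p) (sign p x ℤ.≟ -1ℤ) (∈supp⇒ p) (⇒∈supp p))
          ([]-cong (y ∈? supp p) (sign p y ℤ.≟ -1ℤ) (∈supp⇒ p) (⇒∈supp p)))))

    -- By double transitivity the pair 0, 1 stands for every pair of distinct positions.
    λ₂ : ℕ
    λ₂ = length (selected 𝟘 𝟙)

    length-selected-const : ∀ {x y} → x ≢ y → length (selected x y) ≡ λ₂
    length-selected-const {x} {y} x≢y = ℤ.+-injective (trans (length-selected x y)
      (trans (pairCount-const (+ i) x≢y) (sym (length-selected 𝟘 𝟙))))

    isDesign : 2 ℕ.≤ i → i ℕ.≤ q → IsDesign 2 q i λ₂ (Block i)
    isDesign 2≤i i≤q = record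
      { 1≤t = s≤s z≤n ; t≤k = 2≤i ; k≤v = i≤q
      ; blockSize = λ B (_ , _ , ∣B∣≡i) → ∣B∣≡i
      ; balanced = balanced
      }
      where
      balanced : ∀ T → ∣ T ∣ ≡ 2 → HasCardinality (λ B → Block i B × T ⊆ B) λ₂
      balanced T ∣T∣≡2 = List.map supp (selected x y) ,
        map⁺ supp-injective (filter⁺ (selected? x y) parameters!) ,
        (λ B → mk⇔ to from) ,
        trans (length-map supp (selected x y)) (length-selected-const x≢y)
        where
        pair = ∣p∣≡2⇒pair T ∣T∣≡2
        x y : K
        x = proj₁ pair
        y = proj₁ (proj₂ pair)
        x≢y = proj₁ (proj₂ (proj₂ pair))
        x∈T : x ∈ T
        x∈T = proj₁ (proj₂ (proj₂ (proj₂ pair)))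
        y∈T : y ∈ T
        y∈T = proj₁ (proj₂ (proj₂ (proj₂ (proj₂ pair))))
        only : ∀ {z} → z ∈ T → z ≡ x ⊎ z ≡ y
        only = proj₂ (proj₂ (proj₂ (proj₂ (proj₂ pair))))
        to : ∀ {B} → B List.∈ List.map supp (selected x y) → Block i B × T ⊆ B
        to {B} B∈ =
          let p , p∈ , B≡ = ∈-map⁻ supp B∈
              _ , ∣p∣≡i , x∈p , y∈p = ∈-filter⁻ (selected? x y) {xs = parameters} p∈
          in (p , sym B≡ , trans (cong ∣_∣ B≡) ∣p∣≡i) , λ {z} z∈T → subst (z ∈_) (sym B≡)
               ([ (λ z≡x → subst (_∈ supp p) (sym z≡x) x∈p) , (λ z≡y → subst (_∈ supp p) (sym z≡y) y∈p) ]′ (only z∈T))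
        from : ∀ {B} → Block i B × T ⊆ B → B List.∈ List.map supp (selected x y)
        from ((p , refl , ∣B∣≡i) , T⊆B) =
          ∈-map⁺ supp (∈-filter⁺ (selected? x y) (∈-parameters p) (∣B∣≡i , T⊆B x∈T , T⊆B y∈T))

    λ₂-formula : + λ₂ * (+ q * (+ q - 1ℤ)) ≡ signedCount (+ q - + 2 * + i) * (+ i * + i - + i)
    λ₂-formula = begin
      + λ₂ * (+ q * (+ q - 1ℤ))                                ≡⟨ cong (λ t → t * (+ q * (+ q - 1ℤ))) (length-selected 𝟘 𝟙) ⟩
      pairCount (+ i) 𝟘 𝟙 * (+ q * (+ q - 1ℤ))                 ≡⟨ double-count (+ i) ⟩
      codewordCount (+ i) * (+ i * + i - + i)
        ≡⟨ cong (λ t → t * (+ i * + i - + i)) (codewordCount≡signedCount (+ i)) ⟩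
      signedCount (+ q - + 2 * + i) * (+ i * + i - + i)        ∎

  ∣Block∣≢1 : ∀ {i B} → Block i B → i ≢ 1
  ∣Block∣≢1 (p@(a , b , c , h) , refl , ∣B∣≡i) i≡1 = negatives≢1 a b c (constantSign± h)
    (trans (sym (∣supp∣ p)) (cong +_ (trans ∣B∣≡i i≡1)))

  ∣Block∣≤q : ∀ {i B} → Block i B → i ℕ.≤ q
  ∣Block∣≤q {B = B} (_ , _ , refl) = ∣p∣≤n B

-- From an arbitrary finite field to its copy on `Fin q`

module Transport {c ℓ} (s : ℕ) (3≤s : 3 ℕ.≤ s) (F : FiniteField c ℓ (2 ℕ.^ (2 ℕ.* s))) where

  module F = FiniteField F
  open F using (Carrier; _≈_; 0#; 1#; +-cong; +-congʳ; *-congˡ; *-congʳ)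
    renaming (_+_ to _+ᶠ_; _*_ to _*ᶠ_; -_ to -ᶠ_; refl to ≈-refl; sym to ≈-sym; trans to ≈-trans)
  open Code (2 ℕ.* s) F using (code; 𝔽₂) renaming (Tr to TrF)
  open Inverse F.enumeration using (to; from; to-cong; strictlyInverseˡ; strictlyInverseʳ)
  module ^F = Algebra.Properties.Semiring.Exp F.semiring
  module ∑F = Algebra.Properties.Monoid.Sum F.+-monoid

  q : ℕ
  q = 2 ℕ.^ (2 ℕ.* s)

  -- On Fin q with propositional equality every function can be summed, without congruence proofs.
  rawRing : RawRing 0ℓ 0ℓ
  rawRing = record
    { Carrier = Fin q ; _≈_ = _≡_
    ; _+_ = λ x y → to (from x +ᶠ from y) ; _*_ = λ x y → to (from x *ᶠ from y) ; -_ = λ x → to (-ᶠ from x)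
    ; 0# = to 0# ; 1# = to 1#
    }

  from-injective : ∀ {x y} → from x ≈ from y → x ≡ y
  from-injective {x} {y} e = trans (sym (strictlyInverseˡ x)) (trans (to-cong e) (strictlyInverseˡ y))

  from-isMonomorphism : IsRingMonomorphism rawRing (CommutativeRing.rawRing F.commutativeRing) from
  from-isMonomorphism = record
    { isRingHomomorphism = record
      { isSemiringHomomorphism = record
        { isNearSemiringHomomorphism = record
          { +-isMonoidHomomorphism = record
            { isMagmaHomomorphism = record
              { isRelHomomorphism = record { cong = λ { refl → ≈-refl } }
              ; homo = λ x y → strictlyInverseʳ (from x +ᶠ from y)
              }
            ; ε-homo = strictlyInverseʳ 0#
            }
          ; *-homo = λ x y → strictlyInverseʳ (from x *ᶠ from y)
          }
        ; 1#-homo = strictlyInverseʳ 1#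
        }
      ; -‿homo = λ x → strictlyInverseʳ (-ᶠ from x)
      }
    ; injective = from-injective
    }

  structure : FieldStructure q
  structure = record
    { _⊕_ = RawRing._+_ rawRing ; _⊗_ = RawRing._*_ rawRing ; ⊖_ = RawRing.-_ rawRing
    ; 𝟘 = to 0# ; 𝟙 = to 1#
    ; isCommutativeRing = Algebra.Morphism.RingMonomorphism.isCommutativeRing from-isMonomorphism F.isCommutativeRing
    ; 𝟙≢𝟘 = λ e → F.1≉0 (≈-trans (≈-sym (strictlyInverseʳ 1#)) (≈-trans (from-≡ e) (strictlyInverseʳ 0#)))
    ; inverse = λ x x≢0 →
        let y , xy≈1 = F.inverse (from x) λ x≈0 → x≢0 (from-injective (≈-trans x≈0 (≈-sym (strictlyInverseʳ 0#))))
        in to y , to-cong (≈-trans (*-congˡ (strictlyInverseʳ y)) xy≈1)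
    }
    where
    from-≡ : ∀ {x y} → x ≡ y → from x ≈ from y
    from-≡ refl = ≈-refl

  17≤q : 17 ℕ.≤ q
  17≤q = ℕ.≤-trans (ℕ.m≤m+n 17 47) (ℕ.^-monoʳ-≤ 2 (ℕ.*-monoʳ-≤ 2 3≤s))

  open Blocks structure s refl 17≤q public

  from-⊕ : ∀ x y → from (x ⊕ y) ≈ from x +ᶠ from y
  from-⊕ x y = strictlyInverseʳ _

  from-⊗ : ∀ x y → from (x ⊗ y) ≈ from x *ᶠ from y
  from-⊗ x y = strictlyInverseʳ _

  from-^ : ∀ x n → from (x ^ n) ≈ from x F.^ n
  from-^ x zero = strictlyInverseʳ 1#
  from-^ x (suc n) = ≈-trans (from-⊗ x (x ^ n)) (*-congˡ (from-^ x n))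

  -- One side squares its argument where the other doubles the exponent; (x²)^k = x^(2k) reconciles
  -- them.
  from-partialTr : ∀ n x → from (partialTr n x) ≈ F.sum {n} (λ j → from x F.^ (2 ℕ.^ toℕ j))
  from-partialTr zero x = strictlyInverseʳ 0#
  from-partialTr (suc n) x = ≈-trans (from-⊕ x (partialTr n (x ⊗ x)))
    (+-cong (≈-sym (F.*-identityʳ (from x))) (≈-trans (from-partialTr n (x ⊗ x)) (∑F.sum-cong-≋ {n} λ j → square (2 ℕ.^ toℕ j))))
    where
    square : ∀ k → from (x ⊗ x) F.^ k ≈ from x F.^ (2 ℕ.* k)
    square k = ≈-trans (^F.^-congˡ k (≈-trans (from-⊗ x x) (*-congˡ (≈-sym (F.*-identityʳ (from x)))))) (^F.^-assocʳ (from x) 2 k)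

  TrF-cong : ∀ {x y} → x ≈ y → TrF x ≈ TrF y
  TrF-cong x≈y = ∑F.sum-cong-≋ {2 ℕ.* s} λ j → ^F.^-congˡ (2 ℕ.^ toℕ j) x≈y

  from-form : ∀ a b c x → from (form a b c x) ≈ from a *ᶠ from x F.^ 5 +ᶠ from b *ᶠ from x F.^ 3 +ᶠ from c *ᶠ from x
  from-form a b c x = ≈-trans (from-⊕ _ _) (+-cong
    (≈-trans (from-⊕ _ _) (+-cong (≈-trans (from-⊗ a _) (*-congˡ (from-^ x 5))) (≈-trans (from-⊗ b _) (*-congˡ (from-^ x 3)))))
    (from-⊗ c x))

  from-value : ∀ a b c h x → from (value (a , b , c , h) x) ≈
    TrF (from a *ᶠ from x F.^ 5 +ᶠ from b *ᶠ from x F.^ 3 +ᶠ from c *ᶠ from x) +ᶠ from (constantTerm h)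
  from-value a b c h x = ≈-trans (from-⊕ (Tr (form a b c x)) (constantTerm h))
    (+-congʳ (≈-trans (from-partialTr (2 ℕ.* s) (form a b c x)) (TrF-cong (from-form a b c x))))

  word : Parameter → F.Word
  word p x = from (value p x)

  𝔽₂-constantTerm : ∀ h → 𝔽₂ (from (constantTerm h))
  𝔽₂-constantTerm true = inj₂ (strictlyInverseʳ 1#)
  𝔽₂-constantTerm false = inj₁ (strictlyInverseʳ 0#)

  word∈code : ∀ p → code (word p)
  word∈code (a , b , c , h) = from a , from b , from c , from (constantTerm h) , 𝔽₂-constantTerm h , from-value a b c h

  code⇒word : ∀ {w} → code w → ∃[ p ] (∀ x → w x ≈ word p x)
  code⇒word {w} (a , b , c , h , h∈𝔽₂ , w≈) = (to a , to b , to c , bit) , λ x → ≈-trans (w≈ x) (≈-trans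
      (+-cong (TrF-cong (+-cong (+-cong (*-congʳ (≈from a)) (*-congʳ (≈from b))) (*-congʳ (≈from c)))) (h≈ h∈𝔽₂))
      (≈-sym (from-value (to a) (to b) (to c) bit x)))
    where
    ≈from : ∀ x → x ≈ from (to x)
    ≈from x = ≈-sym (strictlyInverseʳ x)
    bitOf : 𝔽₂ h → Bool
    bitOf (inj₁ _) = false
    bitOf (inj₂ _) = true
    bit : Bool
    bit = bitOf h∈𝔽₂
    h≈ : (h∈ : 𝔽₂ h) → h ≈ from (constantTerm (bitOf h∈))
    h≈ (inj₁ h≈0) = ≈-trans h≈0 (≈from 0#)
    h≈ (inj₂ h≈1) = ≈-trans h≈1 (≈from 1#)

  support-word : ∀ w p → (∀ x → w x ≈ word p x) → F.support w ≡ supp p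
  support-word w p w≈ = tabulate-cong λ x →
    does-⇔ (mk⇔ (λ w≉0 v≡0 → w≉0 (≈-trans (w≈ x) (zero⇒ v≡0)))
                (λ v≢0 w≈0 → v≢0 (from-injective (≈-trans (≈-sym (w≈ x)) (≈-trans w≈0 (≈-sym (strictlyInverseʳ 0#)))))))
           (¬? (w x F.≟ 0#)) (nonzero? p x)
    where
    zero⇒ : ∀ {v} → v ≡ 𝟘 → from v ≈ 0#
    zero⇒ refl = strictlyInverseʳ 0#

  Supports⇔Block : ∀ i B → Block i B ⇔ F.Supports code i B
  Supports⇔Block i B = mk⇔ to′ from′
    where
    to′ : Block i B → F.Supports code i B
    to′ (p , supp≡B , ∣B∣≡i) = word p , word∈code p , trans (cong ∣_∣ support≡B) ∣B∣≡i , support≡B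
      where
      support≡B : F.support (word p) ≡ B
      support≡B = trans (support-word (word p) p (λ x → ≈-refl)) supp≡B
    from′ : F.Supports code i B → Block i B
    from′ (w , w∈code , weight≡i , support≡B) =
      let p , w≈ = code⇒word w∈code
      in p , trans (sym (support-word w p w≈)) support≡B , trans (cong ∣_∣ (sym support≡B)) weight≡i

  design : ∀ i → 2 ℕ.≤ i → i ℕ.≤ q → IsDesign 2 q i (λ₂ i) (F.Supports code i)
  design i 2≤i i≤q = IsDesign-cong (Supports⇔Block i) (isDesign i 2≤i i≤q)

  design-of-weight : ∀ i → 1 ℕ.≤ i → (∃[ w ] (code w × F.weight w ≡ i)) → IsTDesign 2 (F.Supports code i)
  design-of-weight i 1≤i (w , w∈code , weight≡i) = i , λ₂ i , design i (ℕ.≤∧≢⇒< 1≤i λ 1≡i → ∣Block∣≢1 block (sym 1≡i)) (∣Block∣≤q block)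
    where
    block : Block i (F.support w)
    block = Equivalence.from (Supports⇔Block i (F.support w)) (w , w∈code , weight≡i , refl)

-- Fractions, powers of two, and the arithmetic of the indices

/-≡ : ∀ l n d .{{_ : ℕ.NonZero d}} → + l * + d ≡ n → + l / 1 ≡ n / d
/-≡ l n (suc d) e = ℚ.fromℚᵘ-cong {mkℚᵘ (+ l) 0} {mkℚᵘ n d} (*≡* (trans e (sym (ℤ.*-identityʳ n))))

-- Cross-multiplication, carried out on unnormalised fractions, whose product is formed without
-- reduction to lowest terms.
/-*-≡ : ∀ l c b n d .{{_ : ℕ.NonZero b}} .{{_ : ℕ.NonZero d}} → + l * (+ b * + d) ≡ c * n → + l / 1 ≡ (c / b) ℚ.* (n / d)
/-*-≡ l c (suc b) n (suc d) e = ℚ.toℚᵘ-injective (begin-equality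
  toℚᵘ (+ l / 1)                              ≃⟨ ℚ.toℚᵘ-fromℚᵘ (mkℚᵘ (+ l) 0) ⟩
  mkℚᵘ (+ l) 0                                ≃⟨ *≡* (trans (cong (+ l *_) (ℤ.pos-* (suc b) (suc d))) (trans e (sym (ℤ.*-identityʳ (c * n))))) ⟩
  mkℚᵘ c b ℚᵘ.* mkℚᵘ n d                      ≃⟨ ℚᵘ.*-cong (ℚ.toℚᵘ-fromℚᵘ (mkℚᵘ c b)) (ℚ.toℚᵘ-fromℚᵘ (mkℚᵘ n d)) ⟨
  toℚᵘ (c / suc b) ℚᵘ.* toℚᵘ (n / suc d)      ≃⟨ ℚ.toℚᵘ-homo-* (c / suc b) (n / suc d) ⟨
  toℚᵘ ((c / suc b) ℚ.* (n / suc d))          ∎′)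
  where open ℚᵘ.≤-Reasoning renaming (_∎ to _∎′)

pos-∸ : ∀ {m n} → n ℕ.≤ m → + (m ℕ.∸ n) ≡ + m - + n
pos-∸ {m} {n} n≤m = trans (sym (ℤ.⊖-≥ n≤m)) (sym (ℤ.m-n≡m⊖n m n))

cancel-factor : ∀ x y z .{{_ : ℤ.NonZero x}} → x * y ≡ x * z → y ≡ z
cancel-factor x y z = ℤ.*-cancelˡ-≡ x y z

module Powers (s : ℕ) (3≤s : 3 ℕ.≤ s) where

  -- The least exponent in the stated indices is s - 3. All powers of two there are constants times
  -- powers of U = 2^(s - 3), so relations between them become polynomial identities in U.
  t : ℕ
  t = s ℕ.∸ 3

  s≡ : s ≡ 3 ℕ.+ t
  s≡ = sym (ℕ.m+[n∸m]≡n 3≤s)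

  s-multiple : ∀ k → k ℕ.* s ≡ k ℕ.* 3 ℕ.+ k ℕ.* t
  s-multiple k = trans (cong (k ℕ.*_) s≡) (ℕ.*-distribˡ-+ k 3 t)

  U : ℤ
  U = + (2 ℕ.^ t)

  pos-^ : ∀ n k → + (n ℕ.^ k) ≡ (+ n) ℤ.^ k
  pos-^ n zero = refl
  pos-^ n (suc k) = trans (ℤ.pos-* n (n ℕ.^ k)) (cong (+ n *_) (pos-^ n k))

  pow : ∀ {e x} a k → U ℤ.^ k ≡ x → e ≡ a ℕ.+ k ℕ.* t → + (2 ℕ.^ e) ≡ + (2 ℕ.^ a) * x
  pow a k refl refl = begin
    + (2 ℕ.^ (a ℕ.+ k ℕ.* t))                 ≡⟨ cong +_ (ℕ.^-distribˡ-+-* 2 a (k ℕ.* t)) ⟩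
    + (2 ℕ.^ a ℕ.* 2 ℕ.^ (k ℕ.* t))           ≡⟨ cong (λ e → + (2 ℕ.^ a ℕ.* 2 ℕ.^ e)) (ℕ.*-comm k t) ⟩
    + (2 ℕ.^ a ℕ.* 2 ℕ.^ (t ℕ.* k))           ≡⟨ cong (λ n → + (2 ℕ.^ a ℕ.* n)) (sym (ℕ.^-*-assoc 2 t k)) ⟩
    + (2 ℕ.^ a ℕ.* (2 ℕ.^ t) ℕ.^ k)           ≡⟨ ℤ.pos-* (2 ℕ.^ a) _ ⟩
    + (2 ℕ.^ a) * + ((2 ℕ.^ t) ℕ.^ k)         ≡⟨ cong (+ (2 ℕ.^ a) *_) (pos-^ (2 ℕ.^ t) k) ⟩
    + (2 ℕ.^ a) * U ℤ.^ k                     ∎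

  U^1 : U * 1ℤ ≡ U
  U^1 = ℤ.*-identityʳ U

  U^2 : U * (U * 1ℤ) ≡ U * U
  U^2 = cong (U *_) U^1

  U^3 : U * (U * (U * 1ℤ)) ≡ U * U * U
  U^3 = trans (cong (U *_) U^2) (sym (ℤ.*-assoc U U U))

  U^4 : U * (U * (U * (U * 1ℤ))) ≡ U * U * (U * U)
  U^4 = trans (cong (λ x → U * (U * x)) U^2) (sym (ℤ.*-assoc U U (U * U)))

  U^6 : U * (U * (U * (U * (U * (U * 1ℤ))))) ≡ U * U * U * (U * U * U)
  U^6 = expand U
    where
    expand : ∀ x → x * (x * (x * (x * (x * (x * 1ℤ))))) ≡ x * x * x * (x * x * x)
    expand = solve-∀

  drop : ∀ {e} a x → e ≡ a ℕ.+ x → e ℕ.∸ a ≡ x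
  drop a x refl = ℕ.m+n∸m≡n a x

  3+t≡ : 3 ℕ.+ t ≡ 3 ℕ.+ 1 ℕ.* t
  3+t≡ = cong (3 ℕ.+_) (sym (ℕ.+-identityʳ t))

  [s-3] : + (2 ℕ.^ (s ℕ.∸ 3)) ≡ + 1 * U
  [s-3] = pow 0 1 U^1 (sym (ℕ.+-identityʳ t))

  [s-2] : + (2 ℕ.^ (s ℕ.∸ 2)) ≡ + 2 * U
  [s-2] = pow 1 1 U^1 (drop 2 (1 ℕ.+ 1 ℕ.* t) (trans s≡ 3+t≡))

  [s-1] : + (2 ℕ.^ (s ℕ.∸ 1)) ≡ + 4 * U
  [s-1] = pow 2 1 U^1 (drop 1 (2 ℕ.+ 1 ℕ.* t) (trans s≡ 3+t≡))

  [s] : + (2 ℕ.^ s) ≡ + 8 * U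
  [s] = pow 3 1 U^1 (trans s≡ 3+t≡)

  [s+1] : + (2 ℕ.^ (s ℕ.+ 1)) ≡ + 16 * U
  [s+1] = pow 4 1 U^1 (trans (ℕ.+-comm s 1) (cong suc (trans s≡ 3+t≡)))

  [2s] : + (2 ℕ.^ (2 ℕ.* s)) ≡ + 64 * (U * U)
  [2s] = pow 6 2 U^2 (s-multiple 2)

  [2s-1] : + (2 ℕ.^ (2 ℕ.* s ℕ.∸ 1)) ≡ + 32 * (U * U)
  [2s-1] = pow 5 2 U^2 (drop 1 (5 ℕ.+ 2 ℕ.* t) (s-multiple 2))

  [2s-2] : + (2 ℕ.^ (2 ℕ.* s ℕ.∸ 2)) ≡ + 16 * (U * U)
  [2s-2] = pow 4 2 U^2 (drop 2 (4 ℕ.+ 2 ℕ.* t) (s-multiple 2))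

  [2s-4] : + (2 ℕ.^ (2 ℕ.* s ℕ.∸ 4)) ≡ + 4 * (U * U)
  [2s-4] = pow 2 2 U^2 (drop 4 (2 ℕ.+ 2 ℕ.* t) (s-multiple 2))

  [3s-4] : + (2 ℕ.^ (3 ℕ.* s ℕ.∸ 4)) ≡ + 32 * (U * U * U)
  [3s-4] = pow 5 3 U^3 (drop 4 (5 ℕ.+ 3 ℕ.* t) (s-multiple 3))

  [4s] : + (2 ℕ.^ (4 ℕ.* s)) ≡ + 4096 * (U * U * (U * U))
  [4s] = pow 12 4 U^4 (s-multiple 4)

  [4s-2] : + (2 ℕ.^ (4 ℕ.* s ℕ.∸ 2)) ≡ + 1024 * (U * U * (U * U))
  [4s-2] = pow 10 4 U^4 (drop 2 (10 ℕ.+ 4 ℕ.* t) (s-multiple 4))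

  [4s-6] : + (2 ℕ.^ (4 ℕ.* s ℕ.∸ 6)) ≡ + 64 * (U * U * (U * U))
  [4s-6] = pow 6 4 U^4 (drop 6 (6 ℕ.+ 4 ℕ.* t) (s-multiple 4))

  [6s-6] : + (2 ℕ.^ (6 ℕ.* s ℕ.∸ 6)) ≡ + 4096 * (U * U * U * (U * U * U))
  [6s-6] = pow 12 6 U^6 (drop 6 (12 ℕ.+ 6 ℕ.* t) (s-multiple 6))

  -- As e is positive, 2 + 2^e is at most twice 2^e. The summand 2 is what keeps the weight `half`
  -- minus 2^e at least 2.
  gap : ∀ {e f} → 1 ℕ.≤ e → e ℕ.< f → 2 ℕ.+ 2 ℕ.^ e ℕ.≤ 2 ℕ.^ f
  gap {e} {f} 1≤e e<f = ℕ.≤-trans (ℕ.+-mono-≤ (ℕ.^-monoʳ-≤ 2 1≤e) (ℕ.m≤m+n (2 ℕ.^ e) 0)) (ℕ.^-monoʳ-≤ 2 e<f)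

  half : ℕ
  half = 2 ℕ.^ (2 ℕ.* s ℕ.∸ 1)

  half+half : half ℕ.+ half ≡ 2 ℕ.^ (2 ℕ.* s)
  half+half = trans (cong (half ℕ.+_) (sym (ℕ.+-identityʳ half))) (cong (2 ℕ.^_) (ℕ.m+[n∸m]≡n 1≤2s))
    where
    1≤2s : 1 ℕ.≤ 2 ℕ.* s
    1≤2s = ℕ.≤-trans (s≤s z≤n) (ℕ.≤-trans 3≤s (ℕ.m≤m+n s (1 ℕ.* s)))

  2s-1≡ : 2 ℕ.* s ℕ.∸ 1 ≡ 5 ℕ.+ 2 ℕ.* t
  2s-1≡ = drop 1 (5 ℕ.+ 2 ℕ.* t) (s-multiple 2)

  s+2≤2s-1 : s ℕ.+ 2 ℕ.≤ 2 ℕ.* s ℕ.∸ 1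
  s+2≤2s-1 = subst₂ ℕ._≤_ (trans (cong (2 ℕ.+_) (sym s≡)) (ℕ.+-comm 2 s)) (sym 2s-1≡) (ℕ.+-monoʳ-≤ 5 (ℕ.m≤m+n t (t ℕ.+ 0)))

  module Offset {e : ℕ} (1≤e : 1 ℕ.≤ e) (e≤s+1 : e ℕ.≤ s ℕ.+ 1) where

    2+2^e≤half : 2 ℕ.+ 2 ℕ.^ e ℕ.≤ half
    2+2^e≤half = gap 1≤e (ℕ.≤-trans (s≤s e≤s+1) (ℕ.≤-trans (ℕ.≤-reflexive (sym (ℕ.+-suc s 1))) s+2≤2s-1))

    2^e≤half : 2 ℕ.^ e ℕ.≤ half
    2^e≤half = ℕ.m+n≤o⇒n≤o 2 2+2^e≤half

    2≤half-2^e : 2 ℕ.≤ half ℕ.∸ 2 ℕ.^ e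
    2≤half-2^e = ℕ.m+n≤o⇒m≤o∸n 2 2+2^e≤half

    2≤half+2^e : 2 ℕ.≤ half ℕ.+ 2 ℕ.^ e
    2≤half+2^e = ℕ.≤-trans (ℕ.m+n≤o⇒m≤o 2 2+2^e≤half) (ℕ.m≤m+n half (2 ℕ.^ e))

    half-2^e≤q : half ℕ.∸ 2 ℕ.^ e ℕ.≤ 2 ℕ.^ (2 ℕ.* s)
    half-2^e≤q = ℕ.≤-trans (ℕ.m∸n≤m half (2 ℕ.^ e)) (ℕ.≤-trans (ℕ.m≤m+n half half) (ℕ.≤-reflexive half+half))

    half+2^e≤q : half ℕ.+ 2 ℕ.^ e ℕ.≤ 2 ℕ.^ (2 ℕ.* s)
    half+2^e≤q = ℕ.≤-trans (ℕ.+-monoʳ-≤ half 2^e≤half) (ℕ.≤-reflexive half+half)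

    [half-2^e] : + (half ℕ.∸ 2 ℕ.^ e) ≡ + half - + (2 ℕ.^ e)
    [half-2^e] = pos-∸ 2^e≤half

    [half+2^e] : + (half ℕ.+ 2 ℕ.^ e) ≡ + half + + (2 ℕ.^ e)
    [half+2^e] = ℤ.pos-+ half (2 ℕ.^ e)

-- The cases a, b and c are those of radical size 1, 4 and 16, and l is the index.
module Identities where

  -- `X` and `Y` are 2^s - 1 and 2^s + 1, the order depending on the sign of the offset. The factor
  -- `X` of q - 1 cancels against i, and `Y` stays as the denominator.
  weight-a : ∀ {q i} l X Y h P .{{_ : ℤ.NonZero X}} → i ≡ h * X → q - 1ℤ ≡ X * Y →
    + 15 * 1ℤ * l * (q - 1ℤ) ≡ + 2 * P * (i * i - i) → l * (+ 15 * Y) ≡ + 2 * (h * P * (i - 1ℤ))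
  weight-a {q} {i} l X Y h P refl q-1≡ e = cancel-factor X (l * (+ 15 * Y)) (+ 2 * (h * P * (i - 1ℤ))) (begin
    X * (l * (+ 15 * Y))               ≡⟨ before X Y l ⟩
    + 15 * 1ℤ * l * (X * Y)            ≡⟨ cong (+ 15 * 1ℤ * l *_) (sym q-1≡) ⟩
    + 15 * 1ℤ * l * (q - 1ℤ)           ≡⟨ e ⟩
    + 2 * P * (i * i - i)              ≡⟨ after X h P ⟩
    X * (+ 2 * (h * P * (i - 1ℤ)))     ∎)
    where
    before : ∀ X Y l → X * (l * (+ 15 * Y)) ≡ + 15 * 1ℤ * l * (X * Y)
    before = solve-∀
    after : ∀ X h P → + 2 * P * (h * X * (h * X) - h * X) ≡ X * (+ 2 * (h * P * (h * X - 1ℤ)))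
    after = solve-∀

  -- Here h = 2^s and w = 2^(3s - 4). The number of forms already contains q - 1, so only the
  -- denominator 3 remains.
  weight-b : ∀ {q i} l Z h w .{{_ : ℤ.NonZero (q - 1ℤ)}} → i ≡ h * Z → q * h ≡ + 16 * w →
    + 12 * + 4 * l * (q - 1ℤ) ≡ + 7 * (q * (q - 1ℤ)) * (i * i - i) → l * (+ 3 * 1ℤ) ≡ + 7 * (w * (i - 1ℤ) * Z)
  weight-b {q} {i} l Z h w refl qh≡ e =
    cancel-factor (q - 1ℤ) (l * (+ 3 * 1ℤ)) (+ 7 * (w * (i - 1ℤ) * Z))
      (cancel-factor (+ 16) ((q - 1ℤ) * (l * (+ 3 * 1ℤ))) ((q - 1ℤ) * (+ 7 * (w * (i - 1ℤ) * Z))) (begin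
    + 16 * ((q - 1ℤ) * (l * (+ 3 * 1ℤ)))                   ≡⟨ before (q - 1ℤ) l ⟩
    + 12 * + 4 * l * (q - 1ℤ)                              ≡⟨ e ⟩
    + 7 * (q * (q - 1ℤ)) * (i * i - i)                     ≡⟨ middle q (q - 1ℤ) h Z ⟩
    q * h * ((q - 1ℤ) * (+ 7 * ((i - 1ℤ) * Z)))            ≡⟨ cong (_* ((q - 1ℤ) * (+ 7 * ((i - 1ℤ) * Z)))) qh≡ ⟩
    + 16 * w * ((q - 1ℤ) * (+ 7 * ((i - 1ℤ) * Z)))         ≡⟨ after w (q - 1ℤ) (i - 1ℤ) Z ⟩
    + 16 * ((q - 1ℤ) * (+ 7 * (w * (i - 1ℤ) * Z)))         ∎))
    where
    before : ∀ p l → + 16 * (p * (l * (+ 3 * 1ℤ))) ≡ + 12 * + 4 * l * p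
    before = solve-∀
    middle : ∀ q p h Z → + 7 * (q * p) * (h * Z * (h * Z) - h * Z) ≡ q * h * (p * (+ 7 * ((h * Z - 1ℤ) * Z)))
    middle = solve-∀
    after : ∀ w p j Z → + 16 * w * (p * (+ 7 * (j * Z))) ≡ + 16 * (p * (+ 7 * (w * j * Z)))
    after = solve-∀

  -- Here U = 2^(s - 3), Z = 2^(s - 2) ± 1, and P is (q - 1)(q - 4)/4. The cancelled 64 is 4 from P
  -- times 16 from i.
  weight-c : ∀ {q i} l Z U P → i ≡ + 16 * U * Z → (q - 1ℤ) * (q - + 4) ≡ + 4 * P →
    + 60 * + 16 * l * (q - 1ℤ) ≡ (q - 1ℤ) * (q - + 4) * (i * i - i) →
    l * (+ 15 * (q - 1ℤ)) ≡ 1ℤ * (U * P * (i - 1ℤ) * Z)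
  weight-c {q} {i} l Z U P refl P≡ e = cancel-factor (+ 64) (l * (+ 15 * (q - 1ℤ))) (1ℤ * (U * P * (i - 1ℤ) * Z)) (begin
    + 64 * (l * (+ 15 * (q - 1ℤ)))             ≡⟨ before (q - 1ℤ) l ⟩
    + 60 * + 16 * l * (q - 1ℤ)                 ≡⟨ e ⟩
    (q - 1ℤ) * (q - + 4) * (i * i - i)         ≡⟨ cong (_* (i * i - i)) P≡ ⟩
    + 4 * P * (i * i - i)                      ≡⟨ after U Z P ⟩
    + 64 * (1ℤ * (U * P * (i - 1ℤ) * Z))       ∎)
    where
    before : ∀ p l → + 64 * (l * (+ 15 * p)) ≡ + 60 * + 16 * l * p
    before = solve-∀
    after : ∀ U Z P → + 4 * P * (+ 16 * U * Z * (+ 16 * U * Z) - + 16 * U * Z) ≡ + 64 * (1ℤ * (U * P * (+ 16 * U * Z - 1ℤ) * Z))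
    after = solve-∀

  -- The factor 480 = 8 · 60 clears all denominators: 8 for `S`, and 60 as a common multiple of 15,
  -- 12 and 60. The variables x, y, z are q³, q² and 4q, each divided by 64.
  weight-0 : ∀ {q i} l S N₁ N₄ N₁₆ x y z .{{_ : ℤ.NonZero q}} → q ≡ + 2 * i →
    q * (q * q) ≡ + 64 * x → q * q ≡ + 64 * y → + 4 * q ≡ + 64 * z →
    l * (q * (q - 1ℤ)) ≡ S * (i * i - i) →
    + 8 * S ≡ + 16 * (q * (q * q)) - (+ 16 * q * N₁ + + 4 * q * N₄ + q * N₁₆ + + 16) →
    + 15 * N₁ ≡ + 2 * (+ 3 * (q * q) + + 5 * q - + 8) →
    + 12 * N₄ ≡ + 7 * (q * (q - 1ℤ)) →
    + 60 * N₁₆ ≡ (q - 1ℤ) * (q - + 4) →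
    l * (q - 1ℤ) ≡ (+ 29 * x - + 33 * y + + 17 * z - 1ℤ) * (i - 1ℤ)
  weight-0 {q} {i} l S N₁ N₄ N₁₆ x y z q≡ x≡ y≡ z≡ el eS e₁ e₄ e₁₆ =
    cancel-factor q (l * (q - 1ℤ)) (T * (i - 1ℤ)) (cancel-factor (+ 480) (q * (l * (q - 1ℤ))) (q * (T * (i - 1ℤ))) (begin
    + 480 * (q * (l * (q - 1ℤ)))                 ≡⟨ regroup q (q - 1ℤ) l ⟩
    + 480 * (l * (q * (q - 1ℤ)))                 ≡⟨ cong (+ 480 *_) el ⟩
    + 480 * (S * (i * i - i))                    ≡⟨ regroup′ S (i * i - i) ⟩
    + 60 * (+ 8 * S) * (i * i - i)               ≡⟨ cong (λ S → + 60 * S * (i * i - i)) eS ⟩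
    + 60 * (+ 16 * (q * (q * q)) - (+ 16 * q * N₁ + + 4 * q * N₄ + q * N₁₆ + + 16)) * (i * i - i)
      ≡⟨ cong (_* (i * i - i)) (distribute q N₁ N₄ N₁₆) ⟩
    (+ 960 * (q * (q * q)) - (+ 64 * q * (+ 15 * N₁) + + 20 * q * (+ 12 * N₄) + q * (+ 60 * N₁₆) + + 960)) * (i * i - i)
      ≡⟨ cong (λ x → (+ 960 * (q * (q * q)) - x) * (i * i - i))
           (cong₂ (λ x y → x + q * y + + 960) (cong₂ (λ x y → + 64 * q * x + + 20 * q * y) e₁ e₄) e₁₆) ⟩
    (+ 960 * (q * (q * q)) - (+ 64 * q * (+ 2 * (+ 3 * (q * q) + + 5 * q - + 8)) + + 20 * q * (+ 7 * (q * (q - 1ℤ))) + q * ((q - 1ℤ) * (q - + 4)) + + 960)) * (i * i - i)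
      ≡⟨ cong (_* (i * i - i)) (collect q) ⟩
    + 15 * (+ 29 * (q * (q * q)) - + 33 * (q * q) + + 17 * (+ 4 * q) - + 64) * (i * i - i)
      ≡⟨ cong (λ t → + 15 * (t - + 64) * (i * i - i)) (cong₂ _+_ (cong₂ (λ x y → + 29 * x - + 33 * y) x≡ y≡) (cong (+ 17 *_) z≡)) ⟩
    + 15 * (+ 29 * (+ 64 * x) - + 33 * (+ 64 * y) + + 17 * (+ 64 * z) - + 64) * (i * i - i)
      ≡⟨ after x y z i ⟩
    + 480 * (+ 2 * i * (T * (i - 1ℤ)))
      ≡⟨ cong (λ q → + 480 * (q * (T * (i - 1ℤ)))) (sym q≡) ⟩
    + 480 * (q * (T * (i - 1ℤ))) ∎))
    where
    T : ℤ
    T = + 29 * x - + 33 * y + + 17 * z - 1ℤ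
    regroup : ∀ q p l → + 480 * (q * (l * p)) ≡ + 480 * (l * (q * p))
    regroup = solve-∀
    regroup′ : ∀ S x → + 480 * (S * x) ≡ + 60 * (+ 8 * S) * x
    regroup′ = solve-∀
    distribute : ∀ q i j k → + 60 * (+ 16 * (q * (q * q)) - (+ 16 * q * i + + 4 * q * j + q * k + + 16)) ≡
      + 960 * (q * (q * q)) - (+ 64 * q * (+ 15 * i) + + 20 * q * (+ 12 * j) + q * (+ 60 * k) + + 960)
    distribute = solve-∀
    collect : ∀ q → + 960 * (q * (q * q)) - (+ 64 * q * (+ 2 * (+ 3 * (q * q) + + 5 * q - + 8)) + + 20 * q * (+ 7 * (q * (q - 1ℤ))) + q * ((q - 1ℤ) * (q - + 4)) + + 960) ≡
      + 15 * (+ 29 * (q * (q * q)) - + 33 * (q * q) + + 17 * (+ 4 * q) - + 64)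
    collect = solve-∀
    after : ∀ x y z i → + 15 * (+ 29 * (+ 64 * x) - + 33 * (+ 64 * y) + + 17 * (+ 64 * z) - + 64) * (i * i - i) ≡
      + 480 * (+ 2 * i * ((+ 29 * x - + 33 * y + + 17 * z - 1ℤ) * (i - 1ℤ)))
    after = solve-∀

-- The seven weights and their indices

module Indices {c ℓ} (s : ℕ) (3≤s : 3 ℕ.≤ s) (F : FiniteField c ℓ (2 ℕ.^ (2 ℕ.* s))) where
  open Transport s 3≤s F
  open Powers s 3≤s
  open Identities

  Q : ℤ
  Q = + q

  -- Combines the double count λ q(q - 1) = S (i² - i) with k S = q N and d N = R, where N is
  -- `rankCount k`; then q cancels. As (q - 2i)² = qk, the condition on k keeps q - 2i nonzero.
  index-equation : ∀ i {I} k {d R} → + i ≡ I → (Q - + 2 * I) * (Q - + 2 * I) ≡ Q * k → k ≢ 0ℤ → d * rankCount k ≡ R →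
    d * k * + λ₂ i * (Q - 1ℤ) ≡ R * (I * I - I)
  index-equation i k {d} {R} refl ω²≡ k≢0 N≡ = cancel-factor Q (d * k * l * (Q - 1ℤ)) (R * (I * I - I)) (begin
    Q * (d * k * l * (Q - 1ℤ))                ≡⟨ before Q d k l (Q - 1ℤ) ⟩
    d * k * (l * (Q * (Q - 1ℤ)))              ≡⟨ cong (d * k *_) (λ₂-formula i) ⟩
    d * k * (S * (I * I - I))                 ≡⟨ middle d k S (I * I - I) ⟩
    d * (k * S) * (I * I - I)                 ≡⟨ cong (λ x → d * x * (I * I - I)) (signedCount-≢0 (Q - + 2 * I) k ω≢0 ω²≡) ⟩
    d * (Q * rankCount k) * (I * I - I)       ≡⟨ after d Q (rankCount k) (I * I - I) ⟩
    Q * (d * rankCount k * (I * I - I))       ≡⟨ cong (λ x → Q * (x * (I * I - I))) N≡ ⟩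
    Q * (R * (I * I - I))                     ∎)
    where
    I l S : ℤ
    I = + i
    l = + λ₂ i
    S = signedCount (Q - + 2 * I)
    ω≢0 : Q - + 2 * I ≢ 0ℤ
    ω≢0 ω≡0 = k≢0 (cancel-factor Q k 0ℤ (begin
      Q * k                                   ≡⟨ sym ω²≡ ⟩
      (Q - + 2 * I) * (Q - + 2 * I)           ≡⟨ cong (λ x → x * x) ω≡0 ⟩
      0ℤ                                      ≡⟨ sym (ℤ.*-zeroʳ Q) ⟩
      Q * 0ℤ                                  ∎))
    before : ∀ q d k l p → q * (d * k * l * p) ≡ d * k * (l * (q * p))
    before = solve-∀
    middle : ∀ d k S x → d * k * (S * x) ≡ d * (k * S) * x
    middle = solve-∀
    after : ∀ d q n x → d * (q * n) * x ≡ q * (d * n * x)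
    after = solve-∀

  1≤2^ : ∀ e → 1 ℕ.≤ 2 ℕ.^ e
  1≤2^ e = ℕ.m^n>0 2 e

  instance
    2^s∸1-nonZero : ℕ.NonZero (2 ℕ.^ s ℕ.∸ 1)
    2^s∸1-nonZero = ℕ.>-nonZero (ℕ.m<n⇒0<n∸m (ℕ.^-monoʳ-≤ 2 (ℕ.≤-trans (s≤s {0} z≤n) 3≤s)))

    2^s+1-nonZero : ℕ.NonZero (2 ℕ.^ s ℕ.+ 1)
    2^s+1-nonZero = ℕ.>-nonZero (ℕ.m≤n+m 1 (2 ℕ.^ s))

    q∸1-nonZero : ℕ.NonZero (q ℕ.∸ 1)
    q∸1-nonZero = ℕ.>-nonZero (ℕ.m<n⇒0<n∸m (ℕ.^-monoʳ-≤ 2 (ℕ.≤-trans (ℕ.≤-trans (s≤s {0} z≤n) 3≤s) (ℕ.m≤n*m s 2))))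

  [q∸1] : + (q ℕ.∸ 1) ≡ Q - 1ℤ
  [q∸1] = pos-∸ (1≤2^ (2 ℕ.* s))

  instance
    Q-1-nonZero : ℤ.NonZero (Q - 1ℤ)
    Q-1-nonZero = subst ℤ.NonZero [q∸1] q∸1-nonZero

  D₋ D₊ H h : ℤ
  D₋ = + (2 ℕ.^ s ℕ.∸ 1)
  D₊ = + (2 ℕ.^ s ℕ.+ 1)
  H = + half
  h = + (2 ℕ.^ (s ℕ.∸ 1))

  [D₋] : D₋ ≡ + 8 * U - 1ℤ
  [D₋] = trans (pos-∸ (1≤2^ s)) (cong (λ x → x - 1ℤ) [s])

  [D₊] : D₊ ≡ + 8 * U + 1ℤ
  [D₊] = trans (ℤ.pos-+ (2 ℕ.^ s) 1) (cong (λ x → x + 1ℤ) [s])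

  D₋D₊ : Q - 1ℤ ≡ D₋ * D₊
  D₋D₊ = trans (cong (λ x → x - 1ℤ) [2s]) (trans (difference U) (sym (cong₂ _*_ [D₋] [D₊])))
    where
    difference : ∀ U → + 64 * (U * U) - 1ℤ ≡ (+ 8 * U - 1ℤ) * (+ 8 * U + 1ℤ)
    difference = solve-∀

  Q² : Q * Q ≡ + (2 ℕ.^ (4 ℕ.* s))
  Q² = trans (cong (λ x → x * x) [2s]) (trans (regroup (+ 64) (U * U)) (sym [4s]))
    where
    regroup : ∀ k x → k * x * (k * x) ≡ k * k * (x * x)
    regroup = solve-∀

  -- With q = 64 U² the seven weights i are 32 U² + δ for δ = 0, ±4 U, ±8 U, ±16 U, so q - 2 i = -2 δ.
  ω² : ∀ δ k → + 4 * (δ * δ) ≡ + 64 * (U * U) * k → (Q - + 2 * (H + δ)) * (Q - + 2 * (H + δ)) ≡ Q * k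
  ω² δ k δ²≡ = begin
    (Q - + 2 * (H + δ)) * (Q - + 2 * (H + δ))
      ≡⟨ cong₂ (λ q i → (q - + 2 * (i + δ)) * (q - + 2 * (i + δ))) [2s] [2s-1] ⟩
    (+ 64 * (U * U) - + 2 * (+ 32 * (U * U) + δ)) * (+ 64 * (U * U) - + 2 * (+ 32 * (U * U) + δ))
      ≡⟨ square U δ ⟩
    + 4 * (δ * δ)          ≡⟨ δ²≡ ⟩
    + 64 * (U * U) * k     ≡⟨ cong (_* k) (sym [2s]) ⟩
    Q * k                  ∎
    where
    square : ∀ U δ → (+ 64 * (U * U) - + 2 * (+ 32 * (U * U) + δ)) * (+ 64 * (U * U) - + 2 * (+ 32 * (U * U) + δ)) ≡ + 4 * (δ * δ)
    square = solve-∀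

  δ²⁺ : ∀ {δ} m → δ ≡ + m * U → ∀ k → (∀ U → + 4 * (+ m * U * (+ m * U)) ≡ + 64 * (U * U) * k) → + 4 * (δ * δ) ≡ + 64 * (U * U) * k
  δ²⁺ m refl k e = e U

  δ²⁻ : ∀ {δ} m → δ ≡ + m * U → ∀ k → (∀ U → + 4 * (+ m * U * (+ m * U)) ≡ + 64 * (U * U) * k) → + 4 * (- δ * - δ) ≡ + 64 * (U * U) * k
  δ²⁻ m refl k e = trans (cong (+ 4 *_) (even (+ m * U))) (e U)
    where
    even : ∀ x → - x * - x ≡ x * x
    even = solve-∀

  by-4U : ∀ U → + 4 * (+ 4 * U * (+ 4 * U)) ≡ + 64 * (U * U) * + 1
  by-4U = solve-∀
  by-8U : ∀ U → + 4 * (+ 8 * U * (+ 8 * U)) ≡ + 64 * (U * U) * + 4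
  by-8U = solve-∀
  by-16U : ∀ U → + 4 * (+ 16 * U * (+ 16 * U)) ≡ + 64 * (U * U) * + 16
  by-16U = solve-∀

  1≤s : 1 ℕ.≤ s
  1≤s = ℕ.≤-trans (s≤s z≤n) 3≤s

  module Oₐ = Offset {s ℕ.∸ 1} (ℕ.∸-monoˡ-≤ 1 (ℕ.≤-trans (ℕ.n≤1+n 2) 3≤s)) (ℕ.≤-trans (ℕ.m∸n≤m s 1) (ℕ.m≤m+n s 1))
  module Oᵦ = Offset {s} 1≤s (ℕ.m≤m+n s 1)
  module Oᵧ = Offset {s ℕ.+ 1} (ℕ.m≤n+m 1 s) ℕ.≤-refl

  open Parameters s 3≤s using (2^; weightsWithIndices)

  IsIndexed : ℕ → ℚ → Set _
  IsIndexed i r = IsDesignℚ 2 q i r (FiniteField.Supports F (Code.code (2 ℕ.* s) F) i)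

  indexed : ∀ i {r} → 2 ℕ.≤ i → i ℕ.≤ q → + λ₂ i / 1 ≡ r → IsIndexed i r
  indexed i 2≤i i≤q r≡ = λ₂ i , r≡ , design i 2≤i i≤q

  rankCount-1′ : + 15 * rankCount (+ 1) ≡ + 2 * (+ 3 * 2^ (4 ℕ.* s) + + 5 * 2^ (2 ℕ.* s) - + 8)
  rankCount-1′ = trans rankCount-1 (cong (λ x → + 2 * (+ 3 * x + + 5 * Q - + 8)) Q²)

  index-a⁻ : + λ₂ (half ℕ.∸ 2 ℕ.^ (s ℕ.∸ 1)) * (+ 15 * D₊) ≡
    + 2 * (h * (+ 3 * 2^ (4 ℕ.* s) + + 5 * 2^ (2 ℕ.* s) - + 8) * (H - h - 1ℤ))
  index-a⁻ = weight-a {Q} {H - h} (+ λ₂ i) D₋ D₊ h (+ 3 * 2^ (4 ℕ.* s) + + 5 * 2^ (2 ℕ.* s) - + 8) i≡ D₋D₊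
    (index-equation i {H - h} (+ 1) {+ 15} {+ 2 * (+ 3 * 2^ (4 ℕ.* s) + + 5 * 2^ (2 ℕ.* s) - + 8)} Oₐ.[half-2^e] (ω² (- h) (+ 1) (δ²⁻ 4 [s-1] (+ 1) by-4U)) (λ ()) rankCount-1′)
    where
    i = half ℕ.∸ 2 ℕ.^ (s ℕ.∸ 1)
    factor : ∀ U → + 32 * (U * U) - + 4 * U ≡ + 4 * U * (+ 8 * U - 1ℤ)
    factor = solve-∀
    i≡ : H - h ≡ h * D₋
    i≡ = trans (cong₂ _-_ [2s-1] [s-1]) (trans (factor U) (sym (cong₂ _*_ [s-1] [D₋])))

  index-a⁺ : + λ₂ (half ℕ.+ 2 ℕ.^ (s ℕ.∸ 1)) * (+ 15 * D₋) ≡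
    + 2 * (h * (+ 3 * 2^ (4 ℕ.* s) + + 5 * 2^ (2 ℕ.* s) - + 8) * (H + h - 1ℤ))
  index-a⁺ = weight-a {Q} {H + h} (+ λ₂ i) D₊ D₋ h (+ 3 * 2^ (4 ℕ.* s) + + 5 * 2^ (2 ℕ.* s) - + 8) i≡ (trans D₋D₊ (ℤ.*-comm D₋ D₊))
    (index-equation i {H + h} (+ 1) {+ 15} {+ 2 * (+ 3 * 2^ (4 ℕ.* s) + + 5 * 2^ (2 ℕ.* s) - + 8)} Oₐ.[half+2^e] (ω² h (+ 1) (δ²⁺ 4 [s-1] (+ 1) by-4U)) (λ ()) rankCount-1′)
    where
    i = half ℕ.+ 2 ℕ.^ (s ℕ.∸ 1)
    factor : ∀ U → + 32 * (U * U) + + 4 * U ≡ + 4 * U * (+ 8 * U + 1ℤ)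
    factor = solve-∀
    i≡ : H + h ≡ h * D₊
    i≡ = trans (cong₂ _+_ [2s-1] [s-1]) (trans (factor U) (sym (cong₂ _*_ [s-1] [D₊])))

  Q*2^s : Q * 2^ s ≡ + 16 * 2^ (3 ℕ.* s ℕ.∸ 4)
  Q*2^s = trans (cong₂ _*_ [2s] [s]) (trans (regroup (+ 64) (+ 8) U) (trans (ℤ.*-assoc (+ 16) (+ 32) (U * U * U)) (cong (+ 16 *_) (sym [3s-4]))))
    where
    regroup : ∀ k l U → k * (U * U) * (l * U) ≡ k * l * (U * U * U)
    regroup = solve-∀

  index-b⁻ : + λ₂ (half ℕ.∸ 2 ℕ.^ s) * (+ 3 * 1ℤ) ≡ + 7 * (2^ (3 ℕ.* s ℕ.∸ 4) * (H - 2^ s - 1ℤ) * (h - 1ℤ))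
  index-b⁻ = weight-b {Q} {H - 2^ s} (+ λ₂ i) (h - 1ℤ) (2^ s) (2^ (3 ℕ.* s ℕ.∸ 4)) i≡ Q*2^s
    (index-equation i {H - 2^ s} (+ 4) {+ 12} {+ 7 * (Q * (Q - + 1))} Oᵦ.[half-2^e] (ω² (- (2^ s)) (+ 4) (δ²⁻ 8 [s] (+ 4) by-8U)) (λ ()) rankCount-4)
    where
    i = half ℕ.∸ 2 ℕ.^ s
    factor : ∀ U → + 32 * (U * U) - + 8 * U ≡ + 8 * U * (+ 4 * U - 1ℤ)
    factor = solve-∀
    i≡ : H - 2^ s ≡ 2^ s * (h - 1ℤ)
    i≡ = trans (cong₂ _-_ [2s-1] [s]) (trans (factor U) (sym (cong₂ (λ x y → x * (y - 1ℤ)) [s] [s-1])))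

  index-b⁺ : + λ₂ (half ℕ.+ 2 ℕ.^ s) * (+ 3 * 1ℤ) ≡ + 7 * (2^ (3 ℕ.* s ℕ.∸ 4) * (H + 2^ s - 1ℤ) * (h + 1ℤ))
  index-b⁺ = weight-b {Q} {H + 2^ s} (+ λ₂ i) (h + 1ℤ) (2^ s) (2^ (3 ℕ.* s ℕ.∸ 4)) i≡ Q*2^s
    (index-equation i {H + 2^ s} (+ 4) {+ 12} {+ 7 * (Q * (Q - + 1))} Oᵦ.[half+2^e] (ω² (2^ s) (+ 4) (δ²⁺ 8 [s] (+ 4) by-8U)) (λ ()) rankCount-4)
    where
    i = half ℕ.+ 2 ℕ.^ s
    factor : ∀ U → + 32 * (U * U) + + 8 * U ≡ + 8 * U * (+ 4 * U + 1ℤ)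
    factor = solve-∀
    i≡ : H + 2^ s ≡ 2^ s * (h + 1ℤ)
    i≡ = trans (cong₂ _+_ [2s-1] [s]) (trans (factor U) (sym (cong₂ (λ x y → x * (y + 1ℤ)) [s] [s-1])))

  -- In terms of x = q / 4 the left side is 4(4x² - 5x + 1), and 4x² = 2^(4s - 2).
  [Q-1][Q-4] : (Q - 1ℤ) * (Q - + 4) ≡ + 4 * (2^ (4 ℕ.* s ℕ.∸ 2) - + 5 * 2^ (2 ℕ.* s ℕ.∸ 2) + 1ℤ)
  [Q-1][Q-4] = trans (cong (λ x → (x - 1ℤ) * (x - + 4)) Q≡4x) (trans (regroup x) (cong (λ y → + 4 * (y - + 5 * x + 1ℤ)) 4x²≡))
    where
    x : ℤ
    x = 2^ (2 ℕ.* s ℕ.∸ 2)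
    Q≡4x : Q ≡ + 4 * x
    Q≡4x = trans [2s] (trans (ℤ.*-assoc (+ 4) (+ 16) (U * U)) (cong (+ 4 *_) (sym [2s-2])))
    collect : ∀ k l y → k * (l * y * (l * y)) ≡ k * (l * l) * (y * y)
    collect = solve-∀
    4x²≡ : + 4 * (x * x) ≡ 2^ (4 ℕ.* s ℕ.∸ 2)
    4x²≡ = trans (cong (λ x → + 4 * (x * x)) [2s-2]) (trans (collect (+ 4) (+ 16) (U * U)) (sym [4s-2]))
    regroup : ∀ x → (+ 4 * x - 1ℤ) * (+ 4 * x - + 4) ≡ + 4 * (+ 4 * (x * x) - + 5 * x + 1ℤ)
    regroup = solve-∀

  index-c⁻ : + λ₂ (half ℕ.∸ 2 ℕ.^ (s ℕ.+ 1)) * (+ 15 * + (q ℕ.∸ 1)) ≡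
    + 1 * (2^ (s ℕ.∸ 3) * (2^ (4 ℕ.* s ℕ.∸ 2) - + 5 * 2^ (2 ℕ.* s ℕ.∸ 2) + 1ℤ) * (H - 2^ (s ℕ.+ 1) - 1ℤ) * (2^ (s ℕ.∸ 2) - 1ℤ))
  index-c⁻ = trans (cong (λ x → + λ₂ i * (+ 15 * x)) [q∸1])
    (weight-c {Q} {H - 2^ (s ℕ.+ 1)} (+ λ₂ i) (2^ (s ℕ.∸ 2) - 1ℤ) (2^ (s ℕ.∸ 3)) (2^ (4 ℕ.* s ℕ.∸ 2) - + 5 * 2^ (2 ℕ.* s ℕ.∸ 2) + 1ℤ) i≡ [Q-1][Q-4]
    (index-equation i {H - 2^ (s ℕ.+ 1)} (+ 16) {+ 60} {(Q - + 1) * (Q - + 4)} Oᵧ.[half-2^e] (ω² (- (2^ (s ℕ.+ 1))) (+ 16) (δ²⁻ 16 [s+1] (+ 16) by-16U)) (λ ()) rankCount-16))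
    where
    i = half ℕ.∸ 2 ℕ.^ (s ℕ.+ 1)
    factor : ∀ U → + 32 * (U * U) - + 16 * U ≡ + 16 * (1ℤ * U) * (+ 2 * U - 1ℤ)
    factor = solve-∀
    i≡ : H - 2^ (s ℕ.+ 1) ≡ + 16 * 2^ (s ℕ.∸ 3) * (2^ (s ℕ.∸ 2) - 1ℤ)
    i≡ = trans (cong₂ _-_ [2s-1] [s+1]) (trans (factor U) (sym (cong₂ (λ x y → + 16 * x * (y - 1ℤ)) [s-3] [s-2])))

  index-c⁺ : + λ₂ (half ℕ.+ 2 ℕ.^ (s ℕ.+ 1)) * (+ 15 * + (q ℕ.∸ 1)) ≡
    + 1 * (2^ (s ℕ.∸ 3) * (2^ (4 ℕ.* s ℕ.∸ 2) - + 5 * 2^ (2 ℕ.* s ℕ.∸ 2) + 1ℤ) * (H + 2^ (s ℕ.+ 1) - 1ℤ) * (2^ (s ℕ.∸ 2) + 1ℤ))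
  index-c⁺ = trans (cong (λ x → + λ₂ i * (+ 15 * x)) [q∸1])
    (weight-c {Q} {H + 2^ (s ℕ.+ 1)} (+ λ₂ i) (2^ (s ℕ.∸ 2) + 1ℤ) (2^ (s ℕ.∸ 3)) (2^ (4 ℕ.* s ℕ.∸ 2) - + 5 * 2^ (2 ℕ.* s ℕ.∸ 2) + 1ℤ) i≡ [Q-1][Q-4]
    (index-equation i {H + 2^ (s ℕ.+ 1)} (+ 16) {+ 60} {(Q - + 1) * (Q - + 4)} Oᵧ.[half+2^e] (ω² (2^ (s ℕ.+ 1)) (+ 16) (δ²⁺ 16 [s+1] (+ 16) by-16U)) (λ ()) rankCount-16))
    where
    i = half ℕ.+ 2 ℕ.^ (s ℕ.+ 1)
    factor : ∀ U → + 32 * (U * U) + + 16 * U ≡ + 16 * (1ℤ * U) * (+ 2 * U + 1ℤ)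
    factor = solve-∀
    i≡ : H + 2^ (s ℕ.+ 1) ≡ + 16 * 2^ (s ℕ.∸ 3) * (2^ (s ℕ.∸ 2) + 1ℤ)
    i≡ = trans (cong₂ _+_ [2s-1] [s+1]) (trans (factor U) (sym (cong₂ (λ x y → + 16 * x * (y + 1ℤ)) [s-3] [s-2])))

  Q≡2H : Q ≡ + 2 * H
  Q≡2H = trans (cong +_ (sym half+half)) (trans (ℤ.pos-+ half half) (double H))
    where
    double : ∀ x → x + x ≡ + 2 * x
    double = solve-∀

  -- The weight q / 2 belongs to V = 0, where comparison with ω² gives no information; the count of
  -- vanishing V, to which all radical sizes contribute, takes its place.
  index-0 : + λ₂ half * + (q ℕ.∸ 1) ≡
    (+ 29 * 2^ (6 ℕ.* s ℕ.∸ 6) - + 33 * 2^ (4 ℕ.* s ℕ.∸ 6) + + 17 * 2^ (2 ℕ.* s ℕ.∸ 4) - 1ℤ) * (H - 1ℤ)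
  index-0 = trans (cong (+ λ₂ half *_) [q∸1])
    (weight-0 {Q} {H} (+ λ₂ half) (signedCount 0ℤ) (rankCount (+ 1)) (rankCount (+ 4)) (rankCount (+ 16))
      (2^ (6 ℕ.* s ℕ.∸ 6)) (2^ (4 ℕ.* s ℕ.∸ 6)) (2^ (2 ℕ.* s ℕ.∸ 4)) Q≡2H
      (trans (cong (λ x → x * (x * x)) [2s]) (trans (cube (+ 64) U) (cong (+ 64 *_) (sym [6s-6]))))
      (trans (cong (λ x → x * x) [2s]) (trans (square (+ 64) (U * U)) (cong (+ 64 *_) (sym [4s-6]))))
      (trans (cong (+ 4 *_) [2s]) (trans (linear (+ 4) (+ 64) (U * U)) (cong (+ 64 *_) (sym [2s-4]))))
      (trans (λ₂-formula half) (cong (λ ω → signedCount ω * (H * H - H)) Q-2H≡0))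
      signedCount-0 rankCount-1 rankCount-4 rankCount-16)
    where
    Q-2H≡0 : Q - + 2 * H ≡ 0ℤ
    Q-2H≡0 = ℤ.i≡j⇒i-j≡0 {Q} {+ 2 * H} Q≡2H
    cube : ∀ k U → k * (U * U) * (k * (U * U) * (k * (U * U))) ≡ k * (k * k * (U * U * U * (U * U * U)))
    cube = solve-∀
    square : ∀ k x → k * x * (k * x) ≡ k * (k * (x * x))
    square = solve-∀
    linear : ∀ k l x → k * (l * x) ≡ l * (k * x)
    linear = solve-∀

  2≤half : 2 ℕ.≤ half
  2≤half = ℕ.m+n≤o⇒m≤o 2 Oₐ.2+2^e≤half

  half≤q : half ℕ.≤ q
  half≤q = ℕ.≤-trans (ℕ.m≤m+n half half) (ℕ.≤-reflexive half+half)

  designs : All (λ (i , r) → IsIndexed i r) weightsWithIndices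
  designs =
    indexed half 2≤half half≤q (/-≡ (λ₂ half)
      ((+ 29 * 2^ (6 ℕ.* s ℕ.∸ 6) - + 33 * 2^ (4 ℕ.* s ℕ.∸ 6) + + 17 * 2^ (2 ℕ.* s ℕ.∸ 4) - 1ℤ) * (H - 1ℤ)) (q ℕ.∸ 1) index-0) ∷
    indexed (half ℕ.∸ 2 ℕ.^ (s ℕ.∸ 1)) Oₐ.2≤half-2^e Oₐ.half-2^e≤q (/-*-≡ (λ₂ (half ℕ.∸ 2 ℕ.^ (s ℕ.∸ 1))) (+ 2) 15
      (h * (+ 3 * 2^ (4 ℕ.* s) + + 5 * 2^ (2 ℕ.* s) - + 8) * (H - h - 1ℤ)) (2 ℕ.^ s ℕ.+ 1) index-a⁻) ∷
    indexed (half ℕ.+ 2 ℕ.^ (s ℕ.∸ 1)) Oₐ.2≤half+2^e Oₐ.half+2^e≤q (/-*-≡ (λ₂ (half ℕ.+ 2 ℕ.^ (s ℕ.∸ 1))) (+ 2) 15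
      (h * (+ 3 * 2^ (4 ℕ.* s) + + 5 * 2^ (2 ℕ.* s) - + 8) * (H + h - 1ℤ)) (2 ℕ.^ s ℕ.∸ 1) index-a⁺) ∷
    indexed (half ℕ.∸ 2 ℕ.^ s) Oᵦ.2≤half-2^e Oᵦ.half-2^e≤q (/-*-≡ (λ₂ (half ℕ.∸ 2 ℕ.^ s)) (+ 7) 3
      (2^ (3 ℕ.* s ℕ.∸ 4) * (H - 2^ s - 1ℤ) * (h - 1ℤ)) 1 index-b⁻) ∷
    indexed (half ℕ.+ 2 ℕ.^ s) Oᵦ.2≤half+2^e Oᵦ.half+2^e≤q (/-*-≡ (λ₂ (half ℕ.+ 2 ℕ.^ s)) (+ 7) 3
      (2^ (3 ℕ.* s ℕ.∸ 4) * (H + 2^ s - 1ℤ) * (h + 1ℤ)) 1 index-b⁺) ∷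
    indexed (half ℕ.∸ 2 ℕ.^ (s ℕ.+ 1)) Oᵧ.2≤half-2^e Oᵧ.half-2^e≤q (/-*-≡ (λ₂ (half ℕ.∸ 2 ℕ.^ (s ℕ.+ 1))) (+ 1) 15
      (2^ (s ℕ.∸ 3) * (2^ (4 ℕ.* s ℕ.∸ 2) - + 5 * 2^ (2 ℕ.* s ℕ.∸ 2) + 1ℤ) * (H - 2^ (s ℕ.+ 1) - 1ℤ) * (2^ (s ℕ.∸ 2) - 1ℤ)) (q ℕ.∸ 1) index-c⁻) ∷
    indexed (half ℕ.+ 2 ℕ.^ (s ℕ.+ 1)) Oᵧ.2≤half+2^e Oᵧ.half+2^e≤q (/-*-≡ (λ₂ (half ℕ.+ 2 ℕ.^ (s ℕ.+ 1))) (+ 1) 15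
      (2^ (s ℕ.∸ 3) * (2^ (4 ℕ.* s ℕ.∸ 2) - + 5 * 2^ (2 ℕ.* s ℕ.∸ 2) + 1ℤ) * (H + 2^ (s ℕ.+ 1) - 1ℤ) * (2^ (s ℕ.∸ 2) + 1ℤ)) (q ℕ.∸ 1) index-c⁺) ∷ []

theorem5 : ∀ {c ℓ} (s : ℕ) (3≤s : 3 ℕ.≤ s) (F : FiniteField c ℓ (2 ℕ.^ (2 ℕ.* s))) →
    let open FiniteField F using (weight)
        open FiniteField F using (Supports)
        open Code (2 ℕ.* s) F using (code)
        open Parameters s 3≤s using (weightsWithIndices)
    in
    (∀ i → 1 ℕ.≤ i → (∃[ w ] (code w × weight w ≡ i)) →
       IsTDesign 2 (Supports code i))
    ×
    All (λ (i , r) → IsDesignℚ 2 (2 ℕ.^ (2 ℕ.* s)) i r (Supports code i))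
        weightsWithIndices
theorem5 s 3≤s F = Transport.design-of-weight s 3≤s F , Indices.designs s 3≤s F
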